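{- Let $q\ge5$ be a prime power. Then $\Lambda_{\mathrm{Un}\Gamma,3_{\mathcal C}}=3(q-2)$, $\Pi_{3_{\mathcal C},\mathrm{Un}\Gamma}=(q-2)/2$, $\Lambda_{\mathrm{Un}\Gamma,\overline{1_{\mathcal C}}}=q$, and $\Pi_{\overline{1_{\mathcal C}},\mathrm{Un}\Gamma}=q/2$.
   Context: Let $\mathrm{PG}(3,q)$ have points $\mathbf{P}(x_0,x_1,x_2,x_3)$; put $P(t)=\mathbf{P}(t^3,t^2,t,1)$ ($t\in\mathbb{F}_q$), $P(\infty)=\mathbf{P}(1,0,0,0)$, $\mathcal{C}=\{P(t):t\in\mathbb{F}_q\cup\{\infty\}\}$ the twisted cubic, $G_q$ the group of projectivities fixing $\mathcal C$. The $\Gamma$-planes are the osculating planes $c_0x_0+\dots+c_3x_3=0$ with $(c_0,c_1,c_2,c_3)=(1,-3t,3t^2,-t^3)$, $t\in\mathbb{F}_q$, or $(0,0,0,1)$. A $3_{\mathcal C}$-plane contains exactly $3$ points of $\mathcal C$; a $\overline{1_{\mathcal C}}$-plane is a non-$\Gamma$-plane containing exactly one point of $\mathcal C$ (for $q\ge5$ each type is a $G_q$-orbit). A Un$\Gamma$-line is a line meeting $\mathcal C$ in exactly one point and lying in no $\Gamma$-plane. Notation: $\Lambda_{\lambda,\pi}$ is the number of $\lambda$-lines in a $\pi$-plane; $\Pi_{\pi,\lambda}$ is the average, over all $\lambda$-lines, of the number of $\pi$-planes through the line. -}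

module Defs where

open import Data.Nat as ℕ using (ℕ; zero; suc)
open import Data.Bool using (Bool; true; false; if_then_else_; _∧_; _∨_; not)
open import Data.List using (List; []; _∷_; map; concatMap; length)
open import Data.Bool.ListAction using (any)
open import Data.List.Membership.Propositional using (_∈_)
open import Data.List.Relation.Unary.Unique.Propositional using (Unique)
open import Data.Vec using (Vec; []; _∷_; zipWith; foldr)
import Data.Vec.Properties as VecP
open import Data.Fin using (Fin)
open import Data.Product using (_×_; _,_; Σ)
open import Relation.Binary.PropositionalEquality using (_≡_)
open import Relation.Binary.Definitions using (DecidableEquality)
open import Relation.Nullary using (¬_)
open import Relation.Nullary.Decidable using (isYes)
open import Algebra.Structures using (IsCommutativeRing)

record FiniteField : Set₁ where
  infixl 6 _+_
  infixl 7 _*_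
  field
    Carrier  : Set
    _+_ _*_  : Carrier → Carrier → Carrier
    -_       : Carrier → Carrier
    0# 1#    : Carrier
    isCommutativeRing : IsCommutativeRing _≡_ _+_ _*_ -_ 0# 1#
    0≢1      : ¬ (0# ≡ 1#)
    inverse  : ∀ x → ¬ (x ≡ 0#) → Σ Carrier (λ y → x * y ≡ 1#)
    _≟_      : DecidableEquality Carrier
    elements : List Carrier
    complete : ∀ x → x ∈ elements
    unique   : Unique elements

  order : ℕ
  order = length elements

open import Data.Nat.Primality using (Prime)

IsPrimePower : ℕ → Set
IsPrimePower n = Σ ℕ (λ p → Σ ℕ (λ k → Prime p × (n ≡ p ℕ.^ suc k)))

count : ∀ {A : Set} → (A → Bool) → List A → ℕ
count f []       = 0
count f (x ∷ xs) = if f x then suc (count f xs) else count f xs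

sumOver : ∀ {A : Set} → (A → ℕ) → List A → ℕ
sumOver f []       = 0
sumOver f (x ∷ xs) = f x ℕ.+ sumOver f xs

module PG3 (𝔽 : FiniteField) where
  open FiniteField 𝔽

  V4 : Set
  V4 = Vec Carrier 4

  _==_ : Carrier → Carrier → Bool
  x == y = isYes (x ≟ y)

  _==v_ : ∀ {n} → Vec Carrier n → Vec Carrier n → Bool
  u ==v v = isYes (VecP.≡-dec _≟_ u v)

  vectors : (n : ℕ) → List (Vec Carrier n)
  vectors zero    = [] ∷ []
  vectors (suc n) = concatMap (λ x → map (x ∷_) (vectors n)) elements

  dot : V4 → V4 → Carrier
  dot c x = foldr _ _+_ 0# (zipWith _*_ c x)

  scale : Carrier → V4 → V4
  scale a v = Data.Vec.map (a *_) v

  _+v_ : V4 → V4 → V4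
  u +v v = zipWith _+_ u v

  -- a vector is "normalised" if it is nonzero and its first nonzero
  -- coordinate equals 1.  Normalised vectors represent the points
  -- (and, as coefficient vectors, the planes) of PG(3,q) bijectively.
  normalised : ∀ {n} → Vec Carrier n → Bool
  normalised []       = false
  normalised (x ∷ xs) = if x == 0# then normalised xs else x == 1#

  -- Planes of PG(3,q): normalised coefficient vectors (c₀,c₁,c₂,c₃),
  -- the plane being c₀x₀+c₁x₁+c₂x₂+c₃x₃ = 0.
  Plane : Set
  Plane = V4

  planes : List Plane
  planes = Data.List.filterᵇ normalised (vectors 4)

  -- Lines of PG(3,q): a line (2-dimensional subspace of 𝔽⁴) is
  -- represented bijectively by its reduced row echelon basis (r₁ , r₂).
  Line : Set
  Line = V4 × V4

  zeroUpTo : ∀ {n} → ℕ → Vec Carrier n → Bool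
  zeroUpTo zero    _        = true
  zeroUpTo (suc k) []       = true
  zeroUpTo (suc k) (x ∷ xs) = (x == 0#) ∧ zeroUpTo k xs

  coord : ∀ {n} → ℕ → Vec Carrier n → Carrier
  coord _       []       = 0#
  coord zero    (x ∷ xs) = x
  coord (suc k) (x ∷ xs) = coord k xs

  rrefWith : ℕ → ℕ → Line → Bool
  rrefWith i j (r₁ , r₂) =
    zeroUpTo i r₁ ∧ (coord i r₁ == 1#) ∧
    zeroUpTo j r₂ ∧ (coord j r₂ == 1#) ∧ (coord j r₁ == 0#)

  isRREF : Line → Bool
  isRREF ℓ = any (λ ij → rrefWith (Data.Product.proj₁ ij) (Data.Product.proj₂ ij) ℓ)
    ((0 , 1) ∷ (0 , 2) ∷ (0 , 3) ∷ (1 , 2) ∷ (1 , 3) ∷ (2 , 3) ∷ [])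

  lines : List Line
  lines = Data.List.filterᵇ isRREF
    (concatMap (λ r₁ → map (r₁ ,_) (vectors 4)) (vectors 4))

  onPlane : V4 → Plane → Bool
  onPlane v c = dot c v == 0#

  onLine : V4 → Line → Bool
  onLine v (r₁ , r₂) =
    any (λ a → any (λ b → v ==v (scale a r₁ +v scale b r₂)) elements) elements

  lineInPlane : Line → Plane → Bool
  lineInPlane (r₁ , r₂) c = onPlane r₁ c ∧ onPlane r₂ c

  -- The twisted cubic  C = { P(t) : t ∈ 𝔽 ∪ {∞} }

  3# : Carrier
  3# = 1# + 1# + 1#

  P : Carrier → V4
  P t = (t * t * t) ∷ (t * t) ∷ t ∷ 1# ∷ []

  P∞ : V4
  P∞ = 1# ∷ 0# ∷ 0# ∷ 0# ∷ []

  -- number of points of C satisfying a test (t ranging over 𝔽 ∪ {∞};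
  -- the points P(t) are pairwise distinct)
  countC : (V4 → Bool) → ℕ
  countC f = count (λ t → f (P t)) elements ℕ.+ (if f P∞ then 1 else 0)

  -- Γ-planes: osculating planes with coefficients (1,-3t,3t²,-t³), t ∈ 𝔽,
  -- and (0,0,0,1).  Both are already normalised.
  Γ : Carrier → Plane
  Γ t = 1# ∷ (- (3# * t)) ∷ (3# * (t * t)) ∷ (- (t * t * t)) ∷ []

  Γ∞ : Plane
  Γ∞ = 0# ∷ 0# ∷ 0# ∷ 1# ∷ []

  isΓPlane : Plane → Bool
  isΓPlane c = any (λ t → c ==v Γ t) elements ∨ (c ==v Γ∞)

  is3CPlane : Plane → Bool
  is3CPlane c = isYes (countC (λ v → onPlane v c) ℕ.≟ 3)

  is1CbarPlane : Plane → Bool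
  is1CbarPlane c = not (isΓPlane c) ∧ isYes (countC (λ v → onPlane v c) ℕ.≟ 1)

  inSomeΓPlane : Line → Bool
  inSomeΓPlane ℓ = any (λ t → lineInPlane ℓ (Γ t)) elements ∨ lineInPlane ℓ Γ∞

  isUnΓLine : Line → Bool
  isUnΓLine ℓ = isYes (countC (λ v → onLine v ℓ) ℕ.≟ 1) ∧ not (inSomeΓPlane ℓ)

  unΓLines : List Line
  unΓLines = Data.List.filterᵇ isUnΓLine lines

  ΛUnΓ : Plane → ℕ
  ΛUnΓ c = count (λ ℓ → lineInPlane ℓ c) unΓLines

  planesThrough : (Plane → Bool) → Line → ℕ
  planesThrough isType ℓ = count (λ c → isType c ∧ lineInPlane ℓ c) planes

  -- Σ over all UnΓ-lines of the number of π-planes through the line;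
  -- Π_{π,UnΓ} = totalIncidences / (number of UnΓ-lines)
  totalIncidences : (Plane → Bool) → ℕ
  totalIncidences isType = sumOver (planesThrough isType) unΓLines

q : FiniteField → ℕ
q 𝔽 = FiniteField.order 𝔽

-- Let X be a point of the cubic. No osculating plane other than Γ_X contains X, and no line
-- meets the cubic in three points, so a line through X either lies in Γ_X, or is one of the q
-- chords through X, or is a UnΓ-line. In a non-Γ-plane with m + 1 points of the cubic, the
-- q + 1 lines through such a point are thus one line of Γ_X, m chords and q − m UnΓ-lines; in
-- space, the q² + q + 1 lines through X are q + 1 lines of Γ_X, q chords and q² − q UnΓ-lines.
-- Hence both values of Λ, and the number (q + 1)q(q − 1) of UnΓ-lines.
--
-- Counting incidences from the side of the planes, the averages reduce to the numbers of planes
-- of each type. These follow from the first three factorial moments of the number of points of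
-- the cubic on a plane, which determine its distribution because any four points of the cubic
-- are independent, so that no plane contains more than three.
--
-- Lines and planes are given by normal forms, but all counts are reduced to counts of vectors:
-- a linear condition that is not implied by the previous ones divides the number of solutions
-- by q.

module Submission where

open import Defs
open import Algebra.Bundles using (CommutativeRing; RawRing)
import Algebra.Properties.CommutativeSemigroup
import Algebra.Properties.Ring
import Algebra.Properties.Semiring.Mult.TCOptimised
import Algebra.Solver.Ring
open import Algebra.Solver.Ring.AlmostCommutativeRing using (AlmostCommutativeRing; _-Raw-AlmostCommutative⟶_; fromCommutativeRing)
open import Data.Bool using (Bool; true; false; _∧_; _∨_; not; T; if_then_else_)
open import Data.Bool.ListAction using (any)
import Data.Bool.Properties as Boolₚ
open import Data.Empty using (⊥-elim)
open import Data.List as List using (List; []; _∷_; _++_; map; concatMap; length; filterᵇ)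
open import Data.List.Membership.Propositional using (_∈_)
open import Data.List.Relation.Unary.All as All using (All; []; _∷_)
open import Data.List.Relation.Unary.AllPairs using ([]; _∷_)
open import Data.List.Relation.Unary.Any using (here; there)
open import Data.List.Relation.Unary.Unique.Propositional using (Unique)
open import Data.Maybe using (Maybe; just; nothing)
import Data.Maybe.Properties as MaybeP
open import Data.Nat as ℕ using (ℕ; zero; suc; s≤s; z≤n)
import Data.Nat.Properties as ℕₚ
open import Data.Nat.Tactic.RingSolver using (solve-∀)
open import Data.Product using (_×_; _,_; proj₁; proj₂; ∃; ∃₂)
import Data.Product.Properties as ProductP
open import Data.Sum using (_⊎_; inj₁; inj₂; reduce)
open import Data.Vec as Vec using (Vec; []; _∷_; foldr; zipWith)
import Data.Vec.Properties as VecP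
open import Function using (_∘_)
open import Relation.Binary.Definitions using (DecidableEquality; tri<; tri≈; tri>)
open import Relation.Binary.PropositionalEquality
open import Relation.Nullary using (¬_; Dec; yes; no)
open import Relation.Nullary.Decidable using (isYes)

-- One construction supplies the geometry of the cubic. The coordinates of P(t) are the monomials of
-- degree at most three, so a plane is a binary cubic form in the parameter and contains exactly the
-- points at the zeros of that form. A product of three linear forms is thus a plane that meets the
-- cubic precisely at three prescribed parameters, repetitions allowed. The cube of a form is an
-- osculating plane, and suitable products witness that two points are independent, that a line has
-- no third point, and that each of up to four points is a new condition on planes. Nothing is
-- divided by 2 or 3, so all characteristics are treated alike.
--
-- The averages come out exactly because of a coincidence: the number (q + 1)q(q - 1) of UnΓ-lines
-- is also the number of ordered triples of distinct points of the cubic, and this is both 6 times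
-- the number of planes with three points and 2 times the number of non-osculating planes with one.
--
-- Since all counts live in ℕ, equations carry their negative terms on the other side, and quotients
-- are obtained by cancelling a nonzero factor.

-- Sums of indicators over lists, and factorial moments.

module Sums where
  open import Data.Nat using (_+_; _*_; _≤_)
  open import Data.Nat.Properties
  open ≡-Reasoning

  ι : Bool → ℕ
  ι true  = 1
  ι false = 0

  ι-∧ : ∀ a b → ι (a ∧ b) ≡ ι a * ι b
  ι-∧ true  b = sym (+-identityʳ (ι b))
  ι-∧ false b = refl

  ι-idem : ∀ a → ι a * ι a ≡ ι a
  ι-idem true  = refl
  ι-idem false = refl

  ι-not : ∀ a → ι a + ι (not a) ≡ 1
  ι-not true  = refl
  ι-not false = refl

  -- An indicator factor acts as a hypothesis: under a sum weighted by a condition, the other factor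
  -- may be rewritten as if the condition held.
  ι-cong* : ∀ b {m n} → (b ≡ true → m ≡ n) → ι b * m ≡ ι b * n
  ι-cong* true  h = cong (1 *_) (h refl)
  ι-cong* false h = refl

  bool-ext : ∀ {a b} → (a ≡ true → b ≡ true) → (b ≡ true → a ≡ true) → a ≡ b
  bool-ext {true}  {b}     f g = sym (f refl)
  bool-ext {false} {true}  f g = g refl
  bool-ext {false} {false} f g = refl

  false≢true : ∀ {b} → b ≡ false → ¬ b ≡ true
  false≢true refl ()

  ≢true⇒≡false : ∀ {b} → ¬ b ≡ true → b ≡ false
  ≢true⇒≡false {true}  h = ⊥-elim (h refl)
  ≢true⇒≡false {false} h = refl

  T⇒≡ : ∀ {b} → T b → b ≡ true
  T⇒≡ {true} _ = refl

  ∧-intro : ∀ {a b} → a ≡ true → b ≡ true → a ∧ b ≡ true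
  ∧-intro refl refl = refl

  ∧-elim : ∀ a {b} → a ∧ b ≡ true → a ≡ true × b ≡ true
  ∧-elim true h = refl , h

  ∨-elim : ∀ a {b} → a ∨ b ≡ true → a ≡ true ⊎ b ≡ true
  ∨-elim true  h = inj₁ refl
  ∨-elim false h = inj₂ h

  ∨-introʳ : ∀ a {b} → b ≡ true → a ∨ b ≡ true
  ∨-introʳ true  h = refl
  ∨-introʳ false h = h

  module _ {P : Set} where

    isYes-intro : (d : Dec P) → P → isYes d ≡ true
    isYes-intro (yes _) p = refl
    isYes-intro (no ¬p) p = ⊥-elim (¬p p)

    isYes-elim : (d : Dec P) → isYes d ≡ true → P
    isYes-elim (yes p) _ = p

    isYes-false : (d : Dec P) → ¬ P → isYes d ≡ false
    isYes-false (yes p) ¬p = ⊥-elim (¬p p)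
    isYes-false (no _)  ¬p = refl

    not-isYes-elim : (d : Dec P) → not (isYes d) ≡ true → ¬ P
    not-isYes-elim (no ¬p) _ = ¬p

    not-isYes-intro : (d : Dec P) → ¬ P → not (isYes d) ≡ true
    not-isYes-intro d ¬p = cong not (isYes-false d ¬p)

  isYes-cong : ∀ {P Q : Set} (d : Dec P) (e : Dec Q) → (P → Q) → (Q → P) → isYes d ≡ isYes e
  isYes-cong d e f g = bool-ext (isYes-intro e ∘ f ∘ isYes-elim d) (isYes-intro d ∘ g ∘ isYes-elim e)

  module _ {A : Set} where

    count≡sum : ∀ f (xs : List A) → count f xs ≡ sumOver (ι ∘ f) xs
    count≡sum f []       = refl
    count≡sum f (x ∷ xs) with f x
    ... | true  = cong suc (count≡sum f xs)
    ... | false = count≡sum f xs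

    sum-cong : {f g : A → ℕ} → (∀ x → f x ≡ g x) → ∀ xs → sumOver f xs ≡ sumOver g xs
    sum-cong h []       = refl
    sum-cong h (x ∷ xs) = cong₂ _+_ (h x) (sum-cong h xs)

    sum-mono : {f g : A → ℕ} → (∀ x → f x ≤ g x) → ∀ xs → sumOver f xs ≤ sumOver g xs
    sum-mono h []       = z≤n
    sum-mono h (x ∷ xs) = +-mono-≤ (h x) (sum-mono h xs)

    sum-const : ∀ k (xs : List A) → sumOver (λ _ → k) xs ≡ length xs * k
    sum-const k []       = refl
    sum-const k (x ∷ xs) = cong (k +_) (sum-const k xs)

    sum-+ : ∀ (f g : A → ℕ) xs → sumOver (λ x → f x + g x) xs ≡ sumOver f xs + sumOver g xs
    sum-+ f g []       = refl
    sum-+ f g (x ∷ xs) rewrite sum-+ f g xs = lemma (f x) (g x) (sumOver f xs) (sumOver g xs)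
      where
      lemma : ∀ a b c d → a + b + (c + d) ≡ a + c + (b + d)
      lemma = solve-∀

    sum-*ˡ : ∀ k (f : A → ℕ) xs → sumOver (λ x → k * f x) xs ≡ k * sumOver f xs
    sum-*ˡ k f []       = sym (*-zeroʳ k)
    sum-*ˡ k f (x ∷ xs) rewrite sum-*ˡ k f xs = sym (*-distribˡ-+ k (f x) (sumOver f xs))

    sum-*ʳ : ∀ (f : A → ℕ) k xs → sumOver (λ x → f x * k) xs ≡ sumOver f xs * k
    sum-*ʳ f k xs = trans (sum-cong (λ x → *-comm (f x) k) xs)
                          (trans (sum-*ˡ k f xs) (*-comm k (sumOver f xs)))

    sum-0 : {f : A → ℕ} → (∀ x → f x ≡ 0) → ∀ xs → sumOver f xs ≡ 0
    sum-0 h xs = trans (sum-cong h xs) (trans (sum-const 0 xs) (*-zeroʳ (length xs)))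

    sum-++ : ∀ f (xs ys : List A) → sumOver f (xs ++ ys) ≡ sumOver f xs + sumOver f ys
    sum-++ f []       ys = refl
    sum-++ f (x ∷ xs) ys = trans (cong (f x +_) (sum-++ f xs ys)) (sym (+-assoc (f x) _ _))

    sum-filter : ∀ f p (xs : List A) → sumOver f (filterᵇ p xs) ≡ sumOver (λ x → ι (p x) * f x) xs
    sum-filter f p []       = refl
    sum-filter f p (x ∷ xs) with p x
    ... | true  = cong₂ _+_ (sym (+-identityʳ (f x))) (sum-filter f p xs)
    ... | false = sum-filter f p xs

    length≡sum : ∀ (xs : List A) → length xs ≡ sumOver (λ _ → 1) xs
    length≡sum xs = sym (trans (sum-const 1 xs) (*-identityʳ _))

  module _ {A B : Set} where

    sum-map : ∀ f (g : A → B) xs → sumOver f (map g xs) ≡ sumOver (f ∘ g) xs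
    sum-map f g []       = refl
    sum-map f g (x ∷ xs) = cong (f (g x) +_) (sum-map f g xs)

    sum-concatMap : ∀ f (g : A → List B) xs →
      sumOver f (concatMap g xs) ≡ sumOver (λ x → sumOver f (g x)) xs
    sum-concatMap f g []       = refl
    sum-concatMap f g (x ∷ xs) = trans (sum-++ f (g x) _) (cong (sumOver f (g x) +_) (sum-concatMap f g xs))

    sum-swap : ∀ (f : A → B → ℕ) xs ys →
      sumOver (λ x → sumOver (f x) ys) xs ≡ sumOver (λ y → sumOver (λ x → f x y) xs) ys
    sum-swap f []       ys = sym (sum-0 (λ _ → refl) ys)
    sum-swap f (x ∷ xs) ys = trans (cong (sumOver (f x) ys +_) (sum-swap f xs ys))
                                   (sym (sum-+ (f x) _ ys))

  module _ {A : Set} where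

    any-intro : ∀ (p : A → Bool) {x xs} → x ∈ xs → p x ≡ true → any p xs ≡ true
    any-intro p (here refl) h rewrite h = refl
    any-intro p {xs = y ∷ _} (there i) h = ∨-introʳ (p y) (any-intro p i h)

    any-elim : ∀ (p : A → Bool) xs → any p xs ≡ true → ∃ λ x → x ∈ xs × p x ≡ true
    any-elim p (x ∷ xs) h with ∨-elim (p x) h
    ... | inj₁ e = x , here refl , e
    ... | inj₂ e = let (y , i , h) = any-elim p xs e in y , there i , h

    -- The weights w allow the second alternative to be localised at a single x by `pick`.
    search : ∀ (p : A → Bool) xs →
      (∃ λ x → p x ≡ true) ⊎ (∀ (w : A → ℕ) → sumOver (λ x → w x * ι (p x)) xs ≡ 0)
    search p []       = inj₂ λ _ → refl
    search p (x ∷ xs) with p x in eq | search p xs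
    ... | true  | _      = inj₁ (x , eq)
    ... | false | inj₁ r = inj₁ r
    ... | false | inj₂ h = inj₂ λ w → cong₂ _+_ (*-zeroʳ (w x)) (h w)

  module Enumeration {A : Set} (_≟_ : DecidableEquality A) (xs : List A) where

    _≈_ : A → A → Bool
    x ≈ y = isYes (x ≟ y)

    _≉_ : A → A → Bool
    x ≉ y = not (x ≈ y)

    -- Phrased as a sum, "each element occurs exactly once" passes from field elements to vectors,
    -- pairs of vectors and parameters by factoring double sums, with no reasoning about repetitions
    -- in the lists built from them.
    Enumerates : Set
    Enumerates = ∀ x → sumOver (λ y → ι (x ≈ y)) xs ≡ 1

    private
      absent : ∀ x ys → All.All (λ y → ¬ x ≡ y) ys → sumOver (λ y → ι (x ≈ y)) ys ≡ 0
      absent x []       _          = refl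
      absent x (y ∷ ys) (h All.∷ hs) rewrite isYes-false (x ≟ y) h = absent x ys hs

      once : ∀ {x} ys → Unique ys → x ∈ ys → sumOver (λ y → ι (x ≈ y)) ys ≡ 1
      once {x} (x ∷ ys) (h ∷ _) (here refl)
        rewrite isYes-intro (x ≟ x) refl = cong suc (absent x ys h)
      once {x} (y ∷ ys) (h ∷ u) (there i)
        rewrite isYes-false (x ≟ y) (λ e → All.lookup h i (sym e)) = once ys u i

    enumerates : (∀ x → x ∈ xs) → Unique xs → Enumerates
    enumerates complete unique x = once xs unique (complete x)

    module _ (enum : Enumerates) where

      pick : ∀ (f : A → ℕ) x → sumOver (λ y → ι (x ≈ y) * f y) xs ≡ f x
      pick f x = begin
        sumOver (λ y → ι (x ≈ y) * f y) xs ≡⟨ sum-cong (λ y → pointwise y) xs ⟩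
        sumOver (λ y → ι (x ≈ y) * f x) xs ≡⟨ sum-*ʳ _ (f x) xs ⟩
        sumOver (λ y → ι (x ≈ y)) xs * f x ≡⟨ cong (_* f x) (enum x) ⟩
        1 * f x                            ≡⟨ *-identityˡ (f x) ⟩
        f x                                ∎
        where
        pointwise : ∀ y → ι (x ≈ y) * f y ≡ ι (x ≈ y) * f x
        pointwise y = ι-cong* (x ≈ y) (λ e → cong f (sym (isYes-elim (x ≟ y) e)))

      decide : ∀ (p : A → Bool) → (∃ λ x → p x ≡ true) ⊎ (∀ x → p x ≡ false)
      decide p with search p xs
      ... | inj₁ r = inj₁ r
      ... | inj₂ h = inj₂ λ x → ι≡0 (trans (sym (pick (ι ∘ p) x)) (h (λ y → ι (x ≈ y))))
        where
        ι≡0 : ∀ {b} → ι b ≡ 0 → b ≡ false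
        ι≡0 {false} _ = refl

      sum≡1 : ∀ (p : A → Bool) x → p x ≡ true → (∀ y → p y ≡ true → x ≡ y) → sumOver (ι ∘ p) xs ≡ 1
      sum≡1 p x px only = trans (sum-cong (λ y → cong ι (bool-ext (λ py → isYes-intro (x ≟ y) (only y py))
                                                              (λ e → subst (λ z → p z ≡ true) (isYes-elim (x ≟ y) e) px))) xs)
                                (enum x)

      sum≡0 : ∀ (p : A → Bool) → (∀ x → p x ≡ false) → sumOver (ι ∘ p) xs ≡ 0
      sum≡0 p h = sum-0 (λ x → cong ι (h x)) xs

      -- Two distinct solutions would contribute 2. This lets a solution space of size 1 identify a
      -- vector with the zero vector.
      sum≡1⇒unique : ∀ (p : A → Bool) → sumOver (ι ∘ p) xs ≡ 1 → ∀ {x y} → p x ≡ true → p y ≡ true → x ≡ y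
      sum≡1⇒unique p one {x} {y} px py with x ≟ y
      ... | yes e  = e
      ... | no x≢y = ⊥-elim (2≰1 (subst₂ _≤_ two one (sum-mono bound xs)))
        where
        2≰1 : ¬ 2 ≤ 1
        2≰1 (s≤s ())
        two : sumOver (λ z → ι (x ≈ z) + ι (y ≈ z)) xs ≡ 2
        two = trans (sum-+ _ _ xs) (cong₂ _+_ (enum x) (enum y))
        bound : ∀ z → ι (x ≈ z) + ι (y ≈ z) ≤ ι (p z)
        bound z with x ≟ z | y ≟ z
        ... | yes refl | yes refl = ⊥-elim (x≢y refl)
        ... | yes refl | no _     rewrite px = ≤-refl
        ... | no _     | yes refl rewrite py = ≤-refl
        ... | no _     | no _     = z≤n

      -- Change of variables by double counting the pairs with φ y = x: for each x the only such y
      -- is ψ x.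
      reindex : ∀ (φ ψ : A → A) → (∀ x → ψ (φ x) ≡ x) → (∀ x → φ (ψ x) ≡ x) →
        ∀ f → sumOver (f ∘ φ) xs ≡ sumOver f xs
      reindex φ ψ ψφ φψ f = begin
        sumOver (λ y → f (φ y)) xs
          ≡⟨ sum-cong (λ y → sym (pick f (φ y))) xs ⟩
        sumOver (λ y → sumOver (λ x → ι (φ y ≈ x) * f x) xs) xs
          ≡⟨ sum-swap _ xs xs ⟩
        sumOver (λ x → sumOver (λ y → ι (φ y ≈ x) * f x) xs) xs
          ≡⟨ sum-cong (λ x → sum-*ʳ _ (f x) xs) xs ⟩
        sumOver (λ x → sumOver (λ y → ι (φ y ≈ x)) xs * f x) xs
          ≡⟨ sum-cong (λ x → cong (_* f x) (trans (sum-cong (λ y → cong ι (flip x y)) xs) (enum (ψ x)))) xs ⟩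
        sumOver (λ x → 1 * f x) xs
          ≡⟨ sum-cong (λ x → *-identityˡ (f x)) xs ⟩
        sumOver f xs ∎
        where
        flip : ∀ x y → (φ y ≈ x) ≡ (ψ x ≈ y)
        flip x y = isYes-cong (φ y ≟ x) (ψ x ≟ y)
          (λ e → trans (cong ψ (sym e)) (ψφ y)) (λ e → trans (cong φ (sym e)) (φψ x))

      sum-others : ∀ (w : A → ℕ) x → sumOver (λ y → ι (x ≉ y) * w y) xs + w x ≡ sumOver w xs
      sum-others w x = begin
        sumOver (λ y → ι (x ≉ y) * w y) xs + w x
          ≡⟨ cong (sumOver (λ y → ι (x ≉ y) * w y) xs +_) (sym (pick w x)) ⟩
        sumOver (λ y → ι (x ≉ y) * w y) xs + sumOver (λ y → ι (x ≈ y) * w y) xs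
          ≡⟨ sym (sum-+ _ _ xs) ⟩
        sumOver (λ y → ι (x ≉ y) * w y + ι (x ≈ y) * w y) xs
          ≡⟨ sum-cong (λ y → split (x ≈ y) (w y)) xs ⟩
        sumOver w xs ∎
        where
        split : ∀ b n → ι (not b) * n + ι b * n ≡ n
        split true  n = +-identityʳ n
        split false n = trans (+-identityʳ _) (+-identityʳ n)

      -- The factorial moments i(i - 1) and i(i - 1)(i - 2) of the number i of solutions, written
      -- over ordered tuples of distinct elements so that they can be exchanged with a sum over
      -- planes.
      pairs triples : (A → Bool) → ℕ
      pairs p = sumOver (λ x → sumOver (λ y → ι (x ≉ y) * (ι (p x) * ι (p y))) xs) xs
      triples p = sumOver (λ x → sumOver (λ y → sumOver (λ z →
        (ι (x ≉ y) * ι (x ≉ z) * ι (y ≉ z)) * (ι (p x) * ι (p y) * ι (p z))) xs) xs) xs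

      -- The diagonal terms ι (p x) * ι (p x) collapse to ι (p x); adding them back completes the
      -- square.
      pairs-sum : ∀ p → let i = sumOver (ι ∘ p) xs in pairs p + i ≡ i * i
      pairs-sum p = begin
        pairs p + i
          ≡⟨ sym (sum-+ _ _ xs) ⟩
        sumOver (λ x → sumOver (λ y → ι (x ≉ y) * (ι (p x) * ι (p y))) xs + ι (p x)) xs
          ≡⟨ sum-cong (λ x → trans (cong (sumOver (λ y → ι (x ≉ y) * (ι (p x) * ι (p y))) xs +_) (sym (ι-idem (p x)))) (sum-others (λ y → ι (p x) * ι (p y)) x)) xs ⟩
        sumOver (λ x → sumOver (λ y → ι (p x) * ι (p y)) xs) xs
          ≡⟨ sum-cong (λ x → sum-*ˡ (ι (p x)) _ xs) xs ⟩
        sumOver (λ x → ι (p x) * i) xs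
          ≡⟨ sum-*ʳ _ i xs ⟩
        i * i ∎
        where i = sumOver (ι ∘ p) xs

      -- Once two distinct solutions are chosen, the third entry ranges over the remaining i - 2.
      triples-sum : ∀ p → triples p + 2 * pairs p ≡ pairs p * sumOver (ι ∘ p) xs
      triples-sum p = begin
        triples p + 2 * pairs p
          ≡⟨ cong (triples p +_) (sym (trans (sum-cong (λ x → sum-*ˡ 2 _ xs) xs) (sum-*ˡ 2 _ xs))) ⟩
        triples p + sumOver (λ x → sumOver (λ y → 2 * w x y) xs) xs
          ≡⟨ sym (trans (sum-cong (λ x → sum-+ _ _ xs) xs) (sum-+ _ _ xs)) ⟩
        sumOver (λ x → sumOver (λ y → sumOver (t x y) xs + 2 * w x y) xs) xs
          ≡⟨ sum-cong (λ x → sum-cong (λ y → inner x y) xs) xs ⟩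
        sumOver (λ x → sumOver (λ y → w x y * i) xs) xs
          ≡⟨ trans (sum-cong (λ x → sum-*ʳ _ i xs) xs) (sum-*ʳ _ i xs) ⟩
        pairs p * i ∎
        where
        i = sumOver (ι ∘ p) xs
        w : A → A → ℕ
        w x y = ι (x ≉ y) * (ι (p x) * ι (p y))
        t : A → A → A → ℕ
        t x y z = (ι (x ≉ y) * ι (x ≉ z) * ι (y ≉ z)) * (ι (p x) * ι (p y) * ι (p z))
        regroup : ∀ a b c d e f → a * b * c * (d * e * f) ≡ (a * (d * e)) * (b * (c * f))
        regroup = solve-∀
        others : ∀ x y → ¬ x ≡ y → p x ≡ true → p y ≡ true →
          sumOver (λ z → ι (x ≉ z) * (ι (y ≉ z) * ι (p z))) xs + 2 ≡ i
        others x y x≢y px py = begin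
          S + 2                                             ≡⟨ sym (+-assoc S 1 1) ⟩
          S + 1 + 1                                         ≡⟨ cong₂ (λ a b → S + a + b) (sym here-x) (sym (cong ι py)) ⟩
          S + ι (y ≉ x) * ι (p x) + ι (p y)                 ≡⟨ cong (_+ ι (p y)) (sum-others (λ z → ι (y ≉ z) * ι (p z)) x) ⟩
          sumOver (λ z → ι (y ≉ z) * ι (p z)) xs + ι (p y)  ≡⟨ sum-others (ι ∘ p) y ⟩
          i                                                 ∎
          where
          S = sumOver (λ z → ι (x ≉ z) * (ι (y ≉ z) * ι (p z))) xs
          here-x : ι (y ≉ x) * ι (p x) ≡ 1
          here-x rewrite px | not-isYes-intro (y ≟ x) (x≢y ∘ sym) = refl
        weighted : ∀ a b c {m n} → (a ≡ true → b ≡ true → c ≡ true → m ≡ n) →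
          ι a * (ι b * ι c) * m ≡ ι a * (ι b * ι c) * n
        weighted true true true h = cong (_+ 0) (h refl refl refl)
        weighted true true false h = refl
        weighted true false c h = refl
        weighted false b c h = refl
        inner : ∀ x y → sumOver (t x y) xs + 2 * w x y ≡ w x y * i
        inner x y = begin
          sumOver (t x y) xs + 2 * w x y
            ≡⟨ cong₂ _+_ (trans (sum-cong (λ z → regroup (ι (x ≉ y)) (ι (x ≉ z)) (ι (y ≉ z)) (ι (p x)) (ι (p y)) (ι (p z))) xs)
                                (sum-*ˡ (w x y) _ xs)) (*-comm 2 (w x y)) ⟩
          w x y * sumOver (λ z → ι (x ≉ z) * (ι (y ≉ z) * ι (p z))) xs + w x y * 2
            ≡⟨ sym (*-distribˡ-+ (w x y) _ 2) ⟩
          w x y * (sumOver (λ z → ι (x ≉ z) * (ι (y ≉ z) * ι (p z))) xs + 2)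
            ≡⟨ weighted (x ≉ y) (p x) (p y) (λ e px py → others x y (not-isYes-elim (x ≟ y) e) px py) ⟩
          w x y * i ∎

open Sums

-- A ring solver with integer coefficients, and cancellation in a field.

module FieldProperties (𝔽 : FiniteField) where
  open FiniteField 𝔽
  open ≡-Reasoning

  commutativeRing : CommutativeRing _ _
  commutativeRing = record { isCommutativeRing = isCommutativeRing }

  open CommutativeRing commutativeRing public
    using (+-identityˡ; +-identityʳ; +-comm; *-comm; *-assoc; *-identityˡ; *-identityʳ; zeroˡ; zeroʳ; -‿inverseʳ)
  private
    module R = CommutativeRing commutativeRing
    module Rₚ = Algebra.Properties.Ring R.ring
    module +ₚ = Algebra.Properties.CommutativeSemigroup R.+-commutativeSemigroup
    open Algebra.Properties.Semiring.Mult.TCOptimised R.semiring using (×-homo-+; ×1-homo-*) renaming (_×_ to _·_)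

    infixl 6 _-_
    _-_ : Carrier → Carrier → Carrier
    x - y = x + - y

    +-interchange : ∀ a b c d → (a - b) + (c - d) ≡ (a + c) - (b + d)
    +-interchange a b c d = trans (+ₚ.interchange a (- b) c (- d)) (cong ((a + c) +_) (Rₚ.-‿+-comm b d))

    *-expand : ∀ a b c d → (a - b) * (c - d) ≡ (a * c + b * d) - (a * d + b * c)
    *-expand a b c d = begin
      (a - b) * (c - d)                   ≡⟨ Rₚ.[y-z]x≈yx-zx (c - d) a b ⟩
      a * (c - d) - b * (c - d)           ≡⟨ cong₂ _-_ (Rₚ.x[y-z]≈xy-xz a c d) (Rₚ.x[y-z]≈xy-xz b c d) ⟩
      (a * c - a * d) - (b * c - b * d)   ≡⟨ cong ((a * c - a * d) +_) (Rₚ.⁻¹-anti-homo‿- (b * c) (b * d)) ⟩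
      (a * c - a * d) + (b * d - b * c)   ≡⟨ +-interchange (a * c) (a * d) (b * d) (b * c) ⟩
      (a * c + b * d) - (a * d + b * c)   ∎

  -- An integer coefficient m − n of the ring solver is the pair (m , n).
  ⟦_⟧ : ℕ × ℕ → Carrier
  ⟦ m , zero  ⟧ = m · 1#
  ⟦ m , suc n ⟧ = m · 1# - suc n · 1#

  private
    -- The separate clause of `⟦_⟧` for n = 0 lets the constants (0 , 0), (1 , 0) and (3 , 0) of
    -- solver equations compute to `0#`, `1#` and the sum of three `1#`, so that they match goals
    -- definitionally. This lemma restores the uniform formula for the homomorphism proofs.
    ⟦⟧-difference : ∀ m n → ⟦ m , n ⟧ ≡ m · 1# - n · 1#
    ⟦⟧-difference m zero    = sym (trans (cong ((m · 1#) +_) Rₚ.-0#≈0#) (+-identityʳ _))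
    ⟦⟧-difference m (suc n) = refl

    coefficients : RawRing _ _
    coefficients = record
      { Carrier = ℕ × ℕ
      ; _≈_ = _≡_
      ; _+_ = λ (a , b) (c , d) → a ℕ.+ c , b ℕ.+ d
      ; _*_ = λ (a , b) (c , d) → a ℕ.* c ℕ.+ b ℕ.* d , a ℕ.* d ℕ.+ b ℕ.* c
      ; -_  = λ (a , b) → b , a
      ; 0#  = 0 , 0
      ; 1#  = 1 , 0
      }

    almostCommutativeRing : AlmostCommutativeRing _ _
    almostCommutativeRing = fromCommutativeRing commutativeRing

    sum-of-products : ∀ a b c d → (a ℕ.* b ℕ.+ c ℕ.* d) · 1# ≡ (a · 1#) * (b · 1#) + (c · 1#) * (d · 1#)
    sum-of-products a b c d = trans (×-homo-+ 1# (a ℕ.* b) (c ℕ.* d)) (cong₂ _+_ (×1-homo-* a b) (×1-homo-* c d))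

    morphism : coefficients -Raw-AlmostCommutative⟶ almostCommutativeRing
    morphism = record
      { ⟦_⟧    = ⟦_⟧
      ; +-homo = λ (a , b) (c , d) → begin
          ⟦ a ℕ.+ c , b ℕ.+ d ⟧                      ≡⟨ ⟦⟧-difference (a ℕ.+ c) (b ℕ.+ d) ⟩
          (a ℕ.+ c) · 1# - (b ℕ.+ d) · 1#            ≡⟨ cong₂ _-_ (×-homo-+ 1# a c) (×-homo-+ 1# b d) ⟩
          (a · 1# + c · 1#) - (b · 1# + d · 1#)      ≡⟨ sym (+-interchange (a · 1#) (b · 1#) (c · 1#) (d · 1#)) ⟩
          (a · 1# - b · 1#) + (c · 1# - d · 1#)      ≡⟨ sym (cong₂ _+_ (⟦⟧-difference a b) (⟦⟧-difference c d)) ⟩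
          ⟦ a , b ⟧ + ⟦ c , d ⟧                      ∎
      ; *-homo = λ (a , b) (c , d) → begin
          ⟦ a ℕ.* c ℕ.+ b ℕ.* d , a ℕ.* d ℕ.+ b ℕ.* c ⟧
            ≡⟨ ⟦⟧-difference (a ℕ.* c ℕ.+ b ℕ.* d) (a ℕ.* d ℕ.+ b ℕ.* c) ⟩
          (a ℕ.* c ℕ.+ b ℕ.* d) · 1# - (a ℕ.* d ℕ.+ b ℕ.* c) · 1#
            ≡⟨ cong₂ _-_ (sum-of-products a c b d) (sum-of-products a d b c) ⟩
          ((a · 1#) * (c · 1#) + (b · 1#) * (d · 1#)) - ((a · 1#) * (d · 1#) + (b · 1#) * (c · 1#))
            ≡⟨ sym (*-expand (a · 1#) (b · 1#) (c · 1#) (d · 1#)) ⟩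
          (a · 1# - b · 1#) * (c · 1# - d · 1#)
            ≡⟨ sym (cong₂ _*_ (⟦⟧-difference a b) (⟦⟧-difference c d)) ⟩
          ⟦ a , b ⟧ * ⟦ c , d ⟧ ∎
      ; -‿homo = λ (a , b) → begin
          ⟦ b , a ⟧             ≡⟨ ⟦⟧-difference b a ⟩
          b · 1# - a · 1#       ≡⟨ sym (Rₚ.⁻¹-anti-homo‿- (a · 1#) (b · 1#)) ⟩
          - (a · 1# - b · 1#)   ≡⟨ cong -_ (sym (⟦⟧-difference a b)) ⟩
          - ⟦ a , b ⟧           ∎
      ; 0-homo = refl
      ; 1-homo = refl
      }

    -- Pairs with equal cross sums represent the same integer. The test is only sufficient, since
    -- different integers may agree in positive characteristic; the solver asks for no more.
    coefficient≟ : ∀ (a b : ℕ × ℕ) → Maybe (⟦ a ⟧ ≡ ⟦ b ⟧)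
    coefficient≟ (a , b) (c , d) with a ℕ.+ d ℕₚ.≟ c ℕ.+ b
    ... | no _  = nothing
    ... | yes e = just (begin
      ⟦ a , b ⟧                                    ≡⟨ ⟦⟧-difference a b ⟩
      a · 1# - b · 1#                              ≡⟨ shift (a · 1#) (b · 1#) (d · 1#) ⟩
      (a · 1# + d · 1#) - (b · 1# + d · 1#)        ≡⟨ cong₂ _-_ (trans (sym (×-homo-+ 1# a d)) (trans (cong (_· 1#) e) (×-homo-+ 1# c b)))
                                                                (+-comm (b · 1#) (d · 1#)) ⟩
      (c · 1# + b · 1#) - (d · 1# + b · 1#)        ≡⟨ sym (shift (c · 1#) (d · 1#) (b · 1#)) ⟩
      c · 1# - d · 1#                              ≡⟨ sym (⟦⟧-difference c d) ⟩
      ⟦ c , d ⟧                                    ∎)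
      where
      shift : ∀ x y z → x - y ≡ (x + z) - (y + z)
      shift x y z = begin
        x - y                ≡⟨ sym (+-identityʳ (x - y)) ⟩
        (x - y) + 0#         ≡⟨ cong ((x - y) +_) (sym (-‿inverseʳ z)) ⟩
        (x - y) + (z - z)    ≡⟨ +-interchange x y z z ⟩
        (x + z) - (y + z)    ∎

  module Solver = Algebra.Solver.Ring coefficients almostCommutativeRing morphism coefficient≟

  1≢0 : ¬ 1# ≡ 0#
  1≢0 e = 0≢1 (sym e)

  inv : ∀ x → ¬ x ≡ 0# → Carrier
  inv x x≢0 = proj₁ (inverse x x≢0)

  inv-inverseʳ : ∀ x (x≢0 : ¬ x ≡ 0#) → x * inv x x≢0 ≡ 1#
  inv-inverseʳ x x≢0 = proj₂ (inverse x x≢0)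

  inv-inverseˡ : ∀ x (x≢0 : ¬ x ≡ 0#) → inv x x≢0 * x ≡ 1#
  inv-inverseˡ x x≢0 = trans (*-comm _ x) (inv-inverseʳ x x≢0)

  *-cancelˡ-0 : ∀ {x y} → ¬ x ≡ 0# → x * y ≡ 0# → y ≡ 0#
  *-cancelˡ-0 {x} {y} x≢0 e = begin
    y                        ≡⟨ sym (*-identityˡ y) ⟩
    1# * y                   ≡⟨ cong (_* y) (sym (inv-inverseˡ x x≢0)) ⟩
    inv x x≢0 * x * y        ≡⟨ *-assoc _ x y ⟩
    inv x x≢0 * (x * y)      ≡⟨ cong (inv x x≢0 *_) e ⟩
    inv x x≢0 * 0#           ≡⟨ zeroʳ _ ⟩
    0#                       ∎

  *-cancelʳ-0 : ∀ {x y} → ¬ y ≡ 0# → x * y ≡ 0# → x ≡ 0#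
  *-cancelʳ-0 {x} {y} y≢0 e = *-cancelˡ-0 y≢0 (trans (*-comm y x) e)

  *-≢0 : ∀ {x y} → ¬ x ≡ 0# → ¬ y ≡ 0# → ¬ x * y ≡ 0#
  *-≢0 x≢0 y≢0 e = y≢0 (*-cancelˡ-0 x≢0 e)

  inv-≢0 : ∀ x (x≢0 : ¬ x ≡ 0#) → ¬ inv x x≢0 ≡ 0#
  inv-≢0 x x≢0 e = 1≢0 (trans (sym (inv-inverseʳ x x≢0)) (trans (cong (x *_) e) (zeroʳ x)))

  +-cancelʳ-0 : ∀ {x y} → y ≡ 0# → x + y ≡ 0# → x ≡ 0#
  +-cancelʳ-0 {x} refl e = trans (sym (+-identityʳ x)) e

  x-y≡0⇒x≡y : ∀ {x y} → x + - y ≡ 0# → x ≡ y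
  x-y≡0⇒x≡y {x} {y} e = Rₚ.x∙y⁻¹≈ε⇒x≈y x y e

-- Vectors, linear forms, and the sizes of subspaces.

module VectorSpace (𝔽 : FiniteField) where
  open FiniteField 𝔽
  open PG3 𝔽
  open FieldProperties 𝔽
  open ≡-Reasoning

  module 𝔼 = Enumeration _≟_ elements

  elements-enumerate : 𝔼.Enumerates
  elements-enumerate = 𝔼.enumerates complete unique

  module 𝕍 (n : ℕ) = Enumeration (VecP.≡-dec _≟_) (vectors n)

  sum-vectors : ∀ {n} (f : Vec Carrier (suc n) → ℕ) →
    sumOver f (vectors (suc n)) ≡ sumOver (λ x → sumOver (λ v → f (x ∷ v)) (vectors n)) elements
  sum-vectors {n} f = trans (sum-concatMap f _ elements) (sum-cong (λ x → sum-map f (x ∷_) (vectors n)) elements)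

  vectors-enumerate : ∀ n → 𝕍.Enumerates n
  vectors-enumerate zero    []       = refl
  vectors-enumerate (suc n) (x ∷ v) = begin
    sumOver (λ w → ι ((x ∷ v) ==v w)) (vectors (suc n))
      ≡⟨ sum-vectors (λ w → ι ((x ∷ v) ==v w)) ⟩
    sumOver (λ y → sumOver (λ w → ι ((x ∷ v) ==v (y ∷ w))) (vectors n)) elements
      ≡⟨ sum-cong (λ y → trans (sum-cong (λ w → trans (cong ι (split y w)) (ι-∧ (x == y) (v ==v w))) (vectors n))
                               (sum-*ˡ (ι (x == y)) _ (vectors n))) elements ⟩
    sumOver (λ y → ι (x == y) ℕ.* sumOver (λ w → ι (v ==v w)) (vectors n)) elements
      ≡⟨ 𝔼.pick elements-enumerate _ x ⟩
    sumOver (λ w → ι (v ==v w)) (vectors n)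
      ≡⟨ vectors-enumerate n v ⟩
    1 ∎
    where
    split : ∀ y w → ((x ∷ v) ==v (y ∷ w)) ≡ (x == y) ∧ (v ==v w)
    split y w = bool-ext
      (λ e → let h = isYes-elim (VecP.≡-dec _≟_ (x ∷ v) (y ∷ w)) e in
             ∧-intro (isYes-intro (x ≟ y) (VecP.∷-injectiveˡ h)) (isYes-intro (VecP.≡-dec _≟_ v w) (VecP.∷-injectiveʳ h)))
      (λ e → isYes-intro (VecP.≡-dec _≟_ (x ∷ v) (y ∷ w))
               (cong₂ _∷_ (isYes-elim (x ≟ y) (proj₁ (∧-elim (x == y) e)))
                          (isYes-elim (VecP.≡-dec _≟_ v w) (proj₂ (∧-elim (x == y) e)))))

  order-sum : ∀ k → sumOver (λ (_ : Carrier) → k) elements ≡ order ℕ.* k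
  order-sum k = sum-const k elements

  number-of-vectors : ∀ n → sumOver (λ _ → 1) (vectors n) ≡ order ℕ.^ n
  number-of-vectors zero    = refl
  number-of-vectors (suc n) = trans (sum-vectors {n} (λ _ → 1))
    (trans (sum-cong (λ _ → number-of-vectors n) elements) (order-sum (order ℕ.^ n)))

  ==-intro : ∀ {x y} → x ≡ y → x == y ≡ true
  ==-intro {x} {y} = isYes-intro (x ≟ y)

  ==-elim : ∀ {x y} → x == y ≡ true → x ≡ y
  ==-elim {x} {y} = isYes-elim (x ≟ y)

  ==-false : ∀ {x y} → ¬ x ≡ y → x == y ≡ false
  ==-false {x} {y} = isYes-false (x ≟ y)

  ==-cong : ∀ {x y z w} → (x ≡ y → z ≡ w) → (z ≡ w → x ≡ y) → (x == y) ≡ (z == w)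
  ==-cong {x} {y} {z} {w} = isYes-cong (x ≟ y) (z ≟ w)

  ==v-intro : ∀ {n} {u v : Vec Carrier n} → u ≡ v → u ==v v ≡ true
  ==v-intro {u = u} {v} = isYes-intro (VecP.≡-dec _≟_ u v)

  ==v-elim : ∀ {n} {u v : Vec Carrier n} → u ==v v ≡ true → u ≡ v
  ==v-elim {u = u} {v} = isYes-elim (VecP.≡-dec _≟_ u v)

  ==v-false : ∀ {n} {u v : Vec Carrier n} → ¬ u ≡ v → u ==v v ≡ false
  ==v-false {u = u} {v} = isYes-false (VecP.≡-dec _≟_ u v)

  𝟎 : ∀ {n} → Vec Carrier n
  𝟎 = Vec.replicate _ 0#

  -- In dimension four this unfolds to the combination `scale a u +v scale b v` tested by `onLine`;
  -- other dimensions are needed for induction.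
  lin : ∀ {n} → Carrier → Carrier → Vec Carrier n → Vec Carrier n → Vec Carrier n
  lin a b u v = zipWith _+_ (Vec.map (a *_) u) (Vec.map (b *_) v)

  coord-lin : ∀ {n} k a b (u v : Vec Carrier n) → coord k (lin a b u v) ≡ a * coord k u + b * coord k v
  coord-lin k       a b []      []      = solve 2 (λ a b → con (0 , 0) := a :* con (0 , 0) :+ b :* con (0 , 0)) refl a b
    where open Solver
  coord-lin zero    a b (_ ∷ _) (_ ∷ _) = refl
  coord-lin (suc k) a b (_ ∷ u) (_ ∷ v) = coord-lin k a b u v

  coord-scale : ∀ {n} k a (v : Vec Carrier n) → coord k (Vec.map (a *_) v) ≡ a * coord k v
  coord-scale k       a []      = sym (zeroʳ a)
  coord-scale zero    a (_ ∷ _) = refl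
  coord-scale (suc k) a (_ ∷ v) = coord-scale k a v

  coord-𝟎 : ∀ n k → coord k (𝟎 {n}) ≡ 0#
  coord-𝟎 zero    k       = refl
  coord-𝟎 (suc n) zero    = refl
  coord-𝟎 (suc n) (suc k) = coord-𝟎 n k

  -- Coordinates out of range are `0#`, so k may run through all of ℕ. Vector identities thereby
  -- become ring identities, one coordinate at a time.
  coord-ext : ∀ {n} {u v : Vec Carrier n} → (∀ k → coord k u ≡ coord k v) → u ≡ v
  coord-ext {u = []}    {[]}    h = refl
  coord-ext {u = _ ∷ _} {_ ∷ _} h = cong₂ _∷_ (h zero) (coord-ext (h ∘ suc))

  zeroUpTo-elim : ∀ {n} k (v : Vec Carrier n) → zeroUpTo k v ≡ true → ∀ {m} → m ℕ.< k → coord m v ≡ 0#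
  zeroUpTo-elim (suc k) []      h m<k               = refl
  zeroUpTo-elim (suc k) (x ∷ v) h {zero}  m<k       = ==-elim (proj₁ (∧-elim (x == 0#) h))
  zeroUpTo-elim (suc k) (x ∷ v) h {suc m} (s≤s m<k) = zeroUpTo-elim k v (proj₂ (∧-elim (x == 0#) h)) m<k

  zeroUpTo-intro : ∀ {n} k (v : Vec Carrier n) → (∀ {m} → m ℕ.< k → coord m v ≡ 0#) → zeroUpTo k v ≡ true
  zeroUpTo-intro zero    v       h = refl
  zeroUpTo-intro (suc k) []      h = refl
  zeroUpTo-intro (suc k) (x ∷ v) h = ∧-intro (==-intro (h (s≤s z≤n))) (zeroUpTo-intro k v (λ m<k → h (s≤s m<k)))

  -- The search for the first pivot column in Gaussian elimination of two rows. Applied to u = v it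
  -- locates the leading coordinate of a single vector.
  leading : ∀ {n} (u v : Vec Carrier n) →
    (∀ k → coord k u ≡ 0# × coord k v ≡ 0#) ⊎
    (∃ λ i → i ℕ.< n × (∀ {m} → m ℕ.< i → coord m u ≡ 0# × coord m v ≡ 0#) × (¬ coord i u ≡ 0# ⊎ ¬ coord i v ≡ 0#))
  leading []      []      = inj₁ λ k → refl , refl
  leading (x ∷ u) (y ∷ v) with x ≟ 0# | y ≟ 0#
  ... | no x≢0 | _      = inj₂ (0 , s≤s z≤n , (λ ()) , inj₁ x≢0)
  ... | yes _  | no y≢0 = inj₂ (0 , s≤s z≤n , (λ ()) , inj₂ y≢0)
  ... | yes x≡0 | yes y≡0 with leading u v
  ...   | inj₁ h = inj₁ λ { zero → x≡0 , y≡0 ; (suc k) → h k }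
  ...   | inj₂ (i , i<n , below , at) =
    inj₂ (suc i , s≤s i<n , (λ { {zero} _ → x≡0 , y≡0 ; {suc m} (s≤s m<i) → below m<i }) , at)

  -- `dot` lives in dimension four only; inductions on the length need every dimension.
  dotₙ : ∀ {n} → Vec Carrier n → Vec Carrier n → Carrier
  dotₙ c x = foldr _ _+_ 0# (zipWith _*_ c x)

  dotₙ-comm : ∀ {n} (c v : Vec Carrier n) → dotₙ c v ≡ dotₙ v c
  dotₙ-comm []      []      = refl
  dotₙ-comm (x ∷ c) (y ∷ v) = cong₂ _+_ (*-comm x y) (dotₙ-comm c v)

  dotₙ-lin : ∀ {n} a b (c u v : Vec Carrier n) → dotₙ c (lin a b u v) ≡ a * dotₙ c u + b * dotₙ c v
  dotₙ-lin a b []      []      []      = solve 2 (λ a b → con (0 , 0) := a :* con (0 , 0) :+ b :* con (0 , 0)) refl a b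
    where open Solver
  dotₙ-lin a b (z ∷ c) (x ∷ u) (y ∷ v) = trans (cong ((z * (a * x + b * y)) +_) (dotₙ-lin a b c u v))
    (solve 7 (λ a b z x y s t → z :* (a :* x :+ b :* y) :+ (a :* s :+ b :* t) := a :* (z :* x :+ s) :+ b :* (z :* y :+ t)) refl
       a b z x y (dotₙ c u) (dotₙ c v))
    where open Solver

  dotₙ-𝟎 : ∀ {n} (v : Vec Carrier n) → dotₙ 𝟎 v ≡ 0#
  dotₙ-𝟎 []      = refl
  dotₙ-𝟎 (x ∷ v) = trans (cong₂ _+_ (zeroˡ x) (dotₙ-𝟎 v)) (+-identityˡ 0#)

  dotₙ-scale : ∀ {n} a (c v : Vec Carrier n) → dotₙ c (Vec.map (a *_) v) ≡ a * dotₙ c v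
  dotₙ-scale a []      []      = sym (zeroʳ a)
  dotₙ-scale a (z ∷ c) (x ∷ v) = trans (cong ((z * (a * x)) +_) (dotₙ-scale a c v))
    (solve 4 (λ a z x s → z :* (a :* x) :+ a :* s := a :* (z :* x :+ s)) refl a z x (dotₙ c v))
    where open Solver

  dot-comm : ∀ c v → dot c v ≡ dot v c
  dot-comm = dotₙ-comm

  dot-lin : ∀ a b c u v → dot c (lin a b u v) ≡ a * dot c u + b * dot c v
  dot-lin = dotₙ-lin

  dot-𝟎 : ∀ v → dot 𝟎 v ≡ 0#
  dot-𝟎 = dotₙ-𝟎

  dot-scale : ∀ a c v → dot c (scale a v) ≡ a * dot c v
  dot-scale = dotₙ-scale

  onPlane-comm : ∀ u v → onPlane u v ≡ onPlane v u
  onPlane-comm u v = cong (_== 0#) (dot-comm v u)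

  -- Non-degeneracy of the pairing: e is the unit vector at the first nonzero coordinate of c, and
  -- the pairing returns that coordinate.
  dual : ∀ {n} (c : Vec Carrier n) → ¬ c ≡ 𝟎 → ∃ λ e → ¬ dotₙ c e ≡ 0#
  dual []      c≢0 = ⊥-elim (c≢0 refl)
  dual (x ∷ c) c≢0 with x ≟ 0#
  ... | no x≢0 = 1# ∷ 𝟎 , λ h → x≢0 (trans (sym (trans (cong₂ _+_ (*-identityʳ x) (trans (dotₙ-comm c 𝟎) (dotₙ-𝟎 c))) (+-identityʳ x))) h)
  ... | yes x≡0 with dual c (λ c≡0 → c≢0 (cong₂ _∷_ x≡0 c≡0))
  ...   | e , h = 0# ∷ e , λ h′ → h (trans (sym (trans (cong (_+ dotₙ c e) (zeroʳ x)) (+-identityˡ _))) h′)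

  scale-≢𝟎 : ∀ {n} {a} {v : Vec Carrier n} → ¬ a ≡ 0# → ¬ v ≡ 𝟎 → ¬ Vec.map (a *_) v ≡ 𝟎
  scale-≢𝟎 {n} {a} {v} a≢0 v≢𝟎 e = v≢𝟎 (coord-ext λ k → trans (*-cancelˡ-0 a≢0
    (trans (sym (coord-scale k a v)) (trans (cong (coord k) e) (coord-𝟎 n k)))) (sym (coord-𝟎 n k)))

  size : (V4 → Bool) → ℕ
  size W = sumOver (ι ∘ W) (vectors 4)

  -- A list of linear forms stands for the subspace that they cut out. As the pairing is symmetric,
  -- the same predicate says that a point lies on given planes and that a plane passes through given
  -- points.
  vanish : List V4 → V4 → Bool
  vanish []       v = true
  vanish (d ∷ ds) v = onPlane v d ∧ vanish ds v

  vanish-translate : ∀ ds v e a → vanish ds e ≡ true → vanish ds (lin 1# a v e) ≡ vanish ds v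
  vanish-translate []       v e a h = refl
  vanish-translate (d ∷ ds) v e a h = cong₂ _∧_
    (cong (_== 0#) (trans (dot-lin 1# a d v e) (trans (cong (λ z → 1# * dot d v + a * z) (==-elim (proj₁ (∧-elim (onPlane e d) h))))
      (solve 2 (λ x a → con (1 , 0) :* x :+ a :* con (0 , 0) := x) refl (dot d v) a))))
    (vanish-translate ds v e a (proj₂ (∧-elim (onPlane e d) h)))
    where open Solver

  -- Translating by multiples of e permutes the fibres of dot d inside the subspace cut out by ds.
  size-vanish : ∀ d ds e → vanish ds e ≡ true → ¬ dot d e ≡ 0# →
    order ℕ.* size (vanish (d ∷ ds)) ≡ size (vanish ds)
  size-vanish d ds e e∈ds de≢0 = sym (begin
    size (vanish ds)
      -- A factor 1 is inserted as the number of values a with dot d v = a, which splits the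
      -- subspace into q fibres.
      ≡⟨ sum-cong (λ v → trans (sym (ℕₚ.*-identityʳ (ι (vanish ds v))))
                               (trans (cong (ι (vanish ds v) ℕ.*_) (sym (elements-enumerate (dot d v))))
                                      (sym (sum-*ˡ (ι (vanish ds v)) _ elements)))) (vectors 4) ⟩
    sumOver (λ v → sumOver (λ a → ι (vanish ds v) ℕ.* ι (dot d v == a)) elements) (vectors 4)
      ≡⟨ sum-swap _ (vectors 4) elements ⟩
    sumOver (λ a → sumOver (λ v → ι (vanish ds v) ℕ.* ι (dot d v == a)) (vectors 4)) elements
      ≡⟨ sum-cong fibre elements ⟩
    sumOver (λ _ → size (vanish (d ∷ ds))) elements
      ≡⟨ order-sum _ ⟩
    order ℕ.* size (vanish (d ∷ ds)) ∎)
    where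
    μ = inv (dot d e) de≢0
    shift-back : ∀ {n} b (v w : Vec Carrier n) → lin 1# (- b) (lin 1# b v w) w ≡ v
    shift-back b v w = coord-ext λ k → trans (coord-lin k 1# (- b) (lin 1# b v w) w)
      (trans (cong (λ z → 1# * z + - b * coord k w) (coord-lin k 1# b v w))
      (solve 3 (λ b x y → con (1 , 0) :* (con (1 , 0) :* x :+ b :* y) :+ (:- b) :* y := x) refl b (coord k v) (coord k w)))
      where open Solver
    shift-forth : ∀ {n} b (v w : Vec Carrier n) → lin 1# b (lin 1# (- b) v w) w ≡ v
    shift-forth b v w = coord-ext λ k → trans (coord-lin k 1# b (lin 1# (- b) v w) w)
      (trans (cong (λ z → 1# * z + b * coord k w) (coord-lin k 1# (- b) v w))
      (solve 3 (λ b x y → con (1 , 0) :* (con (1 , 0) :* x :+ (:- b) :* y) :+ b :* y := x) refl b (coord k v) (coord k w)))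
      where open Solver
    -- The factor μ makes this translation raise dot d by exactly a, so it carries the fibre over 0
    -- to the fibre over a.
    translate : Carrier → V4 → V4
    translate a v = lin 1# (a * μ) v e
    dot-translate : ∀ a v → dot d (translate a v) ≡ dot d v + a
    dot-translate a v = begin
      dot d (translate a v)                  ≡⟨ dot-lin 1# (a * μ) d v e ⟩
      1# * dot d v + a * μ * dot d e         ≡⟨ cong₂ _+_ (*-identityˡ _) (*-assoc a μ (dot d e)) ⟩
      dot d v + a * (μ * dot d e)            ≡⟨ cong (λ z → dot d v + a * z) (inv-inverseˡ (dot d e) de≢0) ⟩
      dot d v + a * 1#                       ≡⟨ cong (dot d v +_) (*-identityʳ a) ⟩
      dot d v + a                            ∎
    cancel : ∀ x a → x + a ≡ a → x ≡ 0#
    cancel x a h = trans (solve 2 (λ x a → x := x :+ a :- a) refl x a) (trans (cong (_+ - a) h) (-‿inverseʳ a))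
      where open Solver
    fibre : ∀ a → sumOver (λ v → ι (vanish ds v) ℕ.* ι (dot d v == a)) (vectors 4) ≡ size (vanish (d ∷ ds))
    fibre a = begin
      sumOver (λ v → ι (vanish ds v) ℕ.* ι (dot d v == a)) (vectors 4)
        ≡⟨ sym (𝕍.reindex 4 (vectors-enumerate 4) (translate a) (λ v → lin 1# (- (a * μ)) v e)
                 (λ v → shift-back (a * μ) v e) (λ v → shift-forth (a * μ) v e) _) ⟩
      sumOver (λ v → ι (vanish ds (translate a v)) ℕ.* ι (dot d (translate a v) == a)) (vectors 4)
        ≡⟨ sum-cong (λ v → trans (cong₂ (λ b c → ι b ℕ.* ι c) (vanish-translate ds v e (a * μ) e∈ds) (level v))
                                 (trans (ℕₚ.*-comm (ι (vanish ds v)) _) (sym (ι-∧ (onPlane v d) (vanish ds v))))) (vectors 4) ⟩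
      size (vanish (d ∷ ds)) ∎
      where
      level : ∀ v → (dot d (translate a v) == a) ≡ onPlane v d
      level v = ==-cong (λ h → cancel (dot d v) a (trans (sym (dot-translate a v)) h))
                        (λ h → trans (dot-translate a v) (trans (cong (_+ a) h) (+-identityˡ a)))

-- Lines as spans: existence and uniqueness of the reduced row echelon basis.

module LineGeometry (𝔽 : FiniteField) where
  open FiniteField 𝔽
  open PG3 𝔽
  open FieldProperties 𝔽
  open VectorSpace 𝔽
  open ≡-Reasoning

  -- The propositional content of `rrefWith`, together with i < j, which the Boolean test inherits
  -- from its list of index pairs.
  record Echelon (i j : ℕ) (r₁ r₂ : V4) : Set where
    field
      i<j    : i ℕ.< j
      below₁ : ∀ {m} → m ℕ.< i → coord m r₁ ≡ 0#
      pivot₁ : coord i r₁ ≡ 1#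
      below₂ : ∀ {m} → m ℕ.< j → coord m r₂ ≡ 0#
      pivot₂ : coord j r₂ ≡ 1#
      clear  : coord j r₁ ≡ 0#

  private
    index-pairs : List (ℕ × ℕ)
    index-pairs = (0 , 1) ∷ (0 , 2) ∷ (0 , 3) ∷ (1 , 2) ∷ (1 , 3) ∷ (2 , 3) ∷ []

    index-pairs-increasing : All (λ ij → proj₁ ij ℕ.< proj₂ ij) index-pairs
    index-pairs-increasing = s≤s z≤n ∷ s≤s z≤n ∷ s≤s z≤n ∷ s≤s (s≤s z≤n) ∷ s≤s (s≤s z≤n) ∷ s≤s (s≤s (s≤s z≤n)) ∷ []

    index-pairs-complete : ∀ {i j} → i ℕ.< j → j ℕ.< 4 → (i , j) ∈ index-pairs
    index-pairs-complete {0} {1} _ _ = here refl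
    index-pairs-complete {0} {2} _ _ = there (here refl)
    index-pairs-complete {0} {3} _ _ = there (there (here refl))
    index-pairs-complete {1} {2} _ _ = there (there (there (here refl)))
    index-pairs-complete {1} {3} _ _ = there (there (there (there (here refl))))
    index-pairs-complete {2} {3} _ _ = there (there (there (there (there (here refl)))))
    index-pairs-complete {suc _} {1} (s≤s ()) _
    index-pairs-complete {suc (suc _)} {2} (s≤s (s≤s ())) _
    index-pairs-complete {suc (suc (suc _))} {3} (s≤s (s≤s (s≤s ()))) _
    index-pairs-complete {_} {suc (suc (suc (suc _)))} _ (s≤s (s≤s (s≤s (s≤s ()))))

  isRREF-elim : ∀ {r₁ r₂} → isRREF (r₁ , r₂) ≡ true → ∃₂ λ i j → Echelon i j r₁ r₂
  isRREF-elim {r₁} {r₂} h with any-elim (λ ij → rrefWith (proj₁ ij) (proj₂ ij) (r₁ , r₂)) index-pairs h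
  ... | (i , j) , ij∈ , e with ∧-elim (zeroUpTo i r₁) e
  ... | z₁ , e₁ with ∧-elim (coord i r₁ == 1#) e₁
  ... | p₁ , e₂ with ∧-elim (zeroUpTo j r₂) e₂
  ... | z₂ , e₃ with ∧-elim (coord j r₂ == 1#) e₃
  ... | p₂ , c = i , j , record
    { i<j = All.lookup index-pairs-increasing ij∈
    ; below₁ = zeroUpTo-elim i r₁ z₁ ; pivot₁ = ==-elim p₁
    ; below₂ = zeroUpTo-elim j r₂ z₂ ; pivot₂ = ==-elim p₂ ; clear = ==-elim c }

  isRREF-intro : ∀ {i j r₁ r₂} → j ℕ.< 4 → Echelon i j r₁ r₂ → isRREF (r₁ , r₂) ≡ true
  isRREF-intro {i} {j} {r₁} {r₂} j<4 E =
    any-intro (λ ij → rrefWith (proj₁ ij) (proj₂ ij) (r₁ , r₂)) (index-pairs-complete i<j j<4)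
      (∧-intro (zeroUpTo-intro i r₁ below₁) (∧-intro (==-intro pivot₁)
        (∧-intro (zeroUpTo-intro j r₂ below₂) (∧-intro (==-intro pivot₂) (==-intro clear)))))
    where open Echelon E

  InSpan : V4 → V4 → V4 → Set
  InSpan v r₁ r₂ = ∃₂ λ a b → v ≡ lin a b r₁ r₂

  onLine-intro : ∀ {v r₁ r₂} → InSpan v r₁ r₂ → onLine v (r₁ , r₂) ≡ true
  onLine-intro {v} {r₁} {r₂} (a , b , e) = any-intro _ (complete a)
    (any-intro (λ b → v ==v lin a b r₁ r₂) (complete b) (==v-intro e))

  onLine-elim : ∀ {v r₁ r₂} → onLine v (r₁ , r₂) ≡ true → InSpan v r₁ r₂
  onLine-elim {v} {r₁} {r₂} h with any-elim _ elements h
  ... | a , _ , h′ with any-elim (λ b → v ==v lin a b r₁ r₂) elements h′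
  ...   | b , _ , e = a , b , ==v-elim e

  private
    combine : ∀ {a b x y x′ y′} → x ≡ x′ → y ≡ y′ → a * x + b * y ≡ a * x′ + b * y′
    combine refl refl = refl

    both-zero : ∀ {a b x y} → x ≡ 0# → y ≡ 0# → a * x + b * y ≡ 0#
    both-zero {a} {b} refl refl = solve 2 (λ a b → a :* con (0 , 0) :+ b :* con (0 , 0) := con (0 , 0)) refl a b
      where open Solver

    at : ∀ {v r₁ r₂ : V4} k a b → v ≡ lin a b r₁ r₂ → coord k v ≡ a * coord k r₁ + b * coord k r₂
    at {r₁ = r₁} {r₂} k a b e = trans (cong (coord k) e) (coord-lin k a b r₁ r₂)

    -- Left of the first pivot of s every combination of s₁ and s₂ vanishes, whereas r₁ has entry 1
    -- at its own pivot.
    pivot₁-≤ : ∀ {i j r₁ r₂ i′ j′ s₁ s₂} → Echelon i j r₁ r₂ → Echelon i′ j′ s₁ s₂ →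
      InSpan r₁ s₁ s₂ → ¬ i ℕ.< i′
    pivot₁-≤ {i} R S (a , b , e) i<i′ = 1≢0 (trans (sym R.pivot₁) (trans (at i a b e)
      (both-zero (S.below₁ i<i′) (S.below₂ (ℕₚ.<-trans i<i′ S.i<j)))))
      where
      module R = Echelon R
      module S = Echelon S

  -- In the pivot columns the basis is the identity matrix, so the coefficients of a vector of the
  -- span can be read off there.
  coefficient₁ : ∀ {i j s₁ s₂ v} a b → Echelon i j s₁ s₂ → v ≡ lin a b s₁ s₂ → coord i v ≡ a
  coefficient₁ {i} a b S e = trans (at i a b e) (trans (combine S.pivot₁ (S.below₂ S.i<j))
    (solve 2 (λ a b → a :* con (1 , 0) :+ b :* con (0 , 0) := a) refl a b))
    where
    open Solver
    module S = Echelon S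

  coefficient₂ : ∀ {i j s₁ s₂ v} a b → Echelon i j s₁ s₂ → v ≡ lin a b s₁ s₂ → coord j v ≡ b
  coefficient₂ {j = j} a b S e = trans (at j a b e) (trans (combine S.clear S.pivot₂)
    (solve 2 (λ a b → a :* con (0 , 0) :+ b :* con (1 , 0) := b) refl a b))
    where
    open Solver
    module S = Echelon S

  private
    -- r₂ vanishes in column i, so it has no s₁-component; what remains is a multiple of s₂, which
    -- vanishes left of column j′.
    pivot₂-≤ : ∀ {i j r₁ r₂ j′ s₁ s₂} → Echelon i j r₁ r₂ → Echelon i j′ s₁ s₂ →
      InSpan r₂ s₁ s₂ → ¬ j ℕ.< j′
    pivot₂-≤ {i} {j} {r₂ = r₂} {s₁ = s₁} {s₂} R S (a , b , e) j<j′ = 1≢0 (begin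
      1#                              ≡⟨ sym R.pivot₂ ⟩
      coord j r₂                      ≡⟨ at j a b e ⟩
      a * coord j s₁ + b * coord j s₂ ≡⟨ cong₂ (λ x y → x * coord j s₁ + b * y) a≡0 (S.below₂ j<j′) ⟩
      0# * coord j s₁ + b * 0#        ≡⟨ solve 2 (λ b x → con (0 , 0) :* x :+ b :* con (0 , 0) := con (0 , 0)) refl b (coord j s₁) ⟩
      0#                              ∎)
      where
      open Solver
      module R = Echelon R
      module S = Echelon S
      a≡0 : a ≡ 0#
      a≡0 = trans (sym (coefficient₁ a b S e)) (R.below₂ R.i<j)

    same-pivots : ∀ {i j r₁ r₂ s₁ s₂} → Echelon i j r₁ r₂ → Echelon i j s₁ s₂ →
      InSpan r₁ s₁ s₂ → InSpan r₂ s₁ s₂ → (r₁ , r₂) ≡ (s₁ , s₂)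
    same-pivots {s₁ = s₁} {s₂} R S (a , b , e) (c , d , f) = cong₂ _,_
      (trans e (subst₂ (λ a b → lin a b s₁ s₂ ≡ s₁)
        (trans (sym R.pivot₁) (coefficient₁ a b S e)) (trans (sym R.clear) (coefficient₂ a b S e))
        (coord-ext λ k → trans (coord-lin k 1# 0# s₁ s₂)
          (solve 2 (λ x y → con (1 , 0) :* x :+ con (0 , 0) :* y := x) refl (coord k s₁) (coord k s₂)))))
      (trans f (subst₂ (λ a b → lin a b s₁ s₂ ≡ s₂)
        (trans (sym (R.below₂ R.i<j)) (coefficient₁ c d S f)) (trans (sym R.pivot₂) (coefficient₂ c d S f))
        (coord-ext λ k → trans (coord-lin k 0# 1# s₁ s₂)
          (solve 2 (λ x y → con (0 , 0) :* x :+ con (1 , 0) :* y := y) refl (coord k s₁) (coord k s₂)))))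
      where
      open Solver
      module R = Echelon R
      module S = Echelon S

  -- The two pivots are determined by the span. With common pivots, reading off coefficients in the
  -- pivot columns forces (1, 0) for r₁ and (0, 1) for r₂.
  echelon-unique : ∀ {i j r₁ r₂ i′ j′ s₁ s₂} → Echelon i j r₁ r₂ → Echelon i′ j′ s₁ s₂ →
    InSpan r₁ s₁ s₂ → InSpan r₂ s₁ s₂ → InSpan s₁ r₁ r₂ → InSpan s₂ r₁ r₂ → (r₁ , r₂) ≡ (s₁ , s₂)
  echelon-unique {i} {j} {i′ = i′} {j′} R S r₁∈ r₂∈ s₁∈ s₂∈ with ℕₚ.<-cmp i i′
  ... | tri< i<i′ _ _ = ⊥-elim (pivot₁-≤ R S r₁∈ i<i′)
  ... | tri> _ _ i′<i = ⊥-elim (pivot₁-≤ S R s₁∈ i′<i)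
  ... | tri≈ _ refl _ with ℕₚ.<-cmp j j′
  ...   | tri< j<j′ _ _ = ⊥-elim (pivot₂-≤ R S r₂∈ j<j′)
  ...   | tri> _ _ j′<j = ⊥-elim (pivot₂-≤ S R s₂∈ j′<j)
  ...   | tri≈ _ refl _ = same-pivots R S r₁∈ r₂∈

  Independent : V4 → V4 → Set
  Independent u v = ∀ a b → lin a b u v ≡ 𝟎 → a ≡ 0# × b ≡ 0#

  private
    vanishing : ∀ {v : V4} → (∀ k → coord k v ≡ 0#) → v ≡ 𝟎
    vanishing h = coord-ext λ k → trans (h k) (sym (coord-𝟎 4 k))

  -- Cramer's rule
  independent-spans : ∀ {u v r₁ r₂} → Independent u v → InSpan u r₁ r₂ → InSpan v r₁ r₂ →
    InSpan r₁ u v × InSpan r₂ u v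
  independent-spans {u} {v} {r₁} {r₂} ind (a , b , eu) (c , d , ev) =
    (μ * d , - (μ * b) , coord-ext λ k → sym (first k)) , (- (μ * c) , μ * a , coord-ext λ k → sym (second k))
    where
    open Solver
    Δ = a * d + - (b * c)
    expand : ∀ k x y → coord k (lin x y u v) ≡ x * (a * coord k r₁ + b * coord k r₂) + y * (c * coord k r₁ + d * coord k r₂)
    expand k x y = trans (coord-lin k x y u v) (combine (at k a b eu) (at k c d ev))
    -- If Δ = 0, then d u - b v = Δ r₁ and -c u + a v = Δ r₂ are trivial relations, so a = b = 0 and
    -- u = 0, against independence.
    Δ≢0 : ¬ Δ ≡ 0#
    Δ≢0 Δ≡0 = 1≢0 (proj₁ (ind 1# 0# (vanishing λ k → trans (expand k 1# 0#)
        (trans (cong₂ (λ a b → 1# * (a * coord k r₁ + b * coord k r₂) + 0# * (c * coord k r₁ + d * coord k r₂)) a≡0 b≡0)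
        (solve 4 (λ c d x y → con (1 , 0) :* (con (0 , 0) :* x :+ con (0 , 0) :* y) :+ con (0 , 0) :* (c :* x :+ d :* y) := con (0 , 0))
          refl c d (coord k r₁) (coord k r₂))))))
      where
      negated : ∀ {x} → - x ≡ 0# → x ≡ 0#
      negated {x} h = trans (solve 1 (λ x → x := :- (:- x)) refl x) (trans (cong -_ h) (solve 0 (:- con (0 , 0) := con (0 , 0)) refl))
      b≡0 : b ≡ 0#
      b≡0 = negated (proj₂ (ind d (- b) (vanishing λ k → trans (expand k d (- b))
        (trans (solve 6 (λ a b c d x y → d :* (a :* x :+ b :* y) :+ (:- b) :* (c :* x :+ d :* y) := (a :* d :- b :* c) :* x)
                 refl a b c d (coord k r₁) (coord k r₂))
        (trans (cong (_* coord k r₁) Δ≡0) (zeroˡ _))))))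
      a≡0 : a ≡ 0#
      a≡0 = proj₂ (ind (- c) a (vanishing λ k → trans (expand k (- c) a)
        (trans (solve 6 (λ a b c d x y → (:- c) :* (a :* x :+ b :* y) :+ a :* (c :* x :+ d :* y) := (a :* d :- b :* c) :* y)
                 refl a b c d (coord k r₁) (coord k r₂))
        (trans (cong (_* coord k r₂) Δ≡0) (zeroˡ _)))))
    μ = inv Δ Δ≢0
    first : ∀ k → coord k (lin (μ * d) (- (μ * b)) u v) ≡ coord k r₁
    first k = trans (expand k (μ * d) (- (μ * b)))
      (trans (solve 7 (λ μ a b c d x y → μ :* d :* (a :* x :+ b :* y) :+ (:- (μ :* b)) :* (c :* x :+ d :* y) := μ :* (a :* d :- b :* c) :* x)
               refl μ a b c d (coord k r₁) (coord k r₂))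
      (trans (cong (_* coord k r₁) (inv-inverseˡ Δ Δ≢0)) (*-identityˡ _)))
    second : ∀ k → coord k (lin (- (μ * c)) (μ * a) u v) ≡ coord k r₂
    second k = trans (expand k (- (μ * c)) (μ * a))
      (trans (solve 7 (λ μ a b c d x y → (:- (μ :* c)) :* (a :* x :+ b :* y) :+ μ :* a :* (c :* x :+ d :* y) := μ :* (a :* d :- b :* c) :* y)
               refl μ a b c d (coord k r₁) (coord k r₂))
      (trans (cong (_* coord k r₂) (inv-inverseˡ Δ Δ≢0)) (*-identityˡ _)))

  InSpan-trans : ∀ {w u v r₁ r₂} → InSpan w u v → InSpan u r₁ r₂ → InSpan v r₁ r₂ → InSpan w r₁ r₂
  InSpan-trans {w} {u} {v} {r₁} {r₂} (x , y , e) (a , b , eu) (c , d , ev) =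
    x * a + y * c , x * b + y * d , coord-ext λ k →
      trans (at k x y e) (trans (combine (at k a b eu) (at k c d ev)) (trans
        (solve 8 (λ x y a b c d s t → x :* (a :* s :+ b :* t) :+ y :* (c :* s :+ d :* t) := (x :* a :+ y :* c) :* s :+ (x :* b :+ y :* d) :* t)
          refl x y a b c d (coord k r₁) (coord k r₂))
        (sym (coord-lin k _ _ r₁ r₂))))
    where open Solver

  private
    pivot-combination : ∀ {x y} → ¬ x ≡ 0# ⊎ ¬ y ≡ 0# → ∃₂ λ α β → α * x + β * y ≡ 1#
    pivot-combination {x} {y} (inj₁ x≢0) = inv x x≢0 , 0# ,
      trans (cong₂ _+_ (inv-inverseˡ x x≢0) (zeroˡ y)) (+-identityʳ 1#)
    pivot-combination {x} {y} (inj₂ y≢0) = 0# , inv y y≢0 ,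
      trans (cong₂ _+_ (zeroˡ x) (inv-inverseˡ y y≢0)) (+-identityˡ 1#)

  -- With i the first column in which u and v do not both vanish, w = vᵢu − uᵢv is a
  -- nonzero vector of the span starting after column i; p is one with pᵢ = 1.
  echelon-exists : ∀ {u v} → Independent u v → ∃₂ λ r₁ r₂ → isRREF (r₁ , r₂) ≡ true × InSpan u r₁ r₂ × InSpan v r₁ r₂
  echelon-exists {u} {v} ind with leading u v
  ... | inj₁ h = ⊥-elim (1≢0 (proj₁ (ind 1# 0# (vanishing λ k →
          trans (coord-lin k 1# 0# u v) (both-zero (proj₁ (h k)) (proj₂ (h k)))))))
  ... | inj₂ (i , _ , below , at-i) with pivot-combination at-i
  ...   | α , β , unit with leading w w
    where
    w = lin (coord i v) (- coord i u) u v
  -- w = 0 is a relation between u and v, so its coefficients vᵢ and -uᵢ vanish, against α uᵢ + β vᵢ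
  -- = 1.
  ...     | inj₁ h = ⊥-elim (1≢0 (trans (sym unit) (both-zero uᵢ≡0 vᵢ≡0)))
    where
    open Solver
    uᵢ≡0 : coord i u ≡ 0#
    uᵢ≡0 = trans (solve 1 (λ x → x := :- (:- x)) refl (coord i u))
      (trans (cong -_ (proj₂ (ind _ _ (vanishing (proj₁ ∘ h))))) (solve 0 (:- con (0 , 0) := con (0 , 0)) refl))
    vᵢ≡0 : coord i v ≡ 0#
    vᵢ≡0 = proj₁ (ind _ _ (vanishing (proj₁ ∘ h)))
  ...     | inj₂ (j , j<4 , below-j , at-j) =
    -- By α uᵢ + β vᵢ = 1 one has u = uᵢ p + β w and v = vᵢ p - α w; substituting p = r₁ + pⱼ r₂ and
    -- w = wⱼ r₂ gives these coefficients.
    r₁ , r₂ , isRREF-intro j<4 E , (coord i u , coord i u * coord j p + β * coord j w , coord-ext λ k → sym (u∈ k)) ,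
                                   (coord i v , coord i v * coord j p + - α * coord j w , coord-ext λ k → sym (v∈ k))
    where
    open Solver
    w p : V4
    w = lin (coord i v) (- coord i u) u v
    p = lin α β u v
    wⱼ≢0 : ¬ coord j w ≡ 0#
    wⱼ≢0 = reduce at-j
    μ = inv (coord j w) wⱼ≢0
    r₁ r₂ : V4
    r₂ = scale μ w
    r₁ = lin 1# (- coord j p) p r₂
    w-at : ∀ k → coord k w ≡ coord i v * coord k u + - coord i u * coord k v
    w-at k = coord-lin k (coord i v) (- coord i u) u v
    p-at : ∀ k → coord k p ≡ α * coord k u + β * coord k v
    p-at k = coord-lin k α β u v
    r₂-at : ∀ k → coord k r₂ ≡ μ * coord k w
    r₂-at k = coord-scale k μ w
    r₁-at : ∀ k → coord k r₁ ≡ 1# * coord k p + - coord j p * coord k r₂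
    r₁-at k = coord-lin k 1# (- coord j p) p r₂
    w-below : ∀ {m} → m ℕ.≤ i → coord m w ≡ 0#
    w-below {m} m≤i with ℕₚ.m≤n⇒m<n∨m≡n m≤i
    ... | inj₁ m<i  = trans (w-at m) (both-zero (proj₁ (below m<i)) (proj₂ (below m<i)))
    ... | inj₂ refl = trans (w-at m) (solve 2 (λ x y → y :* x :+ (:- x) :* y := con (0 , 0)) refl (coord m u) (coord m v))
    i<j : i ℕ.< j
    i<j = ℕₚ.≰⇒> (λ j≤i → wⱼ≢0 (w-below j≤i))
    r₂-below : ∀ {m} → m ℕ.< j → coord m r₂ ≡ 0#
    r₂-below {m} m<j = trans (r₂-at m) (trans (cong (μ *_) (proj₁ (below-j m<j))) (zeroʳ μ))
    r₂-pivot : coord j r₂ ≡ 1#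
    r₂-pivot = trans (r₂-at j) (inv-inverseˡ _ wⱼ≢0)
    E : Echelon i j r₁ r₂
    E = record
      { i<j    = i<j
      ; below₁ = λ {m} m<i → trans (r₁-at m) (both-zero
                   (trans (p-at m) (both-zero (proj₁ (below m<i)) (proj₂ (below m<i)))) (r₂-below (ℕₚ.<-trans m<i i<j)))
      ; pivot₁ = trans (r₁-at i) (trans (combine (trans (p-at i) unit) (r₂-below i<j))
                   (solve 1 (λ x → con (1 , 0) :* con (1 , 0) :+ (:- x) :* con (0 , 0) := con (1 , 0)) refl (coord j p)))
      ; below₂ = r₂-below
      ; pivot₂ = r₂-pivot
      ; clear  = trans (r₁-at j) (trans (cong (λ z → 1# * coord j p + - coord j p * z) r₂-pivot)
                   (solve 1 (λ x → con (1 , 0) :* x :+ (:- x) :* con (1 , 0) := con (0 , 0)) refl (coord j p)))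
      }
    recover : ∀ x γ k → coord k (lin x (x * coord j p + γ * coord j w) r₁ r₂) ≡ x * coord k p + γ * coord k w
    recover x γ k = begin
      coord k (lin x (x * coord j p + γ * coord j w) r₁ r₂)
        ≡⟨ coord-lin k x (x * coord j p + γ * coord j w) r₁ r₂ ⟩
      x * coord k r₁ + (x * coord j p + γ * coord j w) * coord k r₂
        ≡⟨ cong (λ z → x * z + (x * coord j p + γ * coord j w) * coord k r₂) (r₁-at k) ⟩
      x * (1# * coord k p + - coord j p * coord k r₂) + (x * coord j p + γ * coord j w) * coord k r₂
        ≡⟨ solve 6 (λ x γ pⱼ wⱼ pₖ r → x :* (con (1 , 0) :* pₖ :+ (:- pⱼ) :* r) :+ (x :* pⱼ :+ γ :* wⱼ) :* r := x :* pₖ :+ γ :* (wⱼ :* r))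
             refl x γ (coord j p) (coord j w) (coord k p) (coord k r₂) ⟩
      x * coord k p + γ * (coord j w * coord k r₂)
        ≡⟨ cong (λ z → x * coord k p + γ * z) (begin
             coord j w * coord k r₂        ≡⟨ cong (coord j w *_) (r₂-at k) ⟩
             coord j w * (μ * coord k w)   ≡⟨ sym (*-assoc (coord j w) μ (coord k w)) ⟩
             coord j w * μ * coord k w     ≡⟨ cong (_* coord k w) (inv-inverseʳ _ wⱼ≢0) ⟩
             1# * coord k w                ≡⟨ *-identityˡ _ ⟩
             coord k w                     ∎) ⟩
      x * coord k p + γ * coord k w ∎
    u∈ : ∀ k → coord k (lin (coord i u) (coord i u * coord j p + β * coord j w) r₁ r₂) ≡ coord k u
    u∈ k = begin
      coord k (lin (coord i u) (coord i u * coord j p + β * coord j w) r₁ r₂)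
        ≡⟨ recover (coord i u) β k ⟩
      coord i u * coord k p + β * coord k w
        ≡⟨ cong₂ (λ a b → coord i u * a + β * b) (p-at k) (w-at k) ⟩
      coord i u * (α * coord k u + β * coord k v) + β * (coord i v * coord k u + - coord i u * coord k v)
        ≡⟨ solve 6 (λ x y α β s t → x :* (α :* s :+ β :* t) :+ β :* (y :* s :+ (:- x) :* t) := (α :* x :+ β :* y) :* s)
             refl (coord i u) (coord i v) α β (coord k u) (coord k v) ⟩
      (α * coord i u + β * coord i v) * coord k u
        ≡⟨ trans (cong (_* coord k u) unit) (*-identityˡ _) ⟩
      coord k u ∎
    v∈ : ∀ k → coord k (lin (coord i v) (coord i v * coord j p + - α * coord j w) r₁ r₂) ≡ coord k v
    v∈ k = begin
      coord k (lin (coord i v) (coord i v * coord j p + - α * coord j w) r₁ r₂)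
        ≡⟨ recover (coord i v) (- α) k ⟩
      coord i v * coord k p + - α * coord k w
        ≡⟨ cong₂ (λ a b → coord i v * a + - α * b) (p-at k) (w-at k) ⟩
      coord i v * (α * coord k u + β * coord k v) + - α * (coord i v * coord k u + - coord i u * coord k v)
        ≡⟨ solve 6 (λ x y α β s t → y :* (α :* s :+ β :* t) :+ (:- α) :* (y :* s :+ (:- x) :* t) := (α :* x :+ β :* y) :* t)
             refl (coord i u) (coord i v) α β (coord k u) (coord k v) ⟩
      (α * coord i u + β * coord i v) * coord k v
        ≡⟨ trans (cong (_* coord k v) unit) (*-identityˡ _) ⟩
      coord k v ∎

-- Counting lines through a point inside a subspace.

module LineCounting (𝔽 : FiniteField) where
  open FiniteField 𝔽
  open PG3 𝔽
  open FieldProperties 𝔽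
  open VectorSpace 𝔽
  open LineGeometry 𝔽
  open ≡-Reasoning

  private
    _≟v_ : DecidableEquality V4
    _≟v_ = VecP.≡-dec _≟_

    _≟ℓ_ : DecidableEquality Line
    _≟ℓ_ = ProductP.≡-dec _≟v_ _≟v_

    line-candidates : List Line
    line-candidates = concatMap (λ r₁ → map (r₁ ,_) (vectors 4)) (vectors 4)

    module 𝕃 = Enumeration _≟ℓ_ line-candidates

    candidates-enumerate : 𝕃.Enumerates
    candidates-enumerate (r , s) = begin
      sumOver (λ m → ι ((r , s) 𝕃.≈ m)) line-candidates
        ≡⟨ trans (sum-concatMap _ _ (vectors 4)) (sum-cong (λ x → sum-map _ (x ,_) (vectors 4)) (vectors 4)) ⟩
      sumOver (λ x → sumOver (λ y → ι ((r , s) 𝕃.≈ (x , y))) (vectors 4)) (vectors 4)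
        ≡⟨ sum-cong (λ x → trans (sum-cong (λ y → trans (cong ι (split x y)) (ι-∧ (r ==v x) (s ==v y))) (vectors 4))
                                 (trans (sum-*ˡ (ι (r ==v x)) _ (vectors 4))
                                 (trans (cong (ι (r ==v x) ℕ.*_) (vectors-enumerate 4 s)) (ℕₚ.*-identityʳ _)))) (vectors 4) ⟩
      sumOver (λ x → ι (r ==v x)) (vectors 4)
        ≡⟨ vectors-enumerate 4 r ⟩
      1 ∎
      where
      split : ∀ x y → ((r , s) 𝕃.≈ (x , y)) ≡ (r ==v x) ∧ (s ==v y)
      split x y = bool-ext
        (λ e → let h = isYes-elim ((r , s) ≟ℓ (x , y)) e in ∧-intro (==v-intro (cong proj₁ h)) (==v-intro (cong proj₂ h)))
        (λ e → isYes-intro ((r , s) ≟ℓ (x , y))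
                 (cong₂ _,_ (==v-elim (proj₁ (∧-elim (r ==v x) e))) (==v-elim (proj₂ (∧-elim (r ==v x) e)))))

    sum-lines : ∀ f → sumOver f lines ≡ sumOver (λ ℓ → ι (isRREF ℓ) ℕ.* f ℓ) line-candidates
    sum-lines f = sum-filter f isRREF line-candidates

  sum-lines-cong : ∀ {f g} → (∀ ℓ → isRREF ℓ ≡ true → f ℓ ≡ g ℓ) → sumOver f lines ≡ sumOver g lines
  sum-lines-cong {f} {g} h = trans (sum-lines f)
    (trans (sum-cong (λ ℓ → ι-cong* (isRREF ℓ) (h ℓ)) line-candidates) (sym (sum-lines g)))

  -- Elimination produces one echelon basis. Any other line containing u and v has, by Cramer's
  -- rule, the same span, hence the same basis.
  line-through : ∀ {u v} → Independent u v → sumOver (λ ℓ → ι (onLine u ℓ) ℕ.* ι (onLine v ℓ)) lines ≡ 1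
  line-through {u} {v} ind with echelon-exists ind
  ... | r₁ , r₂ , R , u∈ , v∈ = begin
    sumOver (λ ℓ → ι (onLine u ℓ) ℕ.* ι (onLine v ℓ)) lines
      ≡⟨ sum-lines _ ⟩
    sumOver (λ ℓ → ι (isRREF ℓ) ℕ.* (ι (onLine u ℓ) ℕ.* ι (onLine v ℓ))) line-candidates
      ≡⟨ sum-cong (λ ℓ → sym (trans (ι-∧ (isRREF ℓ) _) (cong (ι (isRREF ℓ) ℕ.*_) (ι-∧ (onLine u ℓ) (onLine v ℓ))))) line-candidates ⟩
    sumOver (λ ℓ → ι (isRREF ℓ ∧ onLine u ℓ ∧ onLine v ℓ)) line-candidates
      ≡⟨ 𝕃.sum≡1 candidates-enumerate _ (r₁ , r₂) (∧-intro R (∧-intro (onLine-intro u∈) (onLine-intro v∈))) only ⟩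
    1 ∎
    where
    only : ∀ ℓ → isRREF ℓ ∧ onLine u ℓ ∧ onLine v ℓ ≡ true → (r₁ , r₂) ≡ ℓ
    only (s₁ , s₂) h =
      let S , h′ = ∧-elim (isRREF (s₁ , s₂)) h
          u∈s , v∈s = ∧-elim (onLine u (s₁ , s₂)) h′
          u∈′ = onLine-elim {u} {s₁} {s₂} u∈s
          v∈′ = onLine-elim {v} {s₁} {s₂} v∈s
          _ , _ , E = isRREF-elim R
          _ , _ , F = isRREF-elim S
          r₁∈ , r₂∈ = independent-spans ind u∈ v∈
          s₁∈ , s₂∈ = independent-spans ind u∈′ v∈′
      in echelon-unique E F (InSpan-trans r₁∈ u∈′ v∈′) (InSpan-trans r₂∈ u∈′ v∈′)
                            (InSpan-trans s₁∈ u∈ v∈) (InSpan-trans s₂∈ u∈ v∈)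

  private
    span-coordinates : ∀ {i j r₁ r₂ v a b} → Echelon i j r₁ r₂ → v ≡ lin a b r₁ r₂ → a ≡ coord i v × b ≡ coord j v
    span-coordinates {a = a} {b} E e = sym (coefficient₁ a b E e) , sym (coefficient₂ a b E e)

  -- Each vector of the line has a single pair of coefficients, found in the pivot columns, so
  -- counting vectors amounts to counting pairs of scalars.
  line-size : ∀ ℓ → isRREF ℓ ≡ true → size (λ v → onLine v ℓ) ≡ order ℕ.* order
  line-size (r₁ , r₂) R = begin
    sumOver (λ v → ι (onLine v (r₁ , r₂))) (vectors 4)
      ≡⟨ sum-cong (λ v → sym (representations v)) (vectors 4) ⟩
    sumOver (λ v → sumOver (λ a → sumOver (λ b → ι (lin a b r₁ r₂ ==v v)) elements) elements) (vectors 4)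
      ≡⟨ sum-swap _ (vectors 4) elements ⟩
    sumOver (λ a → sumOver (λ v → sumOver (λ b → ι (lin a b r₁ r₂ ==v v)) elements) (vectors 4)) elements
      ≡⟨ sum-cong (λ a → trans (sum-swap _ (vectors 4) elements)
                         (trans (sum-cong (λ b → vectors-enumerate 4 (lin a b r₁ r₂)) elements) (order-sum 1))) elements ⟩
    sumOver (λ _ → order ℕ.* 1) elements
      ≡⟨ trans (order-sum (order ℕ.* 1)) (cong (order ℕ.*_) (ℕₚ.*-identityʳ order)) ⟩
    order ℕ.* order ∎
    where
    E = proj₂ (proj₂ (isRREF-elim R))
    representations : ∀ v → sumOver (λ a → sumOver (λ b → ι (lin a b r₁ r₂ ==v v)) elements) elements ≡ ι (onLine v (r₁ , r₂))
    representations v with onLine v (r₁ , r₂) in eq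
    ... | false = sum-0 (λ a → 𝔼.sum≡0 elements-enumerate _ (λ b → ==v-false (λ e →
                    false≢true eq (onLine-intro (a , b , sym e))))) elements
    ... | true with onLine-elim {v} {r₁} {r₂} eq
    ...   | a₀ , b₀ , e₀ = trans (sum-cong (λ a → trans (sum-cong (λ b → trans (cong ι (agree a b)) (ι-∧ (a₀ == a) (b₀ == b))) elements)
                (trans (sum-*ˡ (ι (a₀ == a)) _ elements)
                (trans (cong (ι (a₀ == a) ℕ.*_) (elements-enumerate b₀)) (ℕₚ.*-identityʳ _)))) elements) (elements-enumerate a₀)
      where
      agree : ∀ a b → (lin a b r₁ r₂ ==v v) ≡ (a₀ == a) ∧ (b₀ == b)
      agree a b = bool-ext
        (λ h → let c = span-coordinates E (sym (==v-elim h)) ; c₀ = span-coordinates E e₀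
               in ∧-intro (==-intro (trans (proj₁ c₀) (sym (proj₁ c)))) (==-intro (trans (proj₂ c₀) (sym (proj₂ c)))))
        (λ h → ==v-intro (sym (trans e₀ (cong₂ (λ a b → lin a b r₁ r₂) (==-elim (proj₁ (∧-elim (a₀ == a) h)))
                                                                      (==-elim (proj₂ (∧-elim (a₀ == a) h)))))))

  isMultiple : V4 → V4 → Bool
  isMultiple x v = any (λ a → v ==v scale a x) elements

  isMultiple-elim : ∀ x v → isMultiple x v ≡ true → ∃ λ a → v ≡ scale a x
  isMultiple-elim x v h with any-elim _ elements h
  ... | a , _ , e = a , ==v-elim e

  isMultiple-intro : ∀ x a → isMultiple x (scale a x) ≡ true
  isMultiple-intro x a = any-intro _ (complete a) (==v-intro refl)

  private
    scale-injective : ∀ {x : V4} {a b} → ¬ x ≡ 𝟎 → scale a x ≡ scale b x → a ≡ b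
    scale-injective {x} {a} {b} x≢𝟎 e with leading x x
    ... | inj₁ h = ⊥-elim (x≢𝟎 (coord-ext λ k → trans (proj₁ (h k)) (sym (coord-𝟎 4 k))))
    ... | inj₂ (i , _ , _ , at-i) = x-y≡0⇒x≡y (*-cancelʳ-0 (reduce at-i) (begin
      (a + - b) * coord i x                       ≡⟨ solve 3 (λ a b x → (a :- b) :* x := a :* x :- b :* x) refl a b (coord i x) ⟩
      a * coord i x + - (b * coord i x)           ≡⟨ cong₂ (λ y z → y + - z) (sym (coord-scale i a x)) (sym (coord-scale i b x)) ⟩
      coord i (scale a x) + - coord i (scale b x) ≡⟨ cong (λ z → coord i z + - coord i (scale b x)) e ⟩
      coord i (scale b x) + - coord i (scale b x) ≡⟨ -‿inverseʳ _ ⟩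
      0#                                          ∎))
      where open Solver

  multiples-size : ∀ {x} → ¬ x ≡ 𝟎 → size (isMultiple x) ≡ order
  multiples-size {x} x≢𝟎 = begin
    sumOver (λ v → ι (isMultiple x v)) (vectors 4)
      ≡⟨ sum-cong (λ v → sym (representations v)) (vectors 4) ⟩
    sumOver (λ v → sumOver (λ a → ι (scale a x ==v v)) elements) (vectors 4)
      ≡⟨ sum-swap _ (vectors 4) elements ⟩
    sumOver (λ a → sumOver (λ v → ι (scale a x ==v v)) (vectors 4)) elements
      ≡⟨ sum-cong (λ a → vectors-enumerate 4 (scale a x)) elements ⟩
    sumOver (λ _ → 1) elements
      ≡⟨ trans (order-sum 1) (ℕₚ.*-identityʳ order) ⟩
    order ∎
    where
    representations : ∀ v → sumOver (λ a → ι (scale a x ==v v)) elements ≡ ι (isMultiple x v)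
    representations v with isMultiple x v in eq
    ... | false = 𝔼.sum≡0 elements-enumerate _ (λ a → ==v-false (λ { refl → false≢true eq (isMultiple-intro x a) }))
    ... | true with isMultiple-elim x v eq
    ...   | a₀ , refl = 𝔼.sum≡1 elements-enumerate _ a₀ (==v-intro refl) (λ a h → scale-injective x≢𝟎 (sym (==v-elim h)))

  -- A relation a x + b v = 0 with b ≠ 0 could be solved for v as a multiple of x.
  nonmultiple-independent : ∀ {x v} → ¬ x ≡ 𝟎 → isMultiple x v ≡ false → Independent x v
  nonmultiple-independent {x} {v} x≢𝟎 h a b e with b ≟ 0#
  ... | no b≢0 = ⊥-elim (false≢true h (subst (λ w → isMultiple x w ≡ true) (sym v≡) (isMultiple-intro x (- (μ * a)))))
    where
    open Solver
    μ = inv b b≢0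
    v≡ : v ≡ scale (- (μ * a)) x
    v≡ = coord-ext λ k → sym (begin
      coord k (scale (- (μ * a)) x)                  ≡⟨ coord-scale k (- (μ * a)) x ⟩
      - (μ * a) * coord k x                          ≡⟨ solve 5 (λ μ a b x y → (:- (μ :* a)) :* x := (μ :* b) :* y :- μ :* (a :* x :+ b :* y)) refl μ a b (coord k x) (coord k v) ⟩
      μ * b * coord k v + - (μ * (a * coord k x + b * coord k v))
        ≡⟨ cong₂ (λ s t → s * coord k v + - (μ * t)) (inv-inverseˡ b b≢0)
             (trans (sym (coord-lin k a b x v)) (trans (cong (coord k) e) (coord-𝟎 4 k))) ⟩
      1# * coord k v + - (μ * 0#)                    ≡⟨ solve 2 (λ μ y → con (1 , 0) :* y :- μ :* con (0 , 0) := y) refl μ (coord k v) ⟩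
      coord k v                                      ∎)
  ... | yes refl with a ≟ 0#
  ...   | yes a≡0 = a≡0 , refl
  ...   | no a≢0 = ⊥-elim (scale-≢𝟎 a≢0 x≢𝟎 (coord-ext λ k → trans (coord-scale k a x)
            (trans (solve 3 (λ a x y → a :* x := a :* x :+ con (0 , 0) :* y) refl a (coord k x) (coord k v))
            (trans (sym (coord-lin k a 0# x v)) (cong (coord k) e)))))
    where open Solver

  vanish-lin : ∀ ds {u v} → vanish ds u ≡ true → vanish ds v ≡ true → ∀ {w} → InSpan w u v → vanish ds w ≡ true
  vanish-lin []       hu hv s = refl
  vanish-lin (d ∷ ds) {u} {v} hu hv (a , b , refl) = ∧-intro
    (==-intro (trans (dot-lin a b d u v) (trans (cong₂ (λ x y → a * x + b * y)
       (==-elim (proj₁ (∧-elim (onPlane u d) hu))) (==-elim (proj₁ (∧-elim (onPlane v d) hv))))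
       (solve 2 (λ a b → a :* con (0 , 0) :+ b :* con (0 , 0) := con (0 , 0)) refl a b))))
    (vanish-lin ds {u} {v} (proj₂ (∧-elim (onPlane u d) hu)) (proj₂ (∧-elim (onPlane v d) hv)) (a , b , refl))
    where open Solver

  lineIn : List V4 → Line → Bool
  lineIn ds (r₁ , r₂) = vanish ds r₁ ∧ vanish ds r₂

  lineIn-elim : ∀ ds {ℓ v} → lineIn ds ℓ ≡ true → onLine v ℓ ≡ true → vanish ds v ≡ true
  lineIn-elim ds {r₁ , r₂} {v} h v∈ℓ = vanish-lin ds {r₁} {r₂} (proj₁ (∧-elim (vanish ds r₁) h)) (proj₂ (∧-elim (vanish ds r₁) h))
    (onLine-elim {v} {r₁} {r₂} v∈ℓ)

  lineIn-intro : ∀ ds {ℓ u v} → Independent u v → onLine u ℓ ≡ true → onLine v ℓ ≡ true →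
    vanish ds u ≡ true → vanish ds v ≡ true → lineIn ds ℓ ≡ true
  lineIn-intro ds {r₁ , r₂} {u} {v} ind u∈ v∈ hu hv =
    let spans = independent-spans ind (onLine-elim {u} {r₁} {r₂} u∈) (onLine-elim {v} {r₁} {r₂} v∈)
    in ∧-intro (vanish-lin ds {u} {v} hu hv (proj₁ spans)) (vanish-lin ds {u} {v} hu hv (proj₂ spans))

  private
    multiple-onLine : ∀ {x v ℓ} → onLine x ℓ ≡ true → isMultiple x v ≡ true → onLine v ℓ ≡ true
    multiple-onLine {x} {v} {r₁ , r₂} x∈ℓ h with isMultiple-elim x v h | onLine-elim {x} {r₁} {r₂} x∈ℓ
    ... | c , refl | a , b , refl = onLine-intro (c * a , c * b , coord-ext λ k → trans (coord-scale k c (lin a b r₁ r₂))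
      (trans (cong (c *_) (coord-lin k a b r₁ r₂)) (trans
        (solve 5 (λ c a b x y → c :* (a :* x :+ b :* y) := (c :* a) :* x :+ (c :* b) :* y) refl c a b (coord k r₁) (coord k r₂))
        (sym (coord-lin k (c * a) (c * b) r₁ r₂)))))
      where open Solver

    vanish-multiple : ∀ ds {x v} → vanish ds x ≡ true → isMultiple x v ≡ true → vanish ds v ≡ true
    vanish-multiple ds {x} {v} hx h with isMultiple-elim x v h
    ... | c , refl = vanish-lin ds {x} {x} hx hx (c , 0# , coord-ext λ k → trans (coord-scale k c x)
      (trans (solve 2 (λ c x → c :* x := c :* x :+ con (0 , 0) :* x) refl c (coord k x)) (sym (coord-lin k c 0# x x))))
      where open Solver

    remove-multiples : ∀ {x} → ¬ x ≡ 𝟎 → ∀ (W : V4 → Bool) → (∀ v → isMultiple x v ≡ true → W v ≡ true) →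
      sumOver (λ v → ι (not (isMultiple x v)) ℕ.* ι (W v)) (vectors 4) ℕ.+ order ≡ size W
    remove-multiples {x} x≢𝟎 W h = trans
      (cong (sumOver (λ v → ι (not (isMultiple x v)) ℕ.* ι (W v)) (vectors 4) ℕ.+_) (sym (multiples-size x≢𝟎)))
      (trans (sym (sum-+ _ _ (vectors 4))) (sum-cong split (vectors 4)))
      where
      split : ∀ v → ι (not (isMultiple x v)) ℕ.* ι (W v) ℕ.+ ι (isMultiple x v) ≡ ι (W v)
      split v with isMultiple x v in eq
      ... | true rewrite h v eq = refl
      ... | false = trans (ℕₚ.+-identityʳ _) (ℕₚ.+-identityʳ _)

  linesThrough : V4 → List V4 → ℕ
  linesThrough x ds = sumOver (λ ℓ → ι (onLine x ℓ) ℕ.* ι (lineIn ds ℓ)) lines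

  -- Every vector of the subspace that is not a multiple of x spans with x exactly one line.
  linesThrough-size : ∀ {x} ds → ¬ x ≡ 𝟎 → vanish ds x ≡ true → ∀ m → m ℕ.+ order ≡ order ℕ.* order →
    linesThrough x ds ℕ.* m ℕ.+ order ≡ size (vanish ds)
  linesThrough-size {x} ds x≢𝟎 x∈ds m m+q≡q² = begin
    linesThrough x ds ℕ.* m ℕ.+ order
      ≡⟨ cong (ℕ._+ order) (begin
        linesThrough x ds ℕ.* m
          ≡⟨ sym (sum-*ʳ _ m lines) ⟩
        sumOver (λ ℓ → ι (onLine x ℓ) ℕ.* ι (lineIn ds ℓ) ℕ.* m) lines
          -- m = q² - q is the number of vectors of a line through x that are not multiples of x.
          ≡⟨ sum-lines-cong on-each-line ⟩
        sumOver (λ ℓ → sumOver (λ v → ι (onLine x ℓ) ℕ.* ι (lineIn ds ℓ) ℕ.* (ι (not (isMultiple x v)) ℕ.* ι (onLine v ℓ))) (vectors 4)) lines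
          ≡⟨ sum-swap _ lines (vectors 4) ⟩
        sumOver (λ v → sumOver (λ ℓ → ι (onLine x ℓ) ℕ.* ι (lineIn ds ℓ) ℕ.* (ι (not (isMultiple x v)) ℕ.* ι (onLine v ℓ))) lines) (vectors 4)
          ≡⟨ sum-cong for-each-vector (vectors 4) ⟩
        sumOver (λ v → ι (not (isMultiple x v)) ℕ.* ι (vanish ds v)) (vectors 4) ∎) ⟩
    sumOver (λ v → ι (not (isMultiple x v)) ℕ.* ι (vanish ds v)) (vectors 4) ℕ.+ order
      ≡⟨ remove-multiples x≢𝟎 (vanish ds) (λ v → vanish-multiple ds x∈ds) ⟩
    size (vanish ds) ∎
    where
    weighted : ∀ a b {m n} → (a ≡ true → m ≡ n) → ι a ℕ.* ι b ℕ.* m ≡ ι a ℕ.* ι b ℕ.* n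
    weighted true  b h = cong (ι true ℕ.* ι b ℕ.*_) (h refl)
    weighted false b h = refl
    on-each-line : ∀ ℓ → isRREF ℓ ≡ true → ι (onLine x ℓ) ℕ.* ι (lineIn ds ℓ) ℕ.* m ≡
      sumOver (λ v → ι (onLine x ℓ) ℕ.* ι (lineIn ds ℓ) ℕ.* (ι (not (isMultiple x v)) ℕ.* ι (onLine v ℓ))) (vectors 4)
    on-each-line ℓ R = trans (weighted (onLine x ℓ) (lineIn ds ℓ) (λ x∈ℓ → ℕₚ.+-cancelʳ-≡ order m _
        (trans m+q≡q² (trans (sym (line-size ℓ R)) (sym (remove-multiples x≢𝟎 (λ v → onLine v ℓ) (λ v → multiple-onLine {x} {v} {ℓ} x∈ℓ)))))))
      (sym (sum-*ˡ (ι (onLine x ℓ) ℕ.* ι (lineIn ds ℓ)) _ (vectors 4)))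
    for-each-vector : ∀ v → sumOver (λ ℓ → ι (onLine x ℓ) ℕ.* ι (lineIn ds ℓ) ℕ.* (ι (not (isMultiple x v)) ℕ.* ι (onLine v ℓ))) lines
      ≡ ι (not (isMultiple x v)) ℕ.* ι (vanish ds v)
    for-each-vector v with isMultiple x v in eq
    ... | true  = sum-0 (λ ℓ → ℕₚ.*-zeroʳ (ι (onLine x ℓ) ℕ.* ι (lineIn ds ℓ))) lines
    ... | false = begin
      sumOver (λ ℓ → ι (onLine x ℓ) ℕ.* ι (lineIn ds ℓ) ℕ.* (1 ℕ.* ι (onLine v ℓ))) lines
        ≡⟨ sum-cong (λ ℓ → contained (onLine x ℓ) (onLine v ℓ) (lineIn ds ℓ) (vanish ds v)
             (λ x∈ v∈ → bool-ext (λ h → lineIn-elim ds {ℓ} {v} h v∈) (lineIn-intro ds {ℓ} ind x∈ v∈ x∈ds))) lines ⟩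
      sumOver (λ ℓ → ι (vanish ds v) ℕ.* (ι (onLine x ℓ) ℕ.* ι (onLine v ℓ))) lines
        ≡⟨ sum-*ˡ (ι (vanish ds v)) _ lines ⟩
      ι (vanish ds v) ℕ.* sumOver (λ ℓ → ι (onLine x ℓ) ℕ.* ι (onLine v ℓ)) lines
        ≡⟨ trans (cong (ι (vanish ds v) ℕ.*_) (line-through ind)) (ℕₚ.*-comm (ι (vanish ds v)) 1) ⟩
      1 ℕ.* ι (vanish ds v) ∎
      where
      ind = nonmultiple-independent x≢𝟎 eq
      contained : ∀ a b c d → (a ≡ true → b ≡ true → c ≡ d) → ι a ℕ.* ι c ℕ.* (1 ℕ.* ι b) ≡ ι d ℕ.* (ι a ℕ.* ι b)
      contained true  true  c d h rewrite h refl refl = lemma (ι d)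
        where
        lemma : ∀ n → 1 ℕ.* n ℕ.* (1 ℕ.* 1) ≡ n ℕ.* (1 ℕ.* 1)
        lemma = solve-∀
      contained true  false c d h = trans (ℕₚ.*-zeroʳ (1 ℕ.* ι c)) (sym (ℕₚ.*-zeroʳ (ι d)))
      contained false b     c d h = sym (ℕₚ.*-zeroʳ (ι d))

-- The twisted cubic as a curve of binary cubic forms.

module TwistedCubic (𝔽 : FiniteField) where
  open FiniteField 𝔽
  open PG3 𝔽
  open FieldProperties 𝔽
  open VectorSpace 𝔽
  open LineGeometry 𝔽
  open LineCounting 𝔽
  open ≡-Reasoning

  -- The projective line of parameters, with `nothing` as ∞, so that sums over the points of the
  -- cubic and hypotheses of distinctness treat P(∞) like every other point.
  Parameter : Set
  Parameter = Maybe Carrier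

  _≟ₚ_ : DecidableEquality Parameter
  _≟ₚ_ = MaybeP.≡-dec _≟_

  parameters : List Parameter
  parameters = nothing ∷ map just elements

  module ℙ = Enumeration _≟ₚ_ parameters
  open ℙ using (_≉_)

  parameters-enumerate : ℙ.Enumerates
  parameters-enumerate nothing  = cong suc (trans (sum-map _ just elements)
    (sum-0 (λ t → cong ι (isYes-false (nothing ≟ₚ just t) (λ ()))) elements))
  parameters-enumerate (just s) = trans (sum-map _ just elements)
    (trans (sum-cong (λ t → cong ι (isYes-cong (just s ≟ₚ just t) (s ≟ t) MaybeP.just-injective (cong just))) elements)
           (elements-enumerate s))

  pt : Parameter → V4
  pt (just t) = P t
  pt nothing  = P∞

  Γᵖ : Parameter → Plane
  Γᵖ (just t) = Γ t
  Γᵖ nothing  = Γ∞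

  countC≡sum : ∀ f → countC f ≡ sumOver (λ X → ι (f (pt X))) parameters
  countC≡sum f = trans (ℕₚ.+-comm (Defs.count (λ t → f (P t)) elements) _) (cong₂ ℕ._+_ (if-ι (f P∞))
    (trans (count≡sum (λ t → f (P t)) elements) (sym (sum-map _ just elements))))
    where
    if-ι : ∀ b → (if b then 1 else 0) ≡ ι b
    if-ι true  = refl
    if-ι false = refl

  parameters-sum : ∀ k → sumOver (λ (_ : Parameter) → k) parameters ≡ suc order ℕ.* k
  parameters-sum k = cong (k ℕ.+_) (trans (sum-map (λ _ → k) just elements) (order-sum k))

  -- The value at Y = (t : u) of the linear form t′ − s u′ (or u′ when X = ∞) vanishing at X.
  form : Parameter → Carrier × Carrier
  form (just s) = 1# , - s
  form nothing  = 0# , 1#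

  value : Parameter → Parameter → Carrier
  value X (just t) = proj₁ (form X) * t + proj₂ (form X)
  value X nothing  = proj₁ (form X)

  -- The coefficients of t³, t²u, tu², u³ in (a t + a′ u)(b t + b′ u)(c t + c′ u). These monomials
  -- are the coordinates of a point of the cubic, so the vector is a plane and pairing it with the
  -- point evaluates the product.
  cubicForm : Carrier × Carrier → Carrier × Carrier → Carrier × Carrier → V4
  cubicForm (a , a′) (b , b′) (c , c′) =
    a * b * c ∷ a * b * c′ + a * b′ * c + a′ * b * c ∷ a * b′ * c′ + a′ * b * c′ + a′ * b′ * c ∷ a′ * b′ * c′ ∷ []

  -- Repeated parameters are meaningful: X, Y, Y gives the plane through X that contains the tangent
  -- at Y, and X, X, X the osculating plane at X. No point of the cubic beyond those named lies on
  -- the plane.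
  throughThree : Parameter → Parameter → Parameter → Plane
  throughThree X Y Z = cubicForm (form X) (form Y) (form Z)

  dot-throughThree : ∀ X Y Z W → dot (throughThree X Y Z) (pt W) ≡ value X W * value Y W * value Z W
  dot-throughThree X Y Z (just t) =
    solve 7 (λ t a a′ b b′ c c′ →
        a :* b :* c :* (t :* t :* t) :+ ((a :* b :* c′ :+ a :* b′ :* c :+ a′ :* b :* c) :* (t :* t) :+
        ((a :* b′ :* c′ :+ a′ :* b :* c′ :+ a′ :* b′ :* c) :* t :+ (a′ :* b′ :* c′ :* con (1 , 0) :+ con (0 , 0))))
        := (a :* t :+ a′) :* (b :* t :+ b′) :* (c :* t :+ c′)) refl
      t (proj₁ (form X)) (proj₂ (form X)) (proj₁ (form Y)) (proj₂ (form Y)) (proj₁ (form Z)) (proj₂ (form Z))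
    where open Solver
  dot-throughThree X Y Z nothing =
    solve 6 (λ a a′ b b′ c c′ →
        a :* b :* c :* con (1 , 0) :+ ((a :* b :* c′ :+ a :* b′ :* c :+ a′ :* b :* c) :* con (0 , 0) :+
        ((a :* b′ :* c′ :+ a′ :* b :* c′ :+ a′ :* b′ :* c) :* con (0 , 0) :+ (a′ :* b′ :* c′ :* con (0 , 0) :+ con (0 , 0))))
        := a :* b :* c) refl
      (proj₁ (form X)) (proj₂ (form X)) (proj₁ (form Y)) (proj₂ (form Y)) (proj₁ (form Z)) (proj₂ (form Z))
    where open Solver

  -- (1, -3t, 3t², -t³) is the binomial expansion of the cube of the linear form vanishing at t; at
  -- ∞ the cube is u³.
  Γᵖ≡throughThree : ∀ X → Γᵖ X ≡ throughThree X X X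
  Γᵖ≡throughThree (just t) = cong₂ _∷_ (solve 0 (con (1 , 0) := con (1 , 0) :* con (1 , 0) :* con (1 , 0)) refl)
    (cong₂ _∷_ (solve 1 (λ t → :- (con (3 , 0) :* t) := con (1 , 0) :* con (1 , 0) :* (:- t) :+ con (1 , 0) :* (:- t) :* con (1 , 0) :+ (:- t) :* con (1 , 0) :* con (1 , 0)) refl t)
    (cong₂ _∷_ (solve 1 (λ t → con (3 , 0) :* (t :* t) := con (1 , 0) :* (:- t) :* (:- t) :+ (:- t) :* con (1 , 0) :* (:- t) :+ (:- t) :* (:- t) :* con (1 , 0)) refl t)
    (cong₂ _∷_ (solve 1 (λ t → :- (t :* t :* t) := (:- t) :* (:- t) :* (:- t)) refl t) refl)))
    where open Solver
  Γᵖ≡throughThree nothing = cong₂ _∷_ (solve 0 (z := z :* z :* z) refl)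
    (cong₂ _∷_ (solve 0 (z := z :* z :* o :+ z :* o :* z :+ o :* z :* z) refl)
    (cong₂ _∷_ (solve 0 (z := z :* o :* o :+ o :* z :* o :+ o :* o :* z) refl)
    (cong₂ _∷_ (solve 0 (o := o :* o :* o) refl) refl)))
    where
    open Solver
    z o : Polynomial 0
    z = con (0 , 0)
    o = con (1 , 0)

  value-self : ∀ X → value X X ≡ 0#
  value-self (just t) = solve 1 (λ t → con (1 , 0) :* t :+ :- t := con (0 , 0)) refl t
    where open Solver
  value-self nothing = refl

  value-≢0 : ∀ {X Y} → ¬ X ≡ Y → ¬ value X Y ≡ 0#
  value-≢0 {just s}  {just t}  X≢Y e = X≢Y (cong just (sym (x-y≡0⇒x≡y (trans (cong (_+ - s) (sym (*-identityˡ t))) e))))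
  value-≢0 {just s}  {nothing} X≢Y e = 1≢0 e
  value-≢0 {nothing} {just t}  X≢Y e = 1≢0 (trans (solve 1 (λ t → con (1 , 0) := con (0 , 0) :* t :+ con (1 , 0)) refl t) e)
    where open Solver
  value-≢0 {nothing} {nothing} X≢Y e = X≢Y refl

  throughThree-on : ∀ X Y Z {W} → X ≡ W ⊎ Y ≡ W ⊎ Z ≡ W → dot (throughThree X Y Z) (pt W) ≡ 0#
  throughThree-on X Y Z {W} h = trans (dot-throughThree X Y Z W) (zero-factor h)
    where
    zero-factor : X ≡ W ⊎ Y ≡ W ⊎ Z ≡ W → value X W * value Y W * value Z W ≡ 0#
    zero-factor (inj₁ refl)        = trans (cong (λ z → z * value Y X * value Z X) (value-self X)) (trans (cong (_* value Z X) (zeroˡ _)) (zeroˡ _))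
    zero-factor (inj₂ (inj₁ refl)) = trans (cong (λ z → value X Y * z * value Z Y) (value-self Y)) (trans (cong (_* value Z Y) (zeroʳ _)) (zeroˡ _))
    zero-factor (inj₂ (inj₂ refl)) = trans (cong (value X Z * value Y Z *_) (value-self Z)) (zeroʳ _)

  throughThree-off : ∀ {X Y Z W} → ¬ X ≡ W → ¬ Y ≡ W → ¬ Z ≡ W → ¬ dot (throughThree X Y Z) (pt W) ≡ 0#
  throughThree-off {X} {Y} {Z} {W} h₁ h₂ h₃ e =
    *-≢0 (*-≢0 (value-≢0 h₁) (value-≢0 h₂)) (value-≢0 h₃) (trans (sym (dot-throughThree X Y Z W)) e)

  pt-on-Γᵖ : ∀ X → onPlane (pt X) (Γᵖ X) ≡ true
  pt-on-Γᵖ X = ==-intro (trans (cong (λ c → dot c (pt X)) (Γᵖ≡throughThree X)) (throughThree-on X X X (inj₁ refl)))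

  -- A cube of a linear form has no zero but that of the form. This includes characteristic 3, where
  -- all osculating planes share a line.
  pt-off-Γᵖ : ∀ {X Y} → ¬ X ≡ Y → ¬ dot (Γᵖ X) (pt Y) ≡ 0#
  pt-off-Γᵖ {X} {Y} X≢Y e = throughThree-off X≢Y X≢Y X≢Y (trans (cong (λ c → dot c (pt Y)) (sym (Γᵖ≡throughThree X))) e)

  -- The osculating plane at Y contains pt Y but not pt X, so pairing a relation with it isolates a;
  -- the one at X isolates b.
  points-independent : ∀ {X Y} → ¬ X ≡ Y → Independent (pt X) (pt Y)
  points-independent {X} {Y} X≢Y a b e = a≡0 , b≡0
    where
    pairing : ∀ c → a * dot c (pt X) + b * dot c (pt Y) ≡ 0#
    pairing c = trans (sym (dot-lin a b c (pt X) (pt Y))) (trans (cong (dot c) e) (trans (dot-comm c 𝟎) (dot-𝟎 c)))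
    a≡0 : a ≡ 0#
    a≡0 = *-cancelʳ-0 (throughThree-off (X≢Y ∘ sym) (X≢Y ∘ sym) (X≢Y ∘ sym))
      (+-cancelʳ-0 (trans (cong (b *_) (throughThree-on Y Y Y (inj₁ refl))) (zeroʳ b)) (pairing (throughThree Y Y Y)))
    b≡0 : b ≡ 0#
    b≡0 = *-cancelʳ-0 (throughThree-off X≢Y X≢Y X≢Y)
      (+-cancelʳ-0 (trans (cong (a *_) (throughThree-on X X X (inj₁ refl))) (zeroʳ a))
        (trans (+-comm _ _) (pairing (throughThree X X X))))

  pt-≢𝟎 : ∀ X → ¬ pt X ≡ 𝟎
  pt-≢𝟎 (just t) e = 1≢0 (cong (coord 3) e)
  pt-≢𝟎 nothing  e = 1≢0 (cong (coord 0) e)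

  -- Lines through a point of the cubic.

  lineInPlane≡ : ∀ ℓ c → lineInPlane ℓ c ≡ lineIn (c ∷ []) ℓ
  lineInPlane≡ (r₁ , r₂) c = sym (cong₂ _∧_ (Boolₚ.∧-identityʳ (onPlane r₁ c)) (Boolₚ.∧-identityʳ (onPlane r₂ c)))

  lineIn-∷ : ∀ ℓ c ds → lineIn (c ∷ ds) ℓ ≡ lineInPlane ℓ c ∧ lineIn ds ℓ
  lineIn-∷ (r₁ , r₂) c ds = interchange (onPlane r₁ c) (vanish ds r₁) (onPlane r₂ c) (vanish ds r₂)
    where
    interchange : ∀ a b c d → (a ∧ b) ∧ (c ∧ d) ≡ (a ∧ c) ∧ (b ∧ d)
    interchange true  true  c     d = refl
    interchange true  false true  d = refl
    interchange true  false false d = refl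
    interchange false b     c     d = refl

  lineInPlane-elim : ∀ {ℓ c v} → lineInPlane ℓ c ≡ true → onLine v ℓ ≡ true → dot c v ≡ 0#
  lineInPlane-elim {ℓ} {c} {v} h v∈ = ==-elim (proj₁ (∧-elim (onPlane v c)
    (lineIn-elim (c ∷ []) {ℓ} {v} (trans (sym (lineInPlane≡ ℓ c)) h) v∈)))

  lineInPlane-intro : ∀ {ℓ c u v} → Independent u v → onLine u ℓ ≡ true → onLine v ℓ ≡ true →
    dot c u ≡ 0# → dot c v ≡ 0# → lineInPlane ℓ c ≡ true
  lineInPlane-intro {ℓ} {c} {u} {v} ind u∈ v∈ hu hv = trans (lineInPlane≡ ℓ c)
    (lineIn-intro (c ∷ []) {ℓ} {u} {v} ind u∈ v∈ (∧-intro (==-intro hu) refl) (∧-intro (==-intro hv) refl))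

  -- Every osculating plane other than the one at X misses pt X, so only Γ_X can contain a line
  -- through that point.
  inSomeΓPlane≡ : ∀ {ℓ X} → onLine (pt X) ℓ ≡ true → inSomeΓPlane ℓ ≡ lineInPlane ℓ (Γᵖ X)
  inSomeΓPlane≡ {ℓ} {X} X∈ = bool-ext to (from X)
    where
    own : ∀ Y → lineInPlane ℓ (Γᵖ Y) ≡ true → lineInPlane ℓ (Γᵖ X) ≡ true
    own Y h with Y ≟ₚ X
    ... | yes refl = h
    ... | no Y≢X   = ⊥-elim (pt-off-Γᵖ Y≢X (lineInPlane-elim {ℓ} {Γᵖ Y} {pt X} h X∈))
    to : inSomeΓPlane ℓ ≡ true → lineInPlane ℓ (Γᵖ X) ≡ true
    to h with ∨-elim (any (λ t → lineInPlane ℓ (Γ t)) elements) h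
    ... | inj₂ e = own nothing e
    ... | inj₁ e = let t , _ , h′ = any-elim (λ t → lineInPlane ℓ (Γ t)) elements e in own (just t) h′
    from : ∀ X → lineInPlane ℓ (Γᵖ X) ≡ true → inSomeΓPlane ℓ ≡ true
    from (just t) h = trans (cong (_∨ lineInPlane ℓ Γ∞) (any-intro (λ t → lineInPlane ℓ (Γ t)) (complete t) h)) refl
    from nothing  h = ∨-introʳ (any (λ t → lineInPlane ℓ (Γ t)) elements) h

  otherPoints : Parameter → Line → ℕ
  otherPoints X ℓ = sumOver (λ Y → ι (X ≉ Y) ℕ.* ι (onLine (pt Y) ℓ)) parameters

  -- `throughThree X Y Y` contains pt X and pt Y, hence the line, but misses pt Z; the second Y
  -- merely fills the third slot.
  no-three-collinear : ∀ {ℓ X Y Z} → ¬ X ≡ Y → ¬ X ≡ Z → ¬ Y ≡ Z →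
    onLine (pt X) ℓ ≡ true → onLine (pt Y) ℓ ≡ true → ¬ onLine (pt Z) ℓ ≡ true
  no-three-collinear {ℓ} {X} {Y} {Z} X≢Y X≢Z Y≢Z X∈ Y∈ Z∈ =
    throughThree-off {X} {Y} {Y} X≢Z Y≢Z Y≢Z (lineInPlane-elim {ℓ} {throughThree X Y Y} {pt Z}
      (lineInPlane-intro {ℓ} {throughThree X Y Y} {pt X} {pt Y} (points-independent X≢Y) X∈ Y∈
        (throughThree-on X Y Y (inj₁ refl)) (throughThree-on X Y Y (inj₂ (inj₁ refl)))) Z∈)

  -- A line meets the cubic in at most two points, so otherPoints X ℓ is the indicator of a chord.
  trichotomy : ∀ {ℓ X} → onLine (pt X) ℓ ≡ true →
    ι (lineInPlane ℓ (Γᵖ X)) ℕ.+ otherPoints X ℓ ℕ.+ ι (isUnΓLine ℓ) ≡ 1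
  trichotomy {ℓ} {X} X∈ = cases (ℙ.decide parameters-enumerate (λ Y → (X ≉ Y) ∧ onLine (pt Y) ℓ))
    where
    E = otherPoints X ℓ
    E≡ : E ≡ sumOver (λ Y → ι ((X ≉ Y) ∧ onLine (pt Y) ℓ)) parameters
    E≡ = sum-cong (λ Y → sym (ι-∧ (X ≉ Y) (onLine (pt Y) ℓ))) parameters
    number : countC (λ v → onLine v ℓ) ≡ suc E
    number = begin
      countC (λ v → onLine v ℓ)                        ≡⟨ countC≡sum (λ v → onLine v ℓ) ⟩
      sumOver (λ Y → ι (onLine (pt Y) ℓ)) parameters   ≡⟨ sym (ℙ.sum-others parameters-enumerate (λ Y → ι (onLine (pt Y) ℓ)) X) ⟩
      E ℕ.+ ι (onLine (pt X) ℓ)                        ≡⟨ cong (λ b → E ℕ.+ ι b) X∈ ⟩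
      E ℕ.+ 1                                          ≡⟨ ℕₚ.+-comm E 1 ⟩
      suc E                                            ∎
    unΓ : isUnΓLine ℓ ≡ isYes (suc E ℕ.≟ 1) ∧ not (lineInPlane ℓ (Γᵖ X))
    unΓ = cong₂ (λ n b → isYes (n ℕ.≟ 1) ∧ not b) number (inSomeΓPlane≡ {ℓ} {X} X∈)
    total : ∀ n → E ≡ n → ι (lineInPlane ℓ (Γᵖ X)) ℕ.+ n ℕ.+ ι (isYes (suc n ℕ.≟ 1) ∧ not (lineInPlane ℓ (Γᵖ X))) ≡ 1 →
      ι (lineInPlane ℓ (Γᵖ X)) ℕ.+ E ℕ.+ ι (isUnΓLine ℓ) ≡ 1
    total n e h = trans (cong₂ (λ m b → ι (lineInPlane ℓ (Γᵖ X)) ℕ.+ m ℕ.+ ι b) e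
                          (trans unΓ (cong (λ m → isYes (suc m ℕ.≟ 1) ∧ not (lineInPlane ℓ (Γᵖ X))) e))) h
    cases : (∃ λ Y → (X ≉ Y) ∧ onLine (pt Y) ℓ ≡ true) ⊎ (∀ Y → (X ≉ Y) ∧ onLine (pt Y) ℓ ≡ false) →
      ι (lineInPlane ℓ (Γᵖ X)) ℕ.+ E ℕ.+ ι (isUnΓLine ℓ) ≡ 1
    cases (inj₂ none) = total 0 (trans E≡ (ℙ.sum≡0 parameters-enumerate _ none))
      (trans (cong (ℕ._+ ι (not b)) (ℕₚ.+-identityʳ (ι b))) (ι-not b))
      where b = lineInPlane ℓ (Γᵖ X)
    -- A second point Y makes ℓ a chord. It is the only further point, and it keeps ℓ out of Γ_X, so
    -- just the middle term survives.
    cases (inj₁ (Y , h)) = total 1 (trans E≡ (ℙ.sum≡1 parameters-enumerate _ Y h only))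
      (cong (λ b → ι b ℕ.+ 1 ℕ.+ 0) (≢true⇒≡false outside))
      where
      X≢Y = not-isYes-elim (X ≟ₚ Y) (proj₁ (∧-elim (X ≉ Y) h))
      Y∈ = proj₂ (∧-elim (X ≉ Y) h)
      outside : ¬ lineInPlane ℓ (Γᵖ X) ≡ true
      outside g = pt-off-Γᵖ X≢Y (lineInPlane-elim {ℓ} {Γᵖ X} {pt Y} g Y∈)
      only : ∀ Z → (X ≉ Z) ∧ onLine (pt Z) ℓ ≡ true → Y ≡ Z
      only Z h′ with Y ≟ₚ Z
      ... | yes e  = e
      ... | no Y≢Z = ⊥-elim (no-three-collinear {ℓ} X≢Y (not-isYes-elim (X ≟ₚ Z) (proj₁ (∧-elim (X ≉ Z) h′))) Y≢Z X∈ Y∈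
                               (proj₂ (∧-elim (X ≉ Z) h′)))

  unΓThrough : Parameter → Plane → ℕ
  unΓThrough X c = sumOver (λ ℓ → ι (onLine (pt X) ℓ) ℕ.* ι (lineInPlane ℓ c) ℕ.* ι (isUnΓLine ℓ)) lines

  otherPointsOn : Parameter → Plane → ℕ
  otherPointsOn X c = sumOver (λ Y → ι (X ≉ Y) ℕ.* ι (onPlane (pt Y) c)) parameters

  -- The trichotomy summed over the lines through pt X in c. The vector c may be zero, and then the
  -- count runs over all lines of space through pt X.
  unΓThrough-count : ∀ {X c} → onPlane (pt X) c ≡ true →
    linesThrough (pt X) (c ∷ Γᵖ X ∷ []) ℕ.+ otherPointsOn X c ℕ.+ unΓThrough X c ≡ linesThrough (pt X) (c ∷ [])
  unΓThrough-count {X} {c} X∈c = sym (begin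
    sumOver (λ ℓ → ι (onLine (pt X) ℓ) ℕ.* ι (lineIn (c ∷ []) ℓ)) lines
      ≡⟨ sum-cong split lines ⟩
    sumOver (λ ℓ → α ℓ ℕ.+ β ℓ ℕ.+ γ ℓ) lines
      ≡⟨ trans (sum-+ (λ ℓ → α ℓ ℕ.+ β ℓ) γ lines) (cong (ℕ._+ sumOver γ lines) (sum-+ α β lines)) ⟩
    linesThrough (pt X) (c ∷ Γᵖ X ∷ []) ℕ.+ sumOver β lines ℕ.+ unΓThrough X c
      ≡⟨ cong (λ n → linesThrough (pt X) (c ∷ Γᵖ X ∷ []) ℕ.+ n ℕ.+ unΓThrough X c) chords ⟩
    linesThrough (pt X) (c ∷ Γᵖ X ∷ []) ℕ.+ otherPointsOn X c ℕ.+ unΓThrough X c ∎)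
    where
    α β γ : Line → ℕ
    α ℓ = ι (onLine (pt X) ℓ) ℕ.* ι (lineIn (c ∷ Γᵖ X ∷ []) ℓ)
    β ℓ = ι (onLine (pt X) ℓ) ℕ.* ι (lineInPlane ℓ c) ℕ.* otherPoints X ℓ
    γ ℓ = ι (onLine (pt X) ℓ) ℕ.* ι (lineInPlane ℓ c) ℕ.* ι (isUnΓLine ℓ)
    expand : ∀ a b x y z → (a ≡ true → x ℕ.+ y ℕ.+ z ≡ 1) →
      ι a ℕ.* ι b ≡ ι a ℕ.* (ι b ℕ.* x) ℕ.+ ι a ℕ.* ι b ℕ.* y ℕ.+ ι a ℕ.* ι b ℕ.* z
    expand false b x y z h = refl
    expand true  b x y z h = trans (lemma₁ (ι b)) (trans (cong (ι b ℕ.*_) (sym (h refl))) (lemma₂ (ι b) x y z))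
      where
      lemma₁ : ∀ b → 1 ℕ.* b ≡ b ℕ.* 1
      lemma₁ = solve-∀
      lemma₂ : ∀ b x y z → b ℕ.* (x ℕ.+ y ℕ.+ z) ≡ 1 ℕ.* (b ℕ.* x) ℕ.+ 1 ℕ.* b ℕ.* y ℕ.+ 1 ℕ.* b ℕ.* z
      lemma₂ = solve-∀
    split : ∀ ℓ → ι (onLine (pt X) ℓ) ℕ.* ι (lineIn (c ∷ []) ℓ) ≡ α ℓ ℕ.+ β ℓ ℕ.+ γ ℓ
    split ℓ = begin
      ι (onLine (pt X) ℓ) ℕ.* ι (lineIn (c ∷ []) ℓ)
        ≡⟨ cong (λ b → ι (onLine (pt X) ℓ) ℕ.* ι b) (sym (lineInPlane≡ ℓ c)) ⟩
      ι (onLine (pt X) ℓ) ℕ.* ι (lineInPlane ℓ c)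
        ≡⟨ expand (onLine (pt X) ℓ) (lineInPlane ℓ c) (ι (lineInPlane ℓ (Γᵖ X))) (otherPoints X ℓ) (ι (isUnΓLine ℓ)) (trichotomy {ℓ} {X}) ⟩
      ι (onLine (pt X) ℓ) ℕ.* (ι (lineInPlane ℓ c) ℕ.* ι (lineInPlane ℓ (Γᵖ X))) ℕ.+ β ℓ ℕ.+ γ ℓ
        ≡⟨ cong (λ n → ι (onLine (pt X) ℓ) ℕ.* n ℕ.+ β ℓ ℕ.+ γ ℓ) (trans (sym (ι-∧ (lineInPlane ℓ c) _))
             (cong ι (trans (cong (lineInPlane ℓ c ∧_) (lineInPlane≡ ℓ (Γᵖ X))) (sym (lineIn-∷ ℓ c (Γᵖ X ∷ [])))))) ⟩
      α ℓ ℕ.+ β ℓ ℕ.+ γ ℓ ∎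
    -- As X lies on c, the chord XY lies in c exactly when Y does; after exchanging the sums there
    -- is one chord for each such Y.
    chords : sumOver β lines ≡ otherPointsOn X c
    chords = begin
      sumOver β lines
        ≡⟨ sum-cong (λ ℓ → sym (sum-*ˡ (ι (onLine (pt X) ℓ) ℕ.* ι (lineInPlane ℓ c)) _ parameters)) lines ⟩
      sumOver (λ ℓ → sumOver (λ Y → ι (onLine (pt X) ℓ) ℕ.* ι (lineInPlane ℓ c) ℕ.* (ι (X ≉ Y) ℕ.* ι (onLine (pt Y) ℓ))) parameters) lines
        ≡⟨ sum-swap _ lines parameters ⟩
      sumOver (λ Y → sumOver (λ ℓ → ι (onLine (pt X) ℓ) ℕ.* ι (lineInPlane ℓ c) ℕ.* (ι (X ≉ Y) ℕ.* ι (onLine (pt Y) ℓ))) lines) parameters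
        ≡⟨ sum-cong chord parameters ⟩
      otherPointsOn X c ∎
      where
      contained : ∀ a b d n f → (a ≡ true → b ≡ true → n ≡ true → d ≡ f) →
        ι a ℕ.* ι d ℕ.* (ι n ℕ.* ι b) ≡ ι n ℕ.* ι f ℕ.* (ι a ℕ.* ι b)
      contained true  true  d true  f h rewrite h refl refl refl = refl
      contained true  true  d false f h = ℕₚ.*-zeroʳ (1 ℕ.* ι d)
      contained true  false d n     f h = trans (cong (1 ℕ.* ι d ℕ.*_) (ℕₚ.*-zeroʳ (ι n)))
        (trans (ℕₚ.*-zeroʳ (1 ℕ.* ι d)) (sym (ℕₚ.*-zeroʳ (ι n ℕ.* ι f))))
      contained false b     d n     f h = sym (ℕₚ.*-zeroʳ (ι n ℕ.* ι f))
      chord : ∀ Y → sumOver (λ ℓ → ι (onLine (pt X) ℓ) ℕ.* ι (lineInPlane ℓ c) ℕ.* (ι (X ≉ Y) ℕ.* ι (onLine (pt Y) ℓ))) lines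
        ≡ ι (X ≉ Y) ℕ.* ι (onPlane (pt Y) c)
      chord Y = begin
        sumOver (λ ℓ → ι (onLine (pt X) ℓ) ℕ.* ι (lineInPlane ℓ c) ℕ.* (ι (X ≉ Y) ℕ.* ι (onLine (pt Y) ℓ))) lines
          ≡⟨ sum-cong (λ ℓ → contained (onLine (pt X) ℓ) (onLine (pt Y) ℓ) (lineInPlane ℓ c) (X ≉ Y) (onPlane (pt Y) c) (λ X∈ Y∈ n →
               bool-ext (λ h → ==-intro (lineInPlane-elim {ℓ} {c} {pt Y} h Y∈))
                        (λ h → lineInPlane-intro {ℓ} {c} {pt X} {pt Y} (points-independent (not-isYes-elim (X ≟ₚ Y) n)) X∈ Y∈
                                 (==-elim X∈c) (==-elim h)))) lines ⟩
        sumOver (λ ℓ → ι (X ≉ Y) ℕ.* ι (onPlane (pt Y) c) ℕ.* (ι (onLine (pt X) ℓ) ℕ.* ι (onLine (pt Y) ℓ))) lines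
          ≡⟨ sum-*ˡ (ι (X ≉ Y) ℕ.* ι (onPlane (pt Y) c)) _ lines ⟩
        ι (X ≉ Y) ℕ.* ι (onPlane (pt Y) c) ℕ.* n
          ≡⟨ one-chord (X ≉ Y) (λ h → line-through (points-independent (not-isYes-elim (X ≟ₚ Y) h))) ⟩
        ι (X ≉ Y) ℕ.* ι (onPlane (pt Y) c) ∎
        where
        n = sumOver (λ ℓ → ι (onLine (pt X) ℓ) ℕ.* ι (onLine (pt Y) ℓ)) lines
        one-chord : ∀ b {m k} → (b ≡ true → k ≡ 1) → ι b ℕ.* m ℕ.* k ≡ ι b ℕ.* m
        one-chord true  {m} h = trans (cong (1 ℕ.* m ℕ.*_) (h refl)) (ℕₚ.*-identityʳ (1 ℕ.* m))
        one-chord false h = refl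

  -- A UnΓ-line has exactly one point of the cubic. Inserting that 1 as a sum over points
  -- distributes the lines of c among their points.
  ΛUnΓ≡sum : ∀ c → ΛUnΓ c ≡ sumOver (λ X → ι (onPlane (pt X) c) ℕ.* unΓThrough X c) parameters
  ΛUnΓ≡sum c = begin
    ΛUnΓ c
      ≡⟨ count≡sum (λ ℓ → lineInPlane ℓ c) unΓLines ⟩
    sumOver (λ ℓ → ι (lineInPlane ℓ c)) unΓLines
      ≡⟨ sum-filter _ isUnΓLine lines ⟩
    sumOver (λ ℓ → ι (isUnΓLine ℓ) ℕ.* ι (lineInPlane ℓ c)) lines
      ≡⟨ sum-cong (λ ℓ → trans (one-point ℓ) (sym (sum-*ˡ (ι (isUnΓLine ℓ) ℕ.* ι (lineInPlane ℓ c)) _ parameters))) lines ⟩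
    sumOver (λ ℓ → sumOver (λ X → ι (isUnΓLine ℓ) ℕ.* ι (lineInPlane ℓ c) ℕ.* ι (onLine (pt X) ℓ)) parameters) lines
      ≡⟨ sum-swap _ lines parameters ⟩
    sumOver (λ X → sumOver (λ ℓ → ι (isUnΓLine ℓ) ℕ.* ι (lineInPlane ℓ c) ℕ.* ι (onLine (pt X) ℓ)) lines) parameters
      ≡⟨ sum-cong (λ X → trans (sum-cong (λ ℓ → on-plane (onLine (pt X) ℓ) (lineInPlane ℓ c) (onPlane (pt X) c) (ι (isUnΓLine ℓ))
             (λ X∈ h → ==-intro (lineInPlane-elim {ℓ} {c} {pt X} h X∈))) lines) (sum-*ˡ (ι (onPlane (pt X) c)) _ lines)) parameters ⟩
    sumOver (λ X → ι (onPlane (pt X) c) ℕ.* unΓThrough X c) parameters ∎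
    where
    on-plane : ∀ a b d n → (a ≡ true → b ≡ true → d ≡ true) → n ℕ.* ι b ℕ.* ι a ≡ ι d ℕ.* (ι a ℕ.* ι b ℕ.* n)
    on-plane true true d n h rewrite h refl refl = lemma n
      where
      lemma : ∀ n → n ℕ.* 1 ℕ.* 1 ≡ 1 ℕ.* (1 ℕ.* 1 ℕ.* n)
      lemma = solve-∀
    on-plane true false d n h = trans (cong (ℕ._* 1) (ℕₚ.*-zeroʳ n)) (sym (ℕₚ.*-zeroʳ (ι d)))
    on-plane false b d n h = trans (ℕₚ.*-zeroʳ (n ℕ.* ι b)) (sym (ℕₚ.*-zeroʳ (ι d)))
    weighted : ∀ b {m k} → (b ≡ true → k ≡ 1) → ι b ℕ.* m ≡ ι b ℕ.* m ℕ.* k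
    weighted true  {m} h = sym (trans (cong (1 ℕ.* m ℕ.*_) (h refl)) (ℕₚ.*-identityʳ (1 ℕ.* m)))
    weighted false h = refl
    one-point : ∀ ℓ → ι (isUnΓLine ℓ) ℕ.* ι (lineInPlane ℓ c)
      ≡ ι (isUnΓLine ℓ) ℕ.* ι (lineInPlane ℓ c) ℕ.* sumOver (λ X → ι (onLine (pt X) ℓ)) parameters
    one-point ℓ = weighted (isUnΓLine ℓ) (λ h → trans (sym (countC≡sum (λ v → onLine v ℓ)))
      (isYes-elim (countC (λ v → onLine v ℓ) ℕ.≟ 1) (proj₁ (∧-elim (isYes (countC (λ v → onLine v ℓ) ℕ.≟ 1)) h))))

-- Planes as normalised vectors, and counting planes through given points.

module PlaneCounting (𝔽 : FiniteField) where
  open FiniteField 𝔽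
  open PG3 𝔽
  open FieldProperties 𝔽
  open VectorSpace 𝔽
  open LineGeometry 𝔽
  open LineCounting 𝔽
  open TwistedCubic 𝔽
  open ≡-Reasoning

  normalised-0∷ : ∀ {n x} (v : Vec Carrier n) → x ≡ 0# → normalised (x ∷ v) ≡ normalised v
  normalised-0∷ {x = x} v h = cong (λ b → if b then normalised v else x == 1#) (==-intro h)

  normalised-≢0∷ : ∀ {n x} (v : Vec Carrier n) → ¬ x ≡ 0# → normalised (x ∷ v) ≡ (x == 1#)
  normalised-≢0∷ {x = x} v h = cong (λ b → if b then normalised v else x == 1#) (==-false h)

  normalised-𝟎 : ∀ n → normalised (𝟎 {n}) ≡ false
  normalised-𝟎 zero    = refl
  normalised-𝟎 (suc n) = trans (normalised-0∷ (𝟎 {n}) refl) (normalised-𝟎 n)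

  normalised⇒≢𝟎 : ∀ {n} {v : Vec Carrier n} → normalised v ≡ true → ¬ v ≡ 𝟎
  normalised⇒≢𝟎 {n} h refl = false≢true (normalised-𝟎 n) h

  scale-1 : ∀ {n} (v : Vec Carrier n) → Vec.map (1# *_) v ≡ v
  scale-1 []      = refl
  scale-1 (x ∷ v) = cong₂ _∷_ (*-identityˡ x) (scale-1 v)

  -- Both vectors have leading coordinate 1, in the same place, which forces the scalar to be 1.
  normalised-multiple : ∀ {n} (v : Vec Carrier n) {a} → ¬ a ≡ 0# →
    normalised v ≡ true → normalised (Vec.map (a *_) v) ≡ true → Vec.map (a *_) v ≡ v
  normalised-multiple (x ∷ v) {a} a≢0 h h′ with x ≟ 0#
  ... | yes refl = cong₂ _∷_ (zeroʳ a) (normalised-multiple v a≢0 h (trans (sym (normalised-0∷ (Vec.map (a *_) v) (zeroʳ a))) h′))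
  ... | no x≢0 = subst (λ a → Vec.map (a *_) (x ∷ v) ≡ x ∷ v) (sym a≡1) (scale-1 (x ∷ v))
    where
    a≡1 : a ≡ 1#
    a≡1 = begin
      a        ≡⟨ sym (*-identityʳ a) ⟩
      a * 1#   ≡⟨ cong (a *_) (sym (==-elim h)) ⟩
      a * x    ≡⟨ ==-elim (trans (sym (normalised-≢0∷ (Vec.map (a *_) v) (*-≢0 a≢0 x≢0))) h′) ⟩
      1#       ∎

  -- If c vanished on the whole plane d, then c would be proportional to d.
  separating-vector : ∀ {c d : Plane} → normalised c ≡ true → normalised d ≡ true → ¬ c ≡ d →
    ∃ λ v → onPlane v d ≡ true × ¬ dot c v ≡ 0#
  separating-vector {c} {d} hc hd c≢d
    with 𝕍.decide 4 (vectors-enumerate 4) (λ v → onPlane v d ∧ not (onPlane v c))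
  ... | inj₁ (v , h) = v , proj₁ (∧-elim (onPlane v d) h) , not-isYes-elim (dot c v ≟ 0#) (proj₂ (∧-elim (onPlane v d) h))
  ... | inj₂ none = ⊥-elim (c≢d (trans c≡λd (normalised-multiple d λ≢0 hd (trans (cong normalised (sym c≡λd)) hc))))
    where
    open Solver
    contained : ∀ v → dot d v ≡ 0# → dot c v ≡ 0#
    contained v h with dot c v ≟ 0#
    ... | yes e = e
    ... | no ne = ⊥-elim (false≢true (none v) (∧-intro (==-intro h) (not-isYes-intro (dot c v ≟ 0#) ne)))
    e = proj₁ (dual d (normalised⇒≢𝟎 hd))
    de≢0 = proj₂ (dual d (normalised⇒≢𝟎 hd))
    μ = inv (dot d e) de≢0
    λ′ = dot c e * μ
    -- The vector w - μ (d·w) e lies on the plane d, so c vanishes on it as well; expanding gives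
    -- the proportionality.
    relation : ∀ w → dot c w ≡ λ′ * dot d w
    relation w = x-y≡0⇒x≡y (begin
      dot c w + - (λ′ * dot d w)
        ≡⟨ solve 4 (λ x y z μ → x :- (y :* μ) :* z := con (1 , 0) :* x :+ (:- (μ :* z)) :* y) refl (dot c w) (dot c e) (dot d w) μ ⟩
      1# * dot c w + - (μ * dot d w) * dot c e
        ≡⟨ sym (dot-lin 1# (- (μ * dot d w)) c w e) ⟩
      dot c (lin 1# (- (μ * dot d w)) w e)
        ≡⟨ contained _ (begin
          dot d (lin 1# (- (μ * dot d w)) w e)         ≡⟨ dot-lin 1# (- (μ * dot d w)) d w e ⟩
          1# * dot d w + - (μ * dot d w) * dot d e     ≡⟨ solve 3 (λ x y μ → con (1 , 0) :* x :+ (:- (μ :* x)) :* y := x :- (μ :* y) :* x) refl (dot d w) (dot d e) μ ⟩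
          dot d w + - (μ * dot d e * dot d w)          ≡⟨ cong (λ z → dot d w + - (z * dot d w)) (inv-inverseˡ (dot d e) de≢0) ⟩
          dot d w + - (1# * dot d w)                   ≡⟨ solve 1 (λ x → x :- con (1 , 0) :* x := con (0 , 0)) refl (dot d w) ⟩
          0#                                           ∎) ⟩
      0# ∎)
    difference : V4
    difference = lin 1# (- λ′) c d
    difference-vanishes : ∀ w → dot difference w ≡ 0#
    difference-vanishes w = begin
      dot difference w                      ≡⟨ trans (dot-comm difference w) (dot-lin 1# (- λ′) w c d) ⟩
      1# * dot w c + - λ′ * dot w d         ≡⟨ cong₂ (λ x y → 1# * x + - λ′ * y) (trans (dot-comm w c) (relation w)) (dot-comm w d) ⟩
      1# * (λ′ * dot d w) + - λ′ * dot d w  ≡⟨ solve 2 (λ l x → con (1 , 0) :* (l :* x) :+ (:- l) :* x := con (0 , 0)) refl λ′ (dot d w) ⟩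
      0#                                    ∎
    difference≡𝟎 : difference ≡ 𝟎
    difference≡𝟎 with VecP.≡-dec _≟_ difference 𝟎
    ... | yes h = h
    ... | no h  = let w , nz = dual difference h in ⊥-elim (nz (difference-vanishes w))
    c≡λd : c ≡ scale λ′ d
    c≡λd = coord-ext λ k → trans (x-y≡0⇒x≡y (begin
      coord k c + - (λ′ * coord k d)        ≡⟨ solve 3 (λ x y l → x :- l :* y := con (1 , 0) :* x :+ (:- l) :* y) refl (coord k c) (coord k d) λ′ ⟩
      1# * coord k c + - λ′ * coord k d     ≡⟨ sym (coord-lin k 1# (- λ′) c d) ⟩
      coord k difference                    ≡⟨ trans (cong (coord k) difference≡𝟎) (coord-𝟎 4 k) ⟩
      0#                                    ∎)) (sym (coord-scale k λ′ d))
    λ≢0 : ¬ λ′ ≡ 0#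
    λ≢0 h = normalised⇒≢𝟎 hc (trans c≡λd (coord-ext λ k → trans (coord-scale k λ′ d)
      (trans (cong (_* coord k d) h) (trans (zeroˡ _) (sym (coord-𝟎 4 k))))))

  sum-planes-cong : ∀ {f g} → (∀ c → normalised c ≡ true → f c ≡ g c) → sumOver f planes ≡ sumOver g planes
  sum-planes-cong {f} {g} h = trans (sum-filter f normalised (vectors 4))
    (trans (sum-cong (λ c → ι-cong* (normalised c) (h c)) (vectors 4)) (sym (sum-filter g normalised (vectors 4))))

  private
    nonzero : Carrier → Bool
    nonzero a = 0# 𝔼.≉ a

    nonzero-elim : ∀ {a} → nonzero a ≡ true → ¬ a ≡ 0#
    nonzero-elim {a} h e = not-isYes-elim (0# ≟ a) h (sym e)

    nonzero-intro : ∀ {a} → ¬ a ≡ 0# → nonzero a ≡ true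
    nonzero-intro {a} h = not-isYes-intro (0# ≟ a) (h ∘ sym)

    -- The only scalar that normalises a nonzero vector is the inverse of its leading coordinate;
    -- the zero vector has none.
    normalising-scalar : ∀ {n} (v : Vec Carrier n) →
      sumOver (λ a → ι (nonzero a) ℕ.* ι (normalised (Vec.map (a *_) v))) elements ≡ ι (not (𝟎 ==v v))
    normalising-scalar []      = sum-0 (λ a → ℕₚ.*-zeroʳ (ι (nonzero a))) elements
    normalising-scalar (x ∷ v) with x ≟ 0#
    ... | yes refl = trans (sum-cong (λ a → cong (λ b → ι (nonzero a) ℕ.* ι b) (normalised-0∷ (Vec.map (a *_) v) (zeroʳ a))) elements)
          (trans (normalising-scalar v) (cong (ι ∘ not) (isYes-cong (VecP.≡-dec _≟_ 𝟎 v) (VecP.≡-dec _≟_ 𝟎 (0# ∷ v)) (cong (0# ∷_)) VecP.∷-injectiveʳ)))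
    ... | no x≢0 = trans (trans (sum-cong (λ a → sym (ι-∧ (nonzero a) _)) elements)
            (𝔼.sum≡1 elements-enumerate _ μ (∧-intro (nonzero-intro μ≢0) (trans (normalised-≢0∷ (Vec.map (μ *_) v) (*-≢0 μ≢0 x≢0)) (==-intro (inv-inverseˡ x x≢0)))) only))
            (sym (cong ι (not-isYes-intro (VecP.≡-dec _≟_ 𝟎 (x ∷ v)) (λ e → x≢0 (sym (VecP.∷-injectiveˡ e))))))
      where
      μ = inv x x≢0
      μ≢0 = inv-≢0 x x≢0
      only : ∀ a → nonzero a ∧ normalised (Vec.map (a *_) (x ∷ v)) ≡ true → μ ≡ a
      only a h = begin
        μ              ≡⟨ sym (*-identityˡ μ) ⟩
        1# * μ         ≡⟨ cong (_* μ) (sym ax≡1) ⟩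
        a * x * μ      ≡⟨ *-assoc a x μ ⟩
        a * (x * μ)    ≡⟨ cong (a *_) (inv-inverseʳ x x≢0) ⟩
        a * 1#         ≡⟨ *-identityʳ a ⟩
        a              ∎
        where
        a≢0 = nonzero-elim (proj₁ (∧-elim (nonzero a) h))
        ax≡1 : a * x ≡ 1#
        ax≡1 = ==-elim (trans (sym (normalised-≢0∷ (Vec.map (a *_) v) (*-≢0 a≢0 x≢0))) (proj₂ (∧-elim (nonzero a) h)))

    vanish-scale : ∀ ds {a} c → ¬ a ≡ 0# → vanish ds (scale a c) ≡ vanish ds c
    vanish-scale []       c a≢0 = refl
    vanish-scale (d ∷ ds) {a} c a≢0 = cong₂ _∧_
      (==-cong (λ h → *-cancelˡ-0 a≢0 (trans (sym (dot-scale a d c)) h)) (λ h → trans (dot-scale a d c) (trans (cong (a *_) h) (zeroʳ a))))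
      (vanish-scale ds c a≢0)

    scale-scale : ∀ {n} {a b} → b * a ≡ 1# → (v : Vec Carrier n) → Vec.map (b *_) (Vec.map (a *_) v) ≡ v
    scale-scale e []      = refl
    scale-scale {a = a} {b} e (x ∷ v) = cong₂ _∷_ (trans (sym (*-assoc b a x)) (trans (cong (_* x) e) (*-identityˡ x))) (scale-scale e v)

  planesOn : List V4 → ℕ
  planesOn ds = sumOver (λ c → ι (vanish ds c)) planes

  -- Each plane has one nonzero coefficient vector for every nonzero scalar.
  planesOn-size : ∀ ds k → order ≡ suc k → k ℕ.* planesOn ds ℕ.+ 1 ≡ size (vanish ds)
  planesOn-size ds k q≡ = begin
    k ℕ.* planesOn ds ℕ.+ 1
      ≡⟨ cong (ℕ._+ 1) (begin
        k ℕ.* planesOn ds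
          -- The factor k = q - 1 is turned into a sum over nonzero scalars a, and for each of them
          -- c is replaced by a c, which permutes the vectors and preserves the conditions.
          ≡⟨ cong (ℕ._* planesOn ds) (sym scalars) ⟩
        sumOver (λ a → ι (nonzero a)) elements ℕ.* planesOn ds
          ≡⟨ sym (sum-*ʳ _ (planesOn ds) elements) ⟩
        sumOver (λ a → ι (nonzero a) ℕ.* planesOn ds) elements
          ≡⟨ sum-cong (λ a → trans (ι-cong* (nonzero a) (λ h → scaled (nonzero-elim h))) (sym (sum-*ˡ (ι (nonzero a)) _ (vectors 4)))) elements ⟩
        sumOver (λ a → sumOver (λ c → ι (nonzero a) ℕ.* (ι (normalised (scale a c)) ℕ.* ι (vanish ds c))) (vectors 4)) elements
          ≡⟨ sum-swap _ elements (vectors 4) ⟩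
        sumOver (λ c → sumOver (λ a → ι (nonzero a) ℕ.* (ι (normalised (scale a c)) ℕ.* ι (vanish ds c))) elements) (vectors 4)
          ≡⟨ sum-cong (λ c → trans (sum-cong (λ a → sym (ℕₚ.*-assoc (ι (nonzero a)) _ _)) elements)
               (trans (sum-*ʳ _ (ι (vanish ds c)) elements) (cong (ℕ._* ι (vanish ds c)) (normalising-scalar c)))) (vectors 4) ⟩
        sumOver (λ c → ι (not (𝟎 ==v c)) ℕ.* ι (vanish ds c)) (vectors 4) ∎) ⟩
    sumOver (λ c → ι (not (𝟎 ==v c)) ℕ.* ι (vanish ds c)) (vectors 4) ℕ.+ 1
      ≡⟨ cong (λ b → sumOver (λ c → ι (not (𝟎 ==v c)) ℕ.* ι (vanish ds c)) (vectors 4) ℕ.+ ι b) (sym (vanish-𝟎 ds)) ⟩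
    sumOver (λ c → ι (not (𝟎 ==v c)) ℕ.* ι (vanish ds c)) (vectors 4) ℕ.+ ι (vanish ds 𝟎)
      ≡⟨ 𝕍.sum-others 4 (vectors-enumerate 4) (λ c → ι (vanish ds c)) 𝟎 ⟩
    size (vanish ds) ∎
    where
    vanish-𝟎 : ∀ ds → vanish ds 𝟎 ≡ true
    vanish-𝟎 []       = refl
    vanish-𝟎 (d ∷ ds) = ∧-intro (==-intro (trans (dot-comm d 𝟎) (dot-𝟎 d))) (vanish-𝟎 ds)
    scalars : sumOver (λ a → ι (nonzero a)) elements ≡ k
    scalars = ℕₚ.+-cancelʳ-≡ 1 _ k (begin
      sumOver (λ a → ι (nonzero a)) elements ℕ.+ 1
        ≡⟨ cong (ℕ._+ 1) (sum-cong (λ a → sym (ℕₚ.*-identityʳ (ι (nonzero a)))) elements) ⟩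
      sumOver (λ a → ι (nonzero a) ℕ.* 1) elements ℕ.+ 1
        ≡⟨ 𝔼.sum-others elements-enumerate (λ _ → 1) 0# ⟩
      sumOver (λ _ → 1) elements
        ≡⟨ trans (sym (length≡sum elements)) q≡ ⟩
      suc k
        ≡⟨ ℕₚ.+-comm 1 k ⟩
      k ℕ.+ 1 ∎)
    scaled : ∀ {a} → ¬ a ≡ 0# → planesOn ds ≡ sumOver (λ c → ι (normalised (scale a c)) ℕ.* ι (vanish ds c)) (vectors 4)
    scaled {a} a≢0 = begin
      planesOn ds
        ≡⟨ sum-filter _ normalised (vectors 4) ⟩
      sumOver (λ c → ι (normalised c) ℕ.* ι (vanish ds c)) (vectors 4)
        ≡⟨ sym (𝕍.reindex 4 (vectors-enumerate 4) (scale a) (scale (inv a a≢0))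
                 (scale-scale (inv-inverseˡ a a≢0)) (scale-scale (inv-inverseʳ a a≢0)) _) ⟩
      sumOver (λ c → ι (normalised (scale a c)) ℕ.* ι (vanish ds (scale a c))) (vectors 4)
        ≡⟨ sum-cong (λ c → cong (λ b → ι (normalised (scale a c)) ℕ.* ι b) (vanish-scale ds c a≢0)) (vectors 4) ⟩
      sumOver (λ c → ι (normalised (scale a c)) ℕ.* ι (vanish ds c)) (vectors 4) ∎

-- The dimensions of the conditions imposed by points and planes.

module Counts (𝔽 : FiniteField) (r : ℕ) (q≡ : FiniteField.order 𝔽 ≡ suc (suc r)) where
  open FiniteField 𝔽
  open PG3 𝔽
  open FieldProperties 𝔽
  open VectorSpace 𝔽
  open LineGeometry 𝔽
  open LineCounting 𝔽
  open TwistedCubic 𝔽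
  open PlaneCounting 𝔽
  open ℙ using (_≉_)
  open ≡-Reasoning

  -- k is q - 1. Its form as a successor shows it nonzero, as is needed for cancelling k and the
  -- number q(q - 1) of vectors of a line outside the multiples of one of its points.
  k : ℕ
  k = suc r

  private instance
    order-nonZero : ℕ.NonZero order
    order-nonZero = ℕ.≢-nonZero (λ e → ℕₚ.1+n≢0 (trans (sym q≡) e))

    order*k-nonZero : ℕ.NonZero (order ℕ.* k)
    order*k-nonZero = ℕₚ.m*n≢0 order k

  size-whole : size (vanish []) ≡ order ℕ.^ 4
  size-whole = number-of-vectors 4

  size-cut : ∀ n d ds e → size (vanish ds) ≡ order ℕ.^ suc n → vanish ds e ≡ true → ¬ dot d e ≡ 0# →
    size (vanish (d ∷ ds)) ≡ order ℕ.^ n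
  size-cut n d ds e h e∈ de≢0 = ℕₚ.*-cancelˡ-≡ _ (order ℕ.^ n) order (trans (size-vanish d ds e e∈ de≢0) h)

  size-𝟎∷ : ∀ ds → size (vanish (𝟎 ∷ ds)) ≡ size (vanish ds)
  size-𝟎∷ ds = sum-cong (λ v → cong (λ b → ι (b ∧ vanish ds v)) (==-intro (dot-𝟎 v))) (vectors 4)

  size-plane : ∀ c → ¬ c ≡ 𝟎 → size (vanish (c ∷ [])) ≡ order ℕ.^ 3
  size-plane c c≢𝟎 = let e , nz = dual c c≢𝟎 in size-cut 3 c [] e size-whole refl nz

  onPlane-of : ∀ c v → dot c v ≡ 0# → onPlane c v ≡ true
  onPlane-of c v h = ==-intro (trans (dot-comm v c) h)

  dual-point : ∀ {X Y Z W} → ¬ X ≡ W → ¬ Y ≡ W → ¬ Z ≡ W → ¬ dot (pt W) (throughThree X Y Z) ≡ 0#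
  dual-point {X} {Y} {Z} {W} h₁ h₂ h₃ e =
    throughThree-off h₁ h₂ h₃ (trans (dot-comm (throughThree X Y Z) (pt W)) e)

  size-point : ∀ X → size (vanish (pt X ∷ [])) ≡ order ℕ.^ 3
  size-point X = size-plane (pt X) (pt-≢𝟎 X)

  private
    on : ∀ X Y Z W → X ≡ W ⊎ Y ≡ W ⊎ Z ≡ W → onPlane (throughThree X Y Z) (pt W) ≡ true
    on X Y Z W h = onPlane-of (throughThree X Y Z) (pt W) (throughThree-on X Y Z h)

  -- Each additional point is an independent condition on planes: the witness is a plane through the
  -- earlier points that misses the new one, with repeated parameters in the spare slots. The same
  -- scheme works up to four points.
  size-two-points : ∀ {X Y} → ¬ X ≡ Y → size (vanish (pt X ∷ pt Y ∷ [])) ≡ order ℕ.^ 2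
  size-two-points {X} {Y} X≢Y = size-cut 2 (pt X) (pt Y ∷ []) (throughThree Y Y Y) (size-point Y)
    (∧-intro (on Y Y Y Y (inj₁ refl)) refl) (dual-point (X≢Y ∘ sym) (X≢Y ∘ sym) (X≢Y ∘ sym))

  size-three-points : ∀ {X Y Z} → ¬ X ≡ Y → ¬ X ≡ Z → ¬ Y ≡ Z → size (vanish (pt X ∷ pt Y ∷ pt Z ∷ [])) ≡ order ℕ.^ 1
  size-three-points {X} {Y} {Z} X≢Y X≢Z Y≢Z = size-cut 1 (pt X) (pt Y ∷ pt Z ∷ []) (throughThree Y Z Z) (size-two-points Y≢Z)
    (∧-intro (on Y Z Z Y (inj₁ refl)) (∧-intro (on Y Z Z Z (inj₂ (inj₁ refl))) refl)) (dual-point (X≢Y ∘ sym) (X≢Z ∘ sym) (X≢Z ∘ sym))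

  size-four-points : ∀ {W X Y Z} → ¬ W ≡ X → ¬ W ≡ Y → ¬ W ≡ Z → ¬ X ≡ Y → ¬ X ≡ Z → ¬ Y ≡ Z →
    size (vanish (pt W ∷ pt X ∷ pt Y ∷ pt Z ∷ [])) ≡ 1
  size-four-points {W} {X} {Y} {Z} W≢X W≢Y W≢Z X≢Y X≢Z Y≢Z =
    size-cut 0 (pt W) (pt X ∷ pt Y ∷ pt Z ∷ []) (throughThree X Y Z) (size-three-points X≢Y X≢Z Y≢Z)
      (∧-intro (on X Y Z X (inj₁ refl)) (∧-intro (on X Y Z Y (inj₂ (inj₁ refl))) (∧-intro (on X Y Z Z (inj₂ (inj₂ refl))) refl)))
      (dual-point (W≢X ∘ sym) (W≢Y ∘ sym) (W≢Z ∘ sym))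

  -- The relation N(q² - q) + q = n has at most one solution N, so an expected number of lines only
  -- has to be checked against it.
  linesThrough-unique : ∀ {x ds n} N → ¬ x ≡ 𝟎 → vanish ds x ≡ true → size (vanish ds) ≡ n →
    N ℕ.* (order ℕ.* k) ℕ.+ order ≡ n → linesThrough x ds ≡ N
  linesThrough-unique {x} {ds} {n} N x≢𝟎 x∈ds h N≡ =
    ℕₚ.*-cancelʳ-≡ (linesThrough x ds) N (order ℕ.* k) (ℕₚ.+-cancelʳ-≡ order _ _
      (trans (linesThrough-size ds x≢𝟎 x∈ds (order ℕ.* k) m+q≡q²) (trans h (sym N≡))))
    where
    m+q≡q² : order ℕ.* k ℕ.+ order ≡ order ℕ.* order
    m+q≡q² = trans (ℕₚ.+-comm (order ℕ.* k) order) (trans (sym (ℕₚ.*-suc order k)) (cong (order ℕ.*_) (sym q≡)))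

  -- This identity and the next two check N(q² - q) + q for N = 1, q + 1 and q² + q + 1, the numbers
  -- of lines through a point inside a line, a plane and the whole space.
  q² : 1 ℕ.* (order ℕ.* k) ℕ.+ order ≡ order ℕ.^ 2
  q² = subst (λ q → 1 ℕ.* (q ℕ.* k) ℕ.+ q ≡ q ℕ.^ 2) (sym q≡) (identity k)
    where
    identity : ∀ k → 1 ℕ.* ((1 ℕ.+ k) ℕ.* k) ℕ.+ (1 ℕ.+ k) ≡ (1 ℕ.+ k) ℕ.* ((1 ℕ.+ k) ℕ.* 1)
    identity = solve-∀

  q³ : suc order ℕ.* (order ℕ.* k) ℕ.+ order ≡ order ℕ.^ 3
  q³ = subst (λ q → suc q ℕ.* (q ℕ.* k) ℕ.+ q ≡ q ℕ.^ 3) (sym q≡) (identity k)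
    where
    identity : ∀ k → (1 ℕ.+ (1 ℕ.+ k)) ℕ.* ((1 ℕ.+ k) ℕ.* k) ℕ.+ (1 ℕ.+ k) ≡ (1 ℕ.+ k) ℕ.* ((1 ℕ.+ k) ℕ.* ((1 ℕ.+ k) ℕ.* 1))
    identity = solve-∀

  q⁴ : (order ℕ.* order ℕ.+ suc order) ℕ.* (order ℕ.* k) ℕ.+ order ≡ order ℕ.^ 4
  q⁴ = subst (λ q → (q ℕ.* q ℕ.+ suc q) ℕ.* (q ℕ.* k) ℕ.+ q ≡ q ℕ.^ 4) (sym q≡) (identity k)
    where
    identity : ∀ k → ((1 ℕ.+ k) ℕ.* (1 ℕ.+ k) ℕ.+ (1 ℕ.+ (1 ℕ.+ k))) ℕ.* ((1 ℕ.+ k) ℕ.* k) ℕ.+ (1 ℕ.+ k)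
      ≡ (1 ℕ.+ k) ℕ.* ((1 ℕ.+ k) ℕ.* ((1 ℕ.+ k) ℕ.* ((1 ℕ.+ k) ℕ.* 1)))
    identity = solve-∀

  -- UnΓ-lines in a non-osculating plane.

  pointsOn : Plane → ℕ
  pointsOn c = sumOver (λ X → ι (onPlane (pt X) c)) parameters

  otherPointsOn-suc : ∀ {X c} → onPlane (pt X) c ≡ true → suc (otherPointsOn X c) ≡ pointsOn c
  otherPointsOn-suc {X} {c} X∈ = trans (ℕₚ.+-comm 1 (otherPointsOn X c))
    (trans (cong (λ b → otherPointsOn X c ℕ.+ ι b) (sym X∈)) (ℙ.sum-others parameters-enumerate (λ Y → ι (onPlane (pt Y) c)) X))

  -- A separating vector makes c and Γ_X independent conditions, so they meet in a single line; the
  -- other q lines of the pencil at X in c are chords or UnΓ-lines.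
  unΓThrough-plane : ∀ {X c} → normalised c ≡ true → onPlane (pt X) c ≡ true → ¬ c ≡ Γᵖ X →
    normalised (Γᵖ X) ≡ true → otherPointsOn X c ℕ.+ unΓThrough X c ≡ order
  unΓThrough-plane {X} {c} hc X∈c c≢Γ hΓ = ℕₚ.suc-injective (begin
    suc (otherPointsOn X c ℕ.+ unΓThrough X c)
      ≡⟨ cong (λ n → n ℕ.+ otherPointsOn X c ℕ.+ unΓThrough X c) (sym one) ⟩
    linesThrough (pt X) (c ∷ Γᵖ X ∷ []) ℕ.+ otherPointsOn X c ℕ.+ unΓThrough X c
      ≡⟨ unΓThrough-count {X} {c} X∈c ⟩
    linesThrough (pt X) (c ∷ [])
      ≡⟨ linesThrough-unique {pt X} {c ∷ []} (suc order) (pt-≢𝟎 X) (∧-intro X∈c refl) (size-plane c (normalised⇒≢𝟎 hc)) q³ ⟩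
    suc order ∎)
    where
    separated = separating-vector hc hΓ c≢Γ
    one : linesThrough (pt X) (c ∷ Γᵖ X ∷ []) ≡ 1
    one = linesThrough-unique {pt X} {c ∷ Γᵖ X ∷ []} 1 (pt-≢𝟎 X) (∧-intro X∈c (∧-intro (pt-on-Γᵖ X) refl))
      (size-cut 2 c (Γᵖ X ∷ []) (proj₁ separated) (size-plane (Γᵖ X) (normalised⇒≢𝟎 hΓ))
        (∧-intro (proj₁ (proj₂ separated)) refl) (proj₂ (proj₂ separated))) q²

  normalised-Γᵖ : ∀ X → normalised (Γᵖ X) ≡ true
  normalised-Γᵖ (just t) = trans (normalised-≢0∷ (Vec.tail (Γ t)) 1≢0) (==-intro refl)
  normalised-Γᵖ nothing  = trans (normalised-0∷ (0# ∷ 0# ∷ 1# ∷ []) refl) (trans (normalised-0∷ (0# ∷ 1# ∷ []) refl) (trans (normalised-0∷ (1# ∷ []) refl)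
    (trans (normalised-≢0∷ [] 1≢0) (==-intro refl))))

  pointsOn-Γᵖ : ∀ X → pointsOn (Γᵖ X) ≡ 1
  pointsOn-Γᵖ X = ℙ.sum≡1 parameters-enumerate _ X (pt-on-Γᵖ X) only
    where
    only : ∀ Y → onPlane (pt Y) (Γᵖ X) ≡ true → X ≡ Y
    only Y h with X ≟ₚ Y
    ... | yes e  = e
    ... | no X≢Y = ⊥-elim (pt-off-Γᵖ X≢Y (==-elim h))

  ΛUnΓ-constant : ∀ {c} u → (∀ X → onPlane (pt X) c ≡ true → unΓThrough X c ≡ u) → ΛUnΓ c ≡ pointsOn c ℕ.* u
  ΛUnΓ-constant {c} u h = trans (ΛUnΓ≡sum c)
    (trans (sum-cong (λ X → ι-cong* (onPlane (pt X) c) (h X)) parameters) (sum-*ʳ (λ X → ι (onPlane (pt X) c)) u parameters))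

  -- n counts the points of the plane other than the one whose pencil is considered: n = 2 yields
  -- 3(q - 2) and n = 0 yields q.
  ΛUnΓ-nonosculating : ∀ {c} n → normalised c ≡ true → (∀ X → ¬ c ≡ Γᵖ X) → pointsOn c ≡ suc n →
    ΛUnΓ c ≡ suc n ℕ.* (order ℕ.∸ n)
  ΛUnΓ-nonosculating {c} n hc c≢Γ h = trans (ΛUnΓ-constant {c} (order ℕ.∸ n) through) (cong (ℕ._* (order ℕ.∸ n)) h)
    where
    through : ∀ X → onPlane (pt X) c ≡ true → unΓThrough X c ≡ order ℕ.∸ n
    through X X∈ = begin
      unΓThrough X c                ≡⟨ sym (ℕₚ.m+n∸m≡n n _) ⟩
      n ℕ.+ unΓThrough X c ℕ.∸ n    ≡⟨ cong (λ m → m ℕ.+ unΓThrough X c ℕ.∸ n) (sym (ℕₚ.suc-injective (trans (otherPointsOn-suc {X} {c} X∈) h))) ⟩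
      otherPointsOn X c ℕ.+ unΓThrough X c ℕ.∸ n
                                    ≡⟨ cong (ℕ._∸ n) (unΓThrough-plane {X} {c} hc X∈ (c≢Γ X) (normalised-Γᵖ X)) ⟩
      order ℕ.∸ n                   ∎

  isΓPlane-elim : ∀ c → isΓPlane c ≡ true → ∃ λ X → c ≡ Γᵖ X
  isΓPlane-elim c h with ∨-elim (any (λ t → c ==v Γ t) elements) h
  ... | inj₂ e = nothing , ==v-elim e
  ... | inj₁ e with any-elim (λ t → c ==v Γ t) elements e
  ...   | t , _ , e′ = just t , ==v-elim e′

  isΓPlane-intro : ∀ X → isΓPlane (Γᵖ X) ≡ true
  isΓPlane-intro (just t) = cong (_∨ (Γ t ==v Γ∞)) (any-intro (λ s → Γ t ==v Γ s) (complete t) (==v-intro refl))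
  isΓPlane-intro nothing  = ∨-introʳ (any (λ s → Γ∞ ==v Γ s) elements) (==v-intro refl)

  is3CPlane-elim : ∀ {c} → is3CPlane c ≡ true → pointsOn c ≡ 3
  is3CPlane-elim {c} h = trans (sym (countC≡sum (λ v → onPlane v c))) (isYes-elim (countC (λ v → onPlane v c) ℕ.≟ 3) h)

  is1CbarPlane-elim : ∀ {c} → is1CbarPlane c ≡ true → pointsOn c ≡ 1 × (∀ X → ¬ c ≡ Γᵖ X)
  is1CbarPlane-elim {c} h =
    trans (sym (countC≡sum (λ v → onPlane v c))) (isYes-elim (countC (λ v → onPlane v c) ℕ.≟ 1) (proj₂ (∧-elim (not (isΓPlane c)) h))) ,
    λ { X refl → false≢true (cong not (isΓPlane-intro X)) (proj₁ (∧-elim (not (isΓPlane c)) h)) }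

  -- An osculating plane has only one point of the cubic, so three points rule that case out.
  ΛUnΓ-3C : ∀ c → normalised c ≡ true → is3CPlane c ≡ true → ΛUnΓ c ≡ 3 ℕ.* (order ℕ.∸ 2)
  ΛUnΓ-3C c hc h = ΛUnΓ-nonosculating {c} 2 hc (λ { X refl → 1≢3 (trans (sym (pointsOn-Γᵖ X)) three) }) three
    where
    three = is3CPlane-elim {c} h
    1≢3 : ¬ 1 ≡ 3
    1≢3 ()

  ΛUnΓ-1Cbar : ∀ c → normalised c ≡ true → is1CbarPlane c ≡ true → ΛUnΓ c ≡ order
  ΛUnΓ-1Cbar c hc h = let one , c≢Γ = is1CbarPlane-elim {c} h in
    trans (ΛUnΓ-nonosculating {c} 0 hc c≢Γ one) (ℕₚ.*-identityˡ order)

  -- The total number of UnΓ-lines.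

  pairsOfPoints : ℕ
  pairsOfPoints = suc order ℕ.* order

  -- (q + 1)q(q - 1) plays two parts: it counts the ordered triples of distinct points of the cubic,
  -- and, as q + 1 points with q² - q lines each, the UnΓ-lines.
  triplesOfPoints : ℕ
  triplesOfPoints = suc order ℕ.* (order ℕ.* k)

  onPlane-𝟎 : ∀ v → onPlane v 𝟎 ≡ true
  onPlane-𝟎 v = ==-intro (dot-𝟎 v)

  pointsOn-𝟎 : pointsOn 𝟎 ≡ suc order
  pointsOn-𝟎 = trans (sum-cong (λ X → cong ι (onPlane-𝟎 (pt X))) parameters) (trans (parameters-sum 1) (ℕₚ.*-identityʳ _))

  -- The zero coefficient vector stands for the whole space: every line lies in "the plane" 𝟎.
  number-of-unΓLines : length unΓLines ≡ triplesOfPoints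
  number-of-unΓLines = begin
    length unΓLines
      ≡⟨ length≡sum unΓLines ⟩
    sumOver (λ _ → 1) unΓLines
      ≡⟨ sum-cong (λ ℓ → cong ι (sym (∧-intro (onPlane-𝟎 (proj₁ ℓ)) (onPlane-𝟎 (proj₂ ℓ))))) unΓLines ⟩
    sumOver (λ ℓ → ι (lineInPlane ℓ 𝟎)) unΓLines
      ≡⟨ sym (count≡sum (λ ℓ → lineInPlane ℓ 𝟎) unΓLines) ⟩
    ΛUnΓ 𝟎
      ≡⟨ ΛUnΓ-constant {𝟎} (order ℕ.* k) (λ X _ → through X) ⟩
    pointsOn 𝟎 ℕ.* (order ℕ.* k)
      ≡⟨ cong (ℕ._* (order ℕ.* k)) pointsOn-𝟎 ⟩
    triplesOfPoints ∎
    where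
    through : ∀ X → unΓThrough X 𝟎 ≡ order ℕ.* k
    through X = ℕₚ.+-cancelˡ-≡ (suc order ℕ.+ order) _ _ (begin
      suc order ℕ.+ order ℕ.+ unΓThrough X 𝟎
        ≡⟨ cong₂ (λ m n → m ℕ.+ n ℕ.+ unΓThrough X 𝟎)
             (sym (linesThrough-unique {pt X} {𝟎 ∷ Γᵖ X ∷ []} (suc order) (pt-≢𝟎 X) (∧-intro (onPlane-𝟎 (pt X)) (∧-intro (pt-on-Γᵖ X) refl))
               (trans (size-𝟎∷ (Γᵖ X ∷ [])) (size-plane (Γᵖ X) (normalised⇒≢𝟎 (normalised-Γᵖ X)))) q³))
             (sym (ℕₚ.suc-injective (trans (otherPointsOn-suc {X} {𝟎} (onPlane-𝟎 (pt X))) pointsOn-𝟎))) ⟩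
      linesThrough (pt X) (𝟎 ∷ Γᵖ X ∷ []) ℕ.+ otherPointsOn X 𝟎 ℕ.+ unΓThrough X 𝟎
        ≡⟨ unΓThrough-count {X} {𝟎} (onPlane-𝟎 (pt X)) ⟩
      linesThrough (pt X) (𝟎 ∷ [])
        ≡⟨ linesThrough-unique {pt X} {𝟎 ∷ []} (order ℕ.* order ℕ.+ suc order) (pt-≢𝟎 X) (∧-intro (onPlane-𝟎 (pt X)) refl)
             (trans (size-𝟎∷ []) size-whole) q⁴ ⟩
      order ℕ.* order ℕ.+ suc order
        ≡⟨ subst (λ q → q ℕ.* q ℕ.+ suc q ≡ suc q ℕ.+ q ℕ.+ q ℕ.* k) (sym q≡) (identity k) ⟩
      suc order ℕ.+ order ℕ.+ order ℕ.* k ∎)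
      where
      identity : ∀ k → (1 ℕ.+ k) ℕ.* (1 ℕ.+ k) ℕ.+ (1 ℕ.+ (1 ℕ.+ k)) ≡ 1 ℕ.+ (1 ℕ.+ k) ℕ.+ (1 ℕ.+ k) ℕ.+ (1 ℕ.+ k) ℕ.* k
      identity = solve-∀

  -- Planes through points of the cubic, and the moments of the intersection numbers.

  planesOn-unique : ∀ {ds n} A → size (vanish ds) ≡ n → k ℕ.* A ℕ.+ 1 ≡ n → planesOn ds ≡ A
  planesOn-unique {ds} A h A≡ = ℕₚ.*-cancelˡ-≡ (planesOn ds) A k (ℕₚ.+-cancelʳ-≡ 1 _ _
    (trans (planesOn-size ds k q≡) (trans h (sym A≡))))

  planesOn-point : ∀ X → planesOn (pt X ∷ []) ≡ order ℕ.* order ℕ.+ suc order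
  planesOn-point X = planesOn-unique {pt X ∷ []} _ (size-point X)
    (subst (λ q → k ℕ.* (q ℕ.* q ℕ.+ suc q) ℕ.+ 1 ≡ q ℕ.^ 3) (sym q≡) (identity k))
    where
    identity : ∀ k → k ℕ.* ((1 ℕ.+ k) ℕ.* (1 ℕ.+ k) ℕ.+ (1 ℕ.+ (1 ℕ.+ k))) ℕ.+ 1 ≡ (1 ℕ.+ k) ℕ.* ((1 ℕ.+ k) ℕ.* ((1 ℕ.+ k) ℕ.* 1))
    identity = solve-∀

  planesOn-two : ∀ {X Y} → ¬ X ≡ Y → planesOn (pt X ∷ pt Y ∷ []) ≡ suc order
  planesOn-two {X} {Y} X≢Y = planesOn-unique {pt X ∷ pt Y ∷ []} _ (size-two-points X≢Y)
    (subst (λ q → k ℕ.* suc q ℕ.+ 1 ≡ q ℕ.^ 2) (sym q≡) (identity k))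
    where
    identity : ∀ k → k ℕ.* (1 ℕ.+ (1 ℕ.+ k)) ℕ.+ 1 ≡ (1 ℕ.+ k) ℕ.* ((1 ℕ.+ k) ℕ.* 1)
    identity = solve-∀

  planesOn-three : ∀ {X Y Z} → ¬ X ≡ Y → ¬ X ≡ Z → ¬ Y ≡ Z → planesOn (pt X ∷ pt Y ∷ pt Z ∷ []) ≡ 1
  planesOn-three {X} {Y} {Z} X≢Y X≢Z Y≢Z = planesOn-unique {pt X ∷ pt Y ∷ pt Z ∷ []} 1 (size-three-points X≢Y X≢Z Y≢Z)
    (subst (λ q → k ℕ.* 1 ℕ.+ 1 ≡ q ℕ.^ 1) (sym q≡) (identity k))
    where
    identity : ∀ k → k ℕ.* 1 ℕ.+ 1 ≡ (1 ℕ.+ k) ℕ.* 1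
    identity = solve-∀

  incidences : ∀ (ty : Plane → Bool) Λ → (∀ c → normalised c ≡ true → ty c ≡ true → ΛUnΓ c ≡ Λ) →
    totalIncidences ty ≡ sumOver (λ c → ι (ty c)) planes ℕ.* Λ
  incidences ty Λ h = begin
    sumOver (planesThrough ty) unΓLines
      ≡⟨ sum-cong (λ ℓ → trans (count≡sum (λ c → ty c ∧ lineInPlane ℓ c) planes)
                               (sum-cong (λ c → ι-∧ (ty c) (lineInPlane ℓ c)) planes)) unΓLines ⟩
    sumOver (λ ℓ → sumOver (λ c → ι (ty c) ℕ.* ι (lineInPlane ℓ c)) planes) unΓLines
      ≡⟨ sum-swap _ unΓLines planes ⟩
    sumOver (λ c → sumOver (λ ℓ → ι (ty c) ℕ.* ι (lineInPlane ℓ c)) unΓLines) planes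
      ≡⟨ sum-planes-cong (λ c hc → trans (sum-*ˡ (ι (ty c)) _ unΓLines)
           (ι-cong* (ty c) (λ e → trans (sym (count≡sum (λ ℓ → lineInPlane ℓ c) unΓLines)) (h c hc e)))) ⟩
    sumOver (λ c → ι (ty c) ℕ.* Λ) planes
      ≡⟨ sum-*ʳ _ Λ planes ⟩
    sumOver (λ c → ι (ty c)) planes ℕ.* Λ ∎

  private
    p : Plane → Parameter → Bool
    p c X = onPlane (pt X) c

    pairs triples : (Parameter → Bool) → ℕ
    pairs = ℙ.pairs parameters-enumerate
    triples = ℙ.triples parameters-enumerate

    -- For the constant predicate, `pairs` and `triples` count the ordered pairs and triples of
    -- distinct points, so the moment identities evaluate these numbers too.
    everything : Parameter → Bool
    everything _ = true

    all-parameters : sumOver (λ X → ι (everything X)) parameters ≡ suc order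
    all-parameters = trans (parameters-sum 1) (ℕₚ.*-identityʳ _)

  pairs-everything : pairs everything ≡ pairsOfPoints
  pairs-everything = ℕₚ.+-cancelʳ-≡ (suc order) _ _ (begin
    pairs everything ℕ.+ suc order
      ≡⟨ subst (λ i → pairs everything ℕ.+ i ≡ i ℕ.* i) all-parameters (ℙ.pairs-sum parameters-enumerate everything) ⟩
    suc order ℕ.* suc order
      ≡⟨ trans (ℕₚ.*-suc (suc order) order) (ℕₚ.+-comm (suc order) _) ⟩
    pairsOfPoints ℕ.+ suc order ∎)

  triples-everything : triples everything ≡ triplesOfPoints
  triples-everything = ℕₚ.+-cancelʳ-≡ (2 ℕ.* pairsOfPoints) _ _ (begin
    triples everything ℕ.+ 2 ℕ.* pairsOfPoints
      ≡⟨ subst₂ (λ m i → triples everything ℕ.+ 2 ℕ.* m ≡ m ℕ.* i) pairs-everything all-parameters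
           (ℙ.triples-sum parameters-enumerate everything) ⟩
    pairsOfPoints ℕ.* suc order
      ≡⟨ subst (λ q → suc q ℕ.* q ℕ.* suc q ≡ suc q ℕ.* (q ℕ.* k) ℕ.+ 2 ℕ.* (suc q ℕ.* q)) (sym q≡) (identity k) ⟩
    triplesOfPoints ℕ.+ 2 ℕ.* pairsOfPoints ∎)
    where
    identity : ∀ k → (1 ℕ.+ (1 ℕ.+ k)) ℕ.* (1 ℕ.+ k) ℕ.* (1 ℕ.+ (1 ℕ.+ k))
      ≡ (1 ℕ.+ (1 ℕ.+ k)) ℕ.* ((1 ℕ.+ k) ℕ.* k) ℕ.+ 2 ℕ.* ((1 ℕ.+ (1 ℕ.+ k)) ℕ.* (1 ℕ.+ k))
    identity = solve-∀

  private
    vanish-ι : ∀ c X ds → ι (vanish (pt X ∷ ds) c) ≡ ι (p c X) ℕ.* ι (vanish ds c)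
    vanish-ι c X ds = trans (ι-∧ (onPlane c (pt X)) (vanish ds c)) (cong (λ b → ι b ℕ.* ι (vanish ds c)) (onPlane-comm c (pt X)))

  sum-pointsOn : sumOver pointsOn planes ≡ suc order ℕ.* (order ℕ.* order ℕ.+ suc order)
  sum-pointsOn = begin
    sumOver (λ c → sumOver (λ X → ι (p c X)) parameters) planes
      ≡⟨ sum-swap _ planes parameters ⟩
    sumOver (λ X → sumOver (λ c → ι (p c X)) planes) parameters
      ≡⟨ sum-cong (λ X → trans (sum-cong (λ c → sym (trans (vanish-ι c X []) (ℕₚ.*-identityʳ _))) planes) (planesOn-point X)) parameters ⟩
    sumOver (λ _ → order ℕ.* order ℕ.+ suc order) parameters
      ≡⟨ parameters-sum _ ⟩
    suc order ℕ.* (order ℕ.* order ℕ.+ suc order) ∎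

  -- After exchanging sums, each ordered pair of distinct points contributes the q + 1 planes
  -- through their chord.
  sum-pairs : sumOver (λ c → pairs (p c)) planes ≡ pairsOfPoints ℕ.* suc order
  sum-pairs = begin
    sumOver (λ c → pairs (p c)) planes
      ≡⟨ trans (sum-swap _ planes parameters) (sum-cong (λ X → sum-swap _ planes parameters) parameters) ⟩
    sumOver (λ X → sumOver (λ Y → sumOver (λ c → ι (X ≉ Y) ℕ.* (ι (p c X) ℕ.* ι (p c Y))) planes) parameters) parameters
      ≡⟨ sum-cong (λ X → trans (sum-cong (pair X) parameters) (sum-*ʳ (λ Y → ι (X ≉ Y) ℕ.* 1) (suc order) parameters)) parameters ⟩
    sumOver (λ X → sumOver (λ Y → ι (X ≉ Y) ℕ.* 1) parameters ℕ.* suc order) parameters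
      ≡⟨ sum-*ʳ (λ X → sumOver (λ Y → ι (X ≉ Y) ℕ.* 1) parameters) (suc order) parameters ⟩
    pairs everything ℕ.* suc order
      ≡⟨ cong (ℕ._* suc order) pairs-everything ⟩
    pairsOfPoints ℕ.* suc order ∎
    where
    pair : ∀ X Y → sumOver (λ c → ι (X ≉ Y) ℕ.* (ι (p c X) ℕ.* ι (p c Y))) planes ≡ ι (X ≉ Y) ℕ.* 1 ℕ.* suc order
    pair X Y = begin
      sumOver (λ c → ι (X ≉ Y) ℕ.* (ι (p c X) ℕ.* ι (p c Y))) planes
        ≡⟨ sum-*ˡ (ι (X ≉ Y)) _ planes ⟩
      ι (X ≉ Y) ℕ.* sumOver (λ c → ι (p c X) ℕ.* ι (p c Y)) planes
        ≡⟨ ι-cong* (X ≉ Y) (λ h → trans (sum-cong (λ c → sym (trans (vanish-ι c X (pt Y ∷ []))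
             (cong (ι (p c X) ℕ.*_) (trans (vanish-ι c Y []) (ℕₚ.*-identityʳ _))))) planes) (planesOn-two (not-isYes-elim (X ≟ₚ Y) h))) ⟩
      ι (X ≉ Y) ℕ.* suc order
        ≡⟨ cong (ℕ._* suc order) (sym (ℕₚ.*-identityʳ (ι (X ≉ Y)))) ⟩
      ι (X ≉ Y) ℕ.* 1 ℕ.* suc order ∎

  -- Three distinct points span exactly one plane, so the third moment is the number of ordered
  -- triples.
  sum-triples : sumOver (λ c → triples (p c)) planes ≡ triplesOfPoints
  sum-triples = begin
    sumOver (λ c → triples (p c)) planes
      ≡⟨ trans (sum-swap _ planes parameters) (sum-cong (λ X → trans (sum-swap _ planes parameters)
           (sum-cong (λ Y → sum-swap _ planes parameters) parameters)) parameters) ⟩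
    sumOver (λ X → sumOver (λ Y → sumOver (λ Z → sumOver (λ c →
        (ι (X ≉ Y) ℕ.* ι (X ≉ Z) ℕ.* ι (Y ≉ Z)) ℕ.* (ι (p c X) ℕ.* ι (p c Y) ℕ.* ι (p c Z))) planes) parameters) parameters) parameters
      ≡⟨ sum-cong (λ X → sum-cong (λ Y → sum-cong (triple X Y) parameters) parameters) parameters ⟩
    triples everything
      ≡⟨ triples-everything ⟩
    triplesOfPoints ∎
    where
    weighted : ∀ a b c {m n} → (a ≡ true → b ≡ true → c ≡ true → m ≡ n) → (ι a ℕ.* ι b ℕ.* ι c) ℕ.* m ≡ (ι a ℕ.* ι b ℕ.* ι c) ℕ.* n
    weighted true  true  true  h = cong (1 ℕ.*_) (h refl refl refl)
    weighted true  true  false h = refl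
    weighted true  false c     h = refl
    weighted false b     c     h = refl
    triple : ∀ X Y Z → sumOver (λ c → (ι (X ≉ Y) ℕ.* ι (X ≉ Z) ℕ.* ι (Y ≉ Z)) ℕ.* (ι (p c X) ℕ.* ι (p c Y) ℕ.* ι (p c Z))) planes
      ≡ (ι (X ≉ Y) ℕ.* ι (X ≉ Z) ℕ.* ι (Y ≉ Z)) ℕ.* 1
    triple X Y Z = trans (sum-*ˡ (ι (X ≉ Y) ℕ.* ι (X ≉ Z) ℕ.* ι (Y ≉ Z)) _ planes)
      (weighted (X ≉ Y) (X ≉ Z) (Y ≉ Z) (λ xy xz yz → trans (sum-cong (λ c → sym (begin
          ι (vanish (pt X ∷ pt Y ∷ pt Z ∷ []) c)           ≡⟨ vanish-ι c X (pt Y ∷ pt Z ∷ []) ⟩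
          ι (p c X) ℕ.* ι (vanish (pt Y ∷ pt Z ∷ []) c)    ≡⟨ cong (ι (p c X) ℕ.*_) (vanish-ι c Y (pt Z ∷ [])) ⟩
          ι (p c X) ℕ.* (ι (p c Y) ℕ.* ι (vanish (pt Z ∷ []) c))
                                                           ≡⟨ cong (λ n → ι (p c X) ℕ.* (ι (p c Y) ℕ.* n)) (trans (vanish-ι c Z []) (ℕₚ.*-identityʳ _)) ⟩
          ι (p c X) ℕ.* (ι (p c Y) ℕ.* ι (p c Z))          ≡⟨ sym (ℕₚ.*-assoc (ι (p c X)) _ _) ⟩
          ι (p c X) ℕ.* ι (p c Y) ℕ.* ι (p c Z)            ∎)) planes)
        (planesOn-three (not-isYes-elim (X ≟ₚ Y) xy) (not-isYes-elim (X ≟ₚ Z) xz) (not-isYes-elim (Y ≟ₚ Z) yz))))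

  -- The bound of three points on a plane, and the number of planes of each type.

  private
    remove : Parameter → (Parameter → Bool) → Parameter → Bool
    remove X f Y = (X ≉ Y) ∧ f Y

    abstract
      another : ∀ f {n} → sumOver (λ X → ι (f X)) parameters ≡ suc n →
        ∃ λ X → f X ≡ true × sumOver (λ Y → ι (remove X f Y)) parameters ≡ n
      another f {n} h with ℙ.decide parameters-enumerate f
      ... | inj₂ none = ⊥-elim (ℕₚ.0≢1+n (trans (sym (ℙ.sum≡0 parameters-enumerate f none)) h))
      ... | inj₁ (X , fX) = X , fX , ℕₚ.+-cancelʳ-≡ 1 _ n (begin
        sumOver (λ Y → ι (remove X f Y)) parameters ℕ.+ 1
          ≡⟨ cong₂ ℕ._+_ (sum-cong (λ Y → ι-∧ (X ≉ Y) (f Y)) parameters) (cong ι (sym fX)) ⟩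
        sumOver (λ Y → ι (X ≉ Y) ℕ.* ι (f Y)) parameters ℕ.+ ι (f X)
          ≡⟨ ℙ.sum-others parameters-enumerate (λ Y → ι (f Y)) X ⟩
        sumOver (λ Y → ι (f Y)) parameters
          ≡⟨ trans h (ℕₚ.+-comm 1 n) ⟩
        n ℕ.+ 1 ∎)

    remove-elim : ∀ {X f Y} → remove X f Y ≡ true → ¬ X ≡ Y × f Y ≡ true
    remove-elim {X} {f} {Y} h = not-isYes-elim (X ≟ₚ Y) (proj₁ (∧-elim (X ≉ Y) h)) , proj₂ (∧-elim (X ≉ Y) h)

  -- Four points W, X, Y, Z are extracted one after another. The planes through them form a solution
  -- space of size 1, which contains both c and the zero vector.
  at-most-three : ∀ {c} → ¬ c ≡ 𝟎 → ∀ n → ¬ pointsOn c ≡ 4 ℕ.+ n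
  at-most-three {c} c≢𝟎 n h =
    let W , hW , i₁ = another (p c) h
        X , hX , i₂ = another (remove W (p c)) i₁
        Y , hY , i₃ = another (remove X (remove W (p c))) i₂
        Z , hZ , i₄ = another (remove Y (remove X (remove W (p c)))) i₃
        W≢X , cX = remove-elim {W} {p c} hX
        X≢Y , hY′ = remove-elim {X} {remove W (p c)} hY
        W≢Y , cY = remove-elim {W} {p c} hY′
        Y≢Z , hZ′ = remove-elim {Y} {remove X (remove W (p c))} hZ
        X≢Z , hZ″ = remove-elim {X} {remove W (p c)} hZ′
        W≢Z , cZ = remove-elim {W} {p c} hZ″
    in c≢𝟎 (𝕍.sum≡1⇒unique 4 (vectors-enumerate 4) (vanish (pt W ∷ pt X ∷ pt Y ∷ pt Z ∷ []))
         (size-four-points W≢X W≢Y W≢Z X≢Y X≢Z Y≢Z)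
         (vanishes c W X Y Z (λ V → onPlane-comm c (pt V)) hW cX cY cZ)
         (vanishes 𝟎 W X Y Z (λ V → onPlane-comm 𝟎 (pt V)) (onPlane-𝟎 (pt W)) (onPlane-𝟎 (pt X)) (onPlane-𝟎 (pt Y)) (onPlane-𝟎 (pt Z))))
    where
    vanishes : ∀ c W X Y Z → (∀ V → onPlane c (pt V) ≡ p c V) → p c W ≡ true → p c X ≡ true → p c Y ≡ true → p c Z ≡ true →
      vanish (pt W ∷ pt X ∷ pt Y ∷ pt Z ∷ []) c ≡ true
    vanishes c W X Y Z e hW hX hY hZ = ∧-intro (trans (e W) hW) (∧-intro (trans (e X) hX)
      (∧-intro (trans (e Y) hY) (∧-intro (trans (e Z) hZ) refl)))

  -- For i ≤ 3: 6[i = 3] = i(i−1)(i−2) and 2[i = 1] + 2i(i−1) = 2i + i(i−1)(i−2).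
  small-moments : ∀ i P T → (∀ n → ¬ i ≡ 4 ℕ.+ n) → P ℕ.+ i ≡ i ℕ.* i → T ℕ.+ 2 ℕ.* P ≡ P ℕ.* i →
    6 ℕ.* ι (isYes (i ℕ.≟ 3)) ≡ T × 2 ℕ.* ι (isYes (i ℕ.≟ 1)) ℕ.+ 2 ℕ.* P ≡ 2 ℕ.* i ℕ.+ T
  small-moments 0 P T _ hP hT with ℕₚ.+-cancelʳ-≡ 0 P 0 hP
  ... | refl with ℕₚ.+-cancelʳ-≡ 0 T 0 hT
  ...   | refl = refl , refl
  small-moments 1 P T _ hP hT with ℕₚ.+-cancelʳ-≡ 1 P 0 hP
  ... | refl with ℕₚ.+-cancelʳ-≡ 0 T 0 hT
  ...   | refl = refl , refl
  small-moments 2 P T _ hP hT with ℕₚ.+-cancelʳ-≡ 2 P 2 hP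
  ... | refl with ℕₚ.+-cancelʳ-≡ 4 T 0 hT
  ...   | refl = refl , refl
  small-moments 3 P T _ hP hT with ℕₚ.+-cancelʳ-≡ 3 P 6 hP
  ... | refl with ℕₚ.+-cancelʳ-≡ 12 T 6 hT
  ...   | refl = refl , refl
  small-moments (suc (suc (suc (suc n)))) P T h _ _ = ⊥-elim (h n refl)

  plane-moments : ∀ c → normalised c ≡ true →
    6 ℕ.* ι (isYes (pointsOn c ℕ.≟ 3)) ≡ triples (p c) ×
    2 ℕ.* ι (isYes (pointsOn c ℕ.≟ 1)) ℕ.+ 2 ℕ.* pairs (p c) ≡ 2 ℕ.* pointsOn c ℕ.+ triples (p c)
  plane-moments c hc = small-moments (pointsOn c) (pairs (p c)) (triples (p c)) (at-most-three {c} (normalised⇒≢𝟎 hc))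
    (ℙ.pairs-sum parameters-enumerate (p c)) (ℙ.triples-sum parameters-enumerate (p c))

  number-of-3C : 6 ℕ.* sumOver (λ c → ι (is3CPlane c)) planes ≡ triplesOfPoints
  number-of-3C = begin
    6 ℕ.* sumOver (λ c → ι (is3CPlane c)) planes
      ≡⟨ sym (sum-*ˡ 6 _ planes) ⟩
    sumOver (λ c → 6 ℕ.* ι (is3CPlane c)) planes
      ≡⟨ sum-planes-cong (λ c hc → trans (cong (λ n → 6 ℕ.* ι (isYes (n ℕ.≟ 3))) (countC≡sum (λ v → onPlane v c)))
                                         (proj₁ (plane-moments c hc))) ⟩
    sumOver (λ c → triples (p c)) planes
      ≡⟨ sum-triples ⟩
    triplesOfPoints ∎

  Γᵖ-injective : ∀ {X Y} → Γᵖ X ≡ Γᵖ Y → X ≡ Y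
  Γᵖ-injective {X} {Y} e with X ≟ₚ Y
  ... | yes h  = h
  ... | no X≢Y = ⊥-elim (pt-off-Γᵖ (X≢Y ∘ sym) (trans (cong (λ c → dot c (pt X)) (sym e)) (==-elim (pt-on-Γᵖ X))))

  number-of-Γ : sumOver (λ c → ι (isΓPlane c)) planes ≡ suc order
  number-of-Γ = begin
    sumOver (λ c → ι (isΓPlane c)) planes
      ≡⟨ sum-cong (λ c → representations c) planes ⟩
    sumOver (λ c → sumOver (λ X → ι (Γᵖ X ==v c)) parameters) planes
      ≡⟨ sum-swap _ planes parameters ⟩
    sumOver (λ X → sumOver (λ c → ι (Γᵖ X ==v c)) planes) parameters
      ≡⟨ sum-cong once parameters ⟩
    sumOver (λ _ → 1) parameters
      ≡⟨ all-parameters ⟩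
    suc order ∎
    where
    representations : ∀ c → ι (isΓPlane c) ≡ sumOver (λ X → ι (Γᵖ X ==v c)) parameters
    representations c with isΓPlane c in eq
    ... | false = sym (ℙ.sum≡0 parameters-enumerate _ (λ X → ==v-false (λ { refl → false≢true eq (isΓPlane-intro X) })))
    ... | true = let X , e = isΓPlane-elim c eq in
      sym (ℙ.sum≡1 parameters-enumerate _ X (==v-intro (sym e)) (λ Y h → Γᵖ-injective (trans (sym e) (sym (==v-elim h)))))
    once : ∀ X → sumOver (λ c → ι (Γᵖ X ==v c)) planes ≡ 1
    once X = begin
      sumOver (λ c → ι (Γᵖ X ==v c)) planes
        ≡⟨ sum-filter _ normalised (vectors 4) ⟩
      sumOver (λ c → ι (normalised c) ℕ.* ι (Γᵖ X ==v c)) (vectors 4)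
        ≡⟨ sum-cong (λ c → ℕₚ.*-comm (ι (normalised c)) _) (vectors 4) ⟩
      sumOver (λ c → ι (Γᵖ X ==v c) ℕ.* ι (normalised c)) (vectors 4)
        ≡⟨ 𝕍.pick 4 (vectors-enumerate 4) (λ c → ι (normalised c)) (Γᵖ X) ⟩
      ι (normalised (Γᵖ X))
        ≡⟨ cong ι (normalised-Γᵖ X) ⟩
      1 ∎

  -- In the summed identity 2[i = 1] + 2i(i - 1) = 2i + i(i - 1)(i - 2), the first moment (q + 1)(q²
  -- + q + 1) exceeds the second, (q + 1)q(q + 1), by q + 1. This is the number of osculating planes
  -- among those with one point, so removing them leaves the third moment alone.
  number-of-1Cbar : 2 ℕ.* sumOver (λ c → ι (is1CbarPlane c)) planes ≡ triplesOfPoints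
  number-of-1Cbar = ℕₚ.+-cancelʳ-≡ (2 ℕ.* suc order ℕ.+ 2 ℕ.* (pairsOfPoints ℕ.* suc order)) _ _ (begin
    2 ℕ.* N ℕ.+ (2 ℕ.* suc order ℕ.+ 2 ℕ.* (pairsOfPoints ℕ.* suc order))
      ≡⟨ trans (sym (ℕₚ.+-assoc (2 ℕ.* N) _ _)) (cong (ℕ._+ 2 ℕ.* (pairsOfPoints ℕ.* suc order)) (sym (ℕₚ.*-distribˡ-+ 2 N (suc order)))) ⟩
    2 ℕ.* (N ℕ.+ suc order) ℕ.+ 2 ℕ.* (pairsOfPoints ℕ.* suc order)
      ≡⟨ cong₂ (λ m n → 2 ℕ.* m ℕ.+ 2 ℕ.* n) with-Γ (sym sum-pairs) ⟩
    2 ℕ.* sumOver (λ c → ι (isYes (pointsOn c ℕ.≟ 1))) planes ℕ.+ 2 ℕ.* sumOver (λ c → pairs (p c)) planes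
      ≡⟨ sym (trans (sum-+ _ _ planes) (cong₂ ℕ._+_ (sum-*ˡ 2 _ planes) (sum-*ˡ 2 _ planes))) ⟩
    sumOver (λ c → 2 ℕ.* ι (isYes (pointsOn c ℕ.≟ 1)) ℕ.+ 2 ℕ.* pairs (p c)) planes
      ≡⟨ sum-planes-cong (λ c hc → proj₂ (plane-moments c hc)) ⟩
    sumOver (λ c → 2 ℕ.* pointsOn c ℕ.+ triples (p c)) planes
      ≡⟨ trans (sum-+ _ _ planes) (cong₂ ℕ._+_ (trans (sum-*ˡ 2 _ planes) (cong (2 ℕ.*_) sum-pointsOn)) sum-triples) ⟩
    2 ℕ.* (suc order ℕ.* (order ℕ.* order ℕ.+ suc order)) ℕ.+ triplesOfPoints
      ≡⟨ identity order triplesOfPoints ⟩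
    triplesOfPoints ℕ.+ (2 ℕ.* suc order ℕ.+ 2 ℕ.* (pairsOfPoints ℕ.* suc order)) ∎)
    where
    N = sumOver (λ c → ι (is1CbarPlane c)) planes
    identity : ∀ q t → 2 ℕ.* ((1 ℕ.+ q) ℕ.* (q ℕ.* q ℕ.+ (1 ℕ.+ q))) ℕ.+ t
      ≡ t ℕ.+ (2 ℕ.* (1 ℕ.+ q) ℕ.+ 2 ℕ.* ((1 ℕ.+ q) ℕ.* q ℕ.* (1 ℕ.+ q)))
    identity = solve-∀
    one-point : ∀ c → ι (is1CbarPlane c) ℕ.+ ι (isΓPlane c) ≡ ι (isYes (pointsOn c ℕ.≟ 1))
    one-point c = trans (cong (λ n → ι (not (isΓPlane c) ∧ isYes (n ℕ.≟ 1)) ℕ.+ ι (isΓPlane c)) (countC≡sum (λ v → onPlane v c)))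
      (split (isΓPlane c) (λ h → let X , e = isΓPlane-elim c h in
        isYes-intro (pointsOn c ℕ.≟ 1) (trans (cong pointsOn e) (pointsOn-Γᵖ X))))
      where
      split : ∀ a {b} → (a ≡ true → b ≡ true) → ι (not a ∧ b) ℕ.+ ι a ≡ ι b
      split true  h rewrite h refl = refl
      split false h = ℕₚ.+-identityʳ _
    with-Γ : N ℕ.+ suc order ≡ sumOver (λ c → ι (isYes (pointsOn c ℕ.≟ 1))) planes
    with-Γ = trans (cong (N ℕ.+_) (sym number-of-Γ)) (trans (sym (sum-+ _ _ planes)) (sum-cong one-point planes))

  -- The 2 of the denominator and the 3 of 3(q - 2) combine to the factor 6 of `number-of-3C`, whose
  -- right side is the number of UnΓ-lines.
  average-3C : 2 ℕ.* totalIncidences is3CPlane ≡ (order ℕ.∸ 2) ℕ.* length unΓLines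
  average-3C = begin
    2 ℕ.* totalIncidences is3CPlane
      ≡⟨ cong (2 ℕ.*_) (incidences is3CPlane (3 ℕ.* (order ℕ.∸ 2)) ΛUnΓ-3C) ⟩
    2 ℕ.* (N ℕ.* (3 ℕ.* (order ℕ.∸ 2)))
      ≡⟨ rearrange N (order ℕ.∸ 2) ⟩
    (order ℕ.∸ 2) ℕ.* (6 ℕ.* N)
      ≡⟨ cong ((order ℕ.∸ 2) ℕ.*_) (trans number-of-3C (sym number-of-unΓLines)) ⟩
    (order ℕ.∸ 2) ℕ.* length unΓLines ∎
    where
    N = sumOver (λ c → ι (is3CPlane c)) planes
    rearrange : ∀ n m → 2 ℕ.* (n ℕ.* (3 ℕ.* m)) ≡ m ℕ.* (6 ℕ.* n)
    rearrange = solve-∀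

  average-1Cbar : 2 ℕ.* totalIncidences is1CbarPlane ≡ order ℕ.* length unΓLines
  average-1Cbar = begin
    2 ℕ.* totalIncidences is1CbarPlane
      ≡⟨ cong (2 ℕ.*_) (incidences is1CbarPlane order ΛUnΓ-1Cbar) ⟩
    2 ℕ.* (N ℕ.* order)
      ≡⟨ rearrange N order ⟩
    order ℕ.* (2 ℕ.* N)
      ≡⟨ cong (order ℕ.*_) (trans number-of-1Cbar (sym number-of-unΓLines)) ⟩
    order ℕ.* length unΓLines ∎
    where
    N = sumOver (λ c → ι (is1CbarPlane c)) planes
    rearrange : ∀ n m → 2 ℕ.* (n ℕ.* m) ≡ m ℕ.* (2 ℕ.* n)
    rearrange = solve-∀

open import Defs using (module PG3)
open PG3
open import Data.Nat using (ℕ; _≥_; _*_; _∸_)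
open import Data.Bool using (T)
open import Data.List using (length)
open import Data.Product using (_×_)
open import Relation.Binary.PropositionalEquality using (_≡_)

theorem5p7 : (𝔽 : FiniteField) → IsPrimePower (q 𝔽) → q 𝔽 ≥ 5 →
    ((π : Plane 𝔽) → T (normalised 𝔽 π) → T (is3CPlane 𝔽 π) →
    ΛUnΓ 𝔽 π ≡ 3 * (q 𝔽 ∸ 2))
    × (2 * totalIncidences 𝔽 (is3CPlane 𝔽) ≡ (q 𝔽 ∸ 2) * length (unΓLines 𝔽))
    × ((π : Plane 𝔽) → T (normalised 𝔽 π) → T (is1CbarPlane 𝔽 π) →
    ΛUnΓ 𝔽 π ≡ q 𝔽)
    × (2 * totalIncidences 𝔽 (is1CbarPlane 𝔽) ≡ q 𝔽 * length (unΓLines 𝔽))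
theorem5p7 𝔽 _ q≥5 =
  (λ π hπ h → ΛUnΓ-3C π (T⇒≡ hπ) (T⇒≡ h)) , average-3C ,
  (λ π hπ h → ΛUnΓ-1Cbar π (T⇒≡ hπ) (T⇒≡ h)) , average-1Cbar
  where
  -- From q ≥ 5 the truncated subtraction is exact, and q = 2 + (q - 2) has the required form with r
  -- = q - 2.
  open Counts 𝔽 (q 𝔽 ∸ 2) (sym (ℕₚ.m+[n∸m]≡n (ℕₚ.≤-trans (s≤s (s≤s z≤n)) q≥5)))
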